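{- For all integers $n \geq 0$, \[a_5(49n+31) \equiv 0 \pmod{7} \quad\text{and}\quad a_9(121n+36) \equiv 0 \pmod{11}.\]
   Context: For a positive integer $d$, $a_d(n)$ denotes the number of partitions of $n$ in which the odd parts are unrestricted and each even part may independently be assigned one of $d$ colors; equivalently $\sum_{n\ge0}a_d(n)q^n = \prod_{k\ge1}\frac{1}{(1-q^k)(1-q^{2k})^{d-1}}$. -}

module Defs where

open import Data.Nat using (ℕ; zero; suc; _+_; _*_; _∸_; _≤?_)
open import Relation.Nullary using (yes; no)

-- Formal power series over ℕ, represented by their coefficient sequences.
Series : Set
Series = ℕ → ℕ

one : Series
one zero    = 1
one (suc _) = 0

-- Coefficient n of f(q) / (1 - q^m) for m ≥ 1, i.e. Σ_{j ≥ 0, j*m ≤ n} f(n - j*m).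
-- Computed with fuel j (number of terms remaining); term j is f(n - j*m) when j*m ≤ n.
private
  geomSum : Series → ℕ → ℕ → ℕ → ℕ
  geomSum f m n zero    = f n
  geomSum f m n (suc j) with suc j * m ≤? n
  ... | yes _ = f (n ∸ suc j * m) + geomSum f m n j
  ... | no  _ = geomSum f m n j

divGeom : ℕ → Series → Series
divGeom m f n = geomSum f m n n

iter : ℕ → (Series → Series) → Series → Series
iter zero    t f = f
iter (suc r) t f = t (iter r t f)

factor : ℕ → ℕ → Series → Series
factor d k f = iter (d ∸ 1) (divGeom (2 * k)) (divGeom k f)

partialProd : ℕ → ℕ → Series
partialProd d zero    = one
partialProd d (suc N) = factor d (suc N) (partialProd d N)

-- a_d(n): coefficient of q^n in ∏_{k≥1} 1/((1-q^k)(1-q^{2k})^{d-1}).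
-- Factors with k > n do not affect the coefficient of q^n, so the product over
-- k = 1..n gives the exact coefficient.
a : ℕ → ℕ → ℕ
a d n = partialProd d n n

-- Write E_k = ∏ (1 - q^(ki)) and G = E₂³/E₁.  Modulo the prime p = d + 2 one has E₂ᵖ ≡ E_2p, so
-- Σ a_d(n) qⁿ = 1/(E₁ E₂^(d-1)) = G/E₂ᵖ ≡ G/E_2p for d = 5, 9.
--
-- By Gauss (E₂²/E₁ = Σ q^(m(m+1)/2)) and Euler (for E₂), G = Σ (-1)^k q^(m(m+1)/2 + k(3k-1)).  With
-- x = 2m + 1 and y = 6k - 1 the exponent n satisfies 24n + 5 = 3x² + 2y².  For p = 7 and p = 11 the
-- solutions with p ∣ 24n + 5 are permuted by reflections of the lattice that reverse the sign (-1)^k,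
-- so the coefficient of qⁿ in G is 0 whenever p divides 24n + 5 exactly once.
--
-- In the coefficient of q^(49n+31), resp. q^(121n+36), of G/E_2p only the partition numbers p(7j+5),
-- resp. p(11j+6), survive, and these vanish by Ramanujan's congruences.  For p = 7, 1/E₁ ≡ (E₁³)²/E₇
-- and the exponents in Jacobi's series for E₁³ are 0, 1, 3 modulo 7.  For p = 11 (Hirschhorn),
-- Jacobi's series J = E₁³ has five residue classes modulo 11, Euler's theorem kills five components of
-- J⁴ ≡ E₁ E₁₁, and these quartic relations imply that the relevant component of J⁷ ≡ E₁₁²/E₁ is 0.

module Submission where

-- Infinite products never occur. The identities of Gauss, Jacobi and Euler are proved in any
-- commutative ring for a nilpotent q, all from one finite triple product. The ring is then ℤ[[q]]
-- modulo p and q^(N+1), where N is the index of the coefficient in question, and the identities are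
-- applied to X, X² and X^(2p). Jacobi's identity is classically a limit of the triple product; to
-- avoid the limit, the triple product is stated for any weights that satisfy its three-term
-- recurrence.
--
-- The two vanishing mechanisms complement each other. Let i + j = 49n + 31 with j = 14k an exponent
-- of 1/E_14. As 24 · 31 + 5 = 7 · 107, always 7 ∣ 24i + 5, and 49 ∣ 24i + 5 exactly when j ≡ 21
-- (mod 49), that is k ≡ 5 (mod 7), where Ramanujan's congruence takes over. Likewise 24 · 36 + 5 =
-- 11 · 79, and for j = 22k the exceptional class j ≡ 11 (mod 121) is k ≡ 6 (mod 11). The theta half
-- holds over ℤ, while the Ramanujan half needs residues modulo p².

open import Algebra.Bundles using (CommutativeRing)
open import Data.Nat as ℕ using (ℕ)

-- Exponents and coefficients of the theta series

module ThetaExponents where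

  open import Data.Integer as ℤ using (ℤ; +_)
  import Data.Integer.Solver as ℤ
  open import Data.Nat as ℕ using (ℕ; zero; suc; _≤_; z≤n)
  import Data.Nat.Properties as ℕ
  open import Relation.Binary.PropositionalEquality as ≡ using (_≡_)

  -- `pent m` is m(3m - 1)/2. The generalised pentagonal number at the index -1 - m is `pent m` + 4m
  -- + 2.
  tri pent : ℕ → ℕ
  tri zero     = 0
  tri (suc m)  = suc m ℕ.+ tri m
  pent zero    = 0
  pent (suc m) = m ℕ.+ (m ℕ.+ m) ℕ.+ 1 ℕ.+ pent m

  m≤tri : ∀ m → m ≤ tri m
  m≤tri zero    = z≤n
  m≤tri (suc m) = ℕ.m≤m+n (suc m) (tri m)

  m≤pent : ∀ m → m ≤ pent m
  m≤pent zero    = z≤n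
  m≤pent (suc m) = ℕ.≤-trans (ℕ.≤-reflexive (ℕ.+-comm 1 m))
    (ℕ.≤-trans (ℕ.+-monoˡ-≤ 1 (ℕ.m≤m+n m (m ℕ.+ m))) (ℕ.m≤m+n _ (pent m)))

  sgn jac : ℕ → ℤ
  sgn zero    = + 1
  sgn (suc m) = ℤ.- sgn m
  jac m = sgn m ℤ.* + suc (m ℕ.+ m)

  -- `jac m` is (-1)^m times a linear polynomial in m, hence a solution of the recurrence with
  -- characteristic polynomial (S + 1)². This feeds the three-term recurrence for the weights of
  -- Jacobi's identity.
  jac-recurrence : ∀ m → jac (suc (suc m)) ≡ ℤ.- (+ 2) ℤ.* jac (suc m) ℤ.- jac m
  jac-recurrence m rewrite ℕ.+-suc m (suc m) | ℕ.+-suc m m =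
    ℤ.+-*-Solver.solve 2 (λ s k → (:- (:- s)) :* (con (+ 5) :+ k)
      := (:- con (+ 2)) :* ((:- s) :* (con (+ 3) :+ k)) :- s :* (con (+ 1) :+ k)) ≡.refl (sgn m) (+ (m ℕ.+ m))
    where open ℤ.+-*-Solver

-- Integer constants and the ring solver in an arbitrary commutative ring

module IntegerCoefficients {c ℓ} (R : CommutativeRing c ℓ) where

  open import Algebra.Solver.Ring.AlmostCommutativeRing
    using (fromCommutativeRing; _-Raw-AlmostCommutative⟶_)
  open import Data.Integer as ℤ using (ℤ; +_; -[1+_])
  import Data.Integer.Properties as ℤ
  open import Data.Maybe.Base using (Maybe; just; nothing)
  open import Data.Nat as ℕ using (ℕ; zero; suc)
  import Data.Nat.Properties as ℕ
  open import Relation.Binary.PropositionalEquality as ≡ using (_≡_)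
  open import Relation.Nullary using (yes; no)

  open CommutativeRing R
  open import Algebra.Properties.Ring ring
  open import Algebra.Properties.AbelianGroup +-abelianGroup using (⁻¹-∙-comm)
  open import Algebra.Properties.Semiring.Mult.TCOptimised semiring
    using (_×_; 1+×; ×-homo-+; ×1-homo-*)
  open import Relation.Binary.Reasoning.Setoid setoid

  fromℤ : ℤ → Carrier
  fromℤ (+ n)    = n × 1#
  fromℤ -[1+ n ] = - (ℕ.suc n × 1#)

  fromℤ-neg : ∀ i → fromℤ (ℤ.- i) ≈ - fromℤ i
  fromℤ-neg (+ zero)  = sym -0#≈0#
  fromℤ-neg (+ suc n) = refl
  fromℤ-neg -[1+ n ]  = sym (-‿involutive _)

  fromℤ-⊖ : ∀ m n → fromℤ (m ℤ.⊖ n) ≈ m × 1# - n × 1#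
  fromℤ-⊖ m       zero    = sym (trans (+-congˡ -0#≈0#) (+-identityʳ _))
  fromℤ-⊖ zero    (suc n) = sym (+-identityˡ _)
  fromℤ-⊖ (suc m) (suc n) = begin
    fromℤ (suc m ℤ.⊖ suc n)              ≡⟨ ≡.cong fromℤ (ℤ.[1+m]⊖[1+n]≡m⊖n m n) ⟩
    fromℤ (m ℤ.⊖ n)                      ≈⟨ fromℤ-⊖ m n ⟩
    m × 1# - n × 1#                      ≈⟨ +-congʳ (+-identityʳ _) ⟨
    (m × 1# + 0#) - n × 1#               ≈⟨ +-congʳ (+-congˡ (-‿inverseʳ 1#)) ⟨
    (m × 1# + (1# - 1#)) - n × 1#        ≈⟨ +-congʳ (+-assoc _ _ _) ⟨
    (m × 1# + 1# - 1#) - n × 1#          ≈⟨ +-assoc _ _ _ ⟩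
    (m × 1# + 1#) + (- 1# - n × 1#)      ≈⟨ +-cong (+-comm _ _) (⁻¹-∙-comm _ _) ⟩
    (1# + m × 1#) - (1# + n × 1#)        ≈⟨ +-cong (1+× m 1#) (-‿cong (1+× n 1#)) ⟨
    suc m × 1# - suc n × 1#              ∎

  fromℤ-+ : ∀ i j → fromℤ (i ℤ.+ j) ≈ fromℤ i + fromℤ j
  fromℤ-+ (+ m)    (+ n)    = ×-homo-+ 1# m n
  fromℤ-+ (+ m)    -[1+ n ] = fromℤ-⊖ m (suc n)
  fromℤ-+ -[1+ m ] (+ n)    = trans (fromℤ-⊖ n (suc m)) (+-comm _ _)
  fromℤ-+ -[1+ m ] -[1+ n ] = begin
    - (suc (suc (m ℕ.+ n)) × 1#)          ≡⟨ ≡.cong (λ k → - (suc k × 1#)) (ℕ.+-suc m n) ⟨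
    - ((suc m ℕ.+ suc n) × 1#)            ≈⟨ -‿cong (×-homo-+ 1# (suc m) (suc n)) ⟩
    - (suc m × 1# + suc n × 1#)           ≈⟨ ⁻¹-∙-comm _ _ ⟨
    - (suc m × 1#) - suc n × 1#           ∎

  fromℤ-*-pos : ∀ m n → fromℤ (+ m ℤ.* + n) ≈ (m × 1#) * (n × 1#)
  fromℤ-*-pos m n = trans (reflexive (≡.cong fromℤ (≡.sym (ℤ.pos-* m n)))) (×1-homo-* m n)

  fromℤ-* : ∀ i j → fromℤ (i ℤ.* j) ≈ fromℤ i * fromℤ j
  fromℤ-* (+ m)    (+ n)    = fromℤ-*-pos m n
  fromℤ-* (+ m)    -[1+ n ] = begin
    fromℤ (+ m ℤ.* -[1+ n ])               ≡⟨ ≡.cong fromℤ (ℤ.neg-distribʳ-* (+ m) (+ suc n)) ⟨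
    fromℤ (ℤ.- (+ m ℤ.* + suc n))          ≈⟨ fromℤ-neg (+ m ℤ.* + suc n) ⟩
    - fromℤ (+ m ℤ.* + suc n)              ≈⟨ -‿cong (fromℤ-*-pos m (suc n)) ⟩
    - ((m × 1#) * (suc n × 1#))            ≈⟨ -‿distribʳ-* _ _ ⟩
    (m × 1#) * - (suc n × 1#)              ∎
  fromℤ-* -[1+ m ] (+ n)    = begin
    fromℤ (-[1+ m ] ℤ.* + n)               ≡⟨ ≡.cong fromℤ (ℤ.neg-distribˡ-* (+ suc m) (+ n)) ⟨
    fromℤ (ℤ.- (+ suc m ℤ.* + n))          ≈⟨ fromℤ-neg (+ suc m ℤ.* + n) ⟩
    - fromℤ (+ suc m ℤ.* + n)              ≈⟨ -‿cong (fromℤ-*-pos (suc m) n) ⟩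
    - ((suc m × 1#) * (n × 1#))            ≈⟨ -‿distribˡ-* _ _ ⟩
    - (suc m × 1#) * (n × 1#)              ∎
  fromℤ-* -[1+ m ] -[1+ n ] = begin
    (suc m ℕ.* suc n) × 1#                 ≈⟨ ×1-homo-* (suc m) (suc n) ⟩
    (suc m × 1#) * (suc n × 1#)            ≈⟨ -‿involutive _ ⟨
    - - ((suc m × 1#) * (suc n × 1#))      ≈⟨ -‿cong (-‿distribˡ-* _ _) ⟩
    - (- (suc m × 1#) * (suc n × 1#))      ≈⟨ -‿distribʳ-* _ _ ⟩
    - (suc m × 1#) * - (suc n × 1#)        ∎

  fromℤ-homomorphism : ℤ.+-*-rawRing -Raw-AlmostCommutative⟶ fromCommutativeRing R
  fromℤ-homomorphism = record
    { ⟦_⟧    = fromℤ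
    ; +-homo = fromℤ-+
    ; *-homo = fromℤ-*
    ; -‿homo = fromℤ-neg
    ; 0-homo = refl
    ; 1-homo = refl
    }

  fromℤ-≟ : ∀ i j → Maybe (fromℤ i ≈ fromℤ j)
  fromℤ-≟ i j with i ℤ.≟ j
  ... | yes ≡.refl = just refl
  ... | no  _      = nothing

  open import Algebra.Solver.Ring ℤ.+-*-rawRing (fromCommutativeRing R) fromℤ-homomorphism fromℤ-≟ public
    using (solve; _:=_; _:+_; _:*_; _:-_; :-_; _:^_; con; Polynomial)

-- The finite Jacobi triple product for nilpotent q

module TripleProduct {c ℓ} (R : CommutativeRing c ℓ) where

  open import Data.Nat as ℕ using (ℕ; zero; suc; _∸_; _≤_; _<_; s≤s)
  import Data.Nat.Properties as ℕ
  open import Data.Sum using (_⊎_; inj₁; inj₂)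
  open import Relation.Binary.PropositionalEquality as ≡ using (_≡_)

  open CommutativeRing R
  open import Algebra.Properties.Ring ring
  open import Algebra.Properties.CommutativeSemiring.Exp commutativeSemiring public
  open import Relation.Binary.Reasoning.Setoid setoid
  open IntegerCoefficients R public

  ∑ ∏ : ℕ → (ℕ → Carrier) → Carrier
  ∑ zero    f = 0#
  ∑ (suc n) f = ∑ n f + f n
  ∏ zero    f = 1#
  ∏ (suc n) f = ∏ n f * f n

  ∑-cong : ∀ n {f g} → (∀ i → i < n → f i ≈ g i) → ∑ n f ≈ ∑ n g
  ∑-cong zero    eq = refl
  ∑-cong (suc n) eq = +-cong (∑-cong n (λ i i<n → eq i (ℕ.m<n⇒m<1+n i<n))) (eq n ℕ.≤-refl)

  ∏-cong : ∀ n {f g} → (∀ i → i < n → f i ≈ g i) → ∏ n f ≈ ∏ n g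
  ∏-cong zero    eq = refl
  ∏-cong (suc n) eq = *-cong (∏-cong n (λ i i<n → eq i (ℕ.m<n⇒m<1+n i<n))) (eq n ℕ.≤-refl)

  *-distribˡ-∑ : ∀ n x f → x * ∑ n f ≈ ∑ n (λ i → x * f i)
  *-distribˡ-∑ zero    x f = zeroʳ x
  *-distribˡ-∑ (suc n) x f = trans (distribˡ x _ _) (+-congʳ (*-distribˡ-∑ n x f))

  ∏-* : ∀ n f g → ∏ n (λ i → f i * g i) ≈ ∏ n f * ∏ n g
  ∏-* zero    f g = sym (*-identityˡ 1#)
  ∏-* (suc n) f g = trans (*-congʳ (∏-* n f g))
    (solve 4 (λ a b x y → (a :* b) :* (x :* y) := (a :* x) :* (b :* y)) refl _ _ _ _)

  ∏-one : ∀ n {f} → (∀ i → f i ≈ 1#) → ∏ n f ≈ 1#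
  ∏-one zero    eq = refl
  ∏-one (suc n) eq = trans (*-cong (∏-one n eq) (eq n)) (*-identityʳ 1#)

  ∏-stable : ∀ {n} f k → (∀ i → n ≤ i → f i ≈ 1#) → ∏ (k ℕ.+ n) f ≈ ∏ n f
  ∏-stable f zero    eq = refl
  ∏-stable f (suc k) eq = trans (*-cong (∏-stable f k eq) (eq _ (ℕ.m≤n+m _ k))) (*-identityʳ _)

  ∏-^ : ∀ n f k → ∏ n (λ i → f i ^ k) ≈ ∏ n f ^ k
  ∏-^ n f zero    = ∏-one n (λ _ → refl)
  ∏-^ n f (suc k) = trans (∏-* n f (λ i → f i ^ k)) (*-congˡ (∏-^ n f k))

  geometric : ∀ x n → (1# - x) * ∑ n (x ^_) ≈ 1# - x ^ n
  geometric x zero    = trans (zeroʳ _) (sym (-‿inverseʳ 1#))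
  geometric x (suc n) = begin
    (1# - x) * (∑ n (x ^_) + x ^ n)              ≈⟨ distribˡ _ _ _ ⟩
    (1# - x) * ∑ n (x ^_) + (1# - x) * x ^ n     ≈⟨ +-congʳ (geometric x n) ⟩
    (1# - x ^ n) + (1# - x) * x ^ n
      ≈⟨ solve 2 (λ x p → (con (ℤ.+ 1) :- p) :+ (con (ℤ.+ 1) :- x) :* p := con (ℤ.+ 1) :- x :* p) refl x (x ^ n) ⟩
    1# - x ^ suc n                               ∎
    where import Data.Integer as ℤ

  module Nilpotent (q : Carrier) (K : ℕ) (q^K≈0 : q ^ K ≈ 0#) where

    open import Data.Integer using (+_)

    private
      one : ∀ {n} → Polynomial n
      one = con (+ 1)

    ^-vanish : ∀ {k} → K ≤ k → q ^ k ≈ 0#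
    ^-vanish {k} K≤k = begin
      q ^ k                   ≡⟨ ≡.cong (q ^_) (ℕ.m+[n∸m]≡n K≤k) ⟨
      q ^ (K ℕ.+ (k ∸ K))     ≈⟨ ^-homo-* q K (k ∸ K) ⟩
      q ^ K * q ^ (k ∸ K)     ≈⟨ *-congʳ q^K≈0 ⟩
      0# * q ^ (k ∸ K)        ≈⟨ zeroˡ _ ⟩
      0#                      ∎

    -- The q-Pochhammer symbol (q; q)_n and its inverse: since q^K ≈ 0, geometric sums with K terms
    -- are exact inverses of the factors 1 - q^i.
    poch poch⁻¹ : ℕ → Carrier
    poch   n = ∏ n (λ i → 1# - q ^ suc i)
    poch⁻¹ n = ∏ n (λ i → ∑ K ((q ^ suc i) ^_))

    1-q^i-inverse : ∀ i → (1# - q ^ suc i) * ∑ K ((q ^ suc i) ^_) ≈ 1#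
    1-q^i-inverse i = begin
      (1# - q ^ suc i) * ∑ K ((q ^ suc i) ^_)   ≈⟨ geometric (q ^ suc i) K ⟩
      1# - (q ^ suc i) ^ K                      ≈⟨ +-congˡ (-‿cong (^-assocʳ q (suc i) K)) ⟩
      1# - q ^ (suc i ℕ.* K)                    ≈⟨ +-congˡ (-‿cong (^-vanish (ℕ.m≤m+n K (i ℕ.* K)))) ⟩
      1# - 0#                                   ≈⟨ +-congˡ -0#≈0# ⟩
      1# + 0#                                   ≈⟨ +-identityʳ 1# ⟩
      1#                                        ∎

    poch-inverse : ∀ n → poch n * poch⁻¹ n ≈ 1#
    poch-inverse n = trans (sym (∏-* n _ _)) (∏-one n 1-q^i-inverse)

    poch⁻¹-pred : ∀ n → poch⁻¹ n ≈ (1# - q ^ suc n) * poch⁻¹ (suc n)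
    poch⁻¹-pred n = begin
      poch⁻¹ n                                                  ≈⟨ *-identityʳ _ ⟨
      poch⁻¹ n * 1#                                             ≈⟨ *-congˡ (1-q^i-inverse n) ⟨
      poch⁻¹ n * ((1# - q ^ suc n) * ∑ K ((q ^ suc n) ^_))
        ≈⟨ solve 3 (λ a b c → a :* (b :* c) := b :* (a :* c)) refl _ _ _ ⟩
      (1# - q ^ suc n) * poch⁻¹ (suc n)                         ∎

    1-q^i-stable : ∀ {k} → K ≤ k → 1# - q ^ k ≈ 1#
    1-q^i-stable K≤k = trans (+-congˡ (trans (-‿cong (^-vanish K≤k)) -0#≈0#)) (+-identityʳ 1#)

    poch-stable : ∀ {k} → K ≤ k → poch k ≈ poch K
    poch-stable {k} K≤k = begin
      poch k                  ≡⟨ ≡.cong poch (ℕ.m∸n+n≡m K≤k) ⟨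
      poch (k ∸ K ℕ.+ K)      ≈⟨ ∏-stable _ (k ∸ K) (λ i K≤i → 1-q^i-stable (ℕ.m≤n⇒m≤1+n K≤i)) ⟩
      poch K                  ∎

    poch⁻¹-unique : ∀ {k} → K ≤ k → poch K * poch⁻¹ k ≈ 1#
    poch⁻¹-unique {k} K≤k = trans (*-congʳ (sym (poch-stable K≤k))) (poch-inverse k)

    -- The finite Jacobi triple product, folded under j ↔ -1-j.  For
    -- c = a + bq with ab = q it is the expansion of
    -- ∏ (1 + a qⁱ)(1 + b qⁱ⁺¹) with w m = a^(m(m+1)/2) b^(m(m-1)/2) (1 + b²ᵐ⁺¹),
    -- up to a constant factor; t n d m is the q-binomial coefficient
    -- [2n+1 choose n-m] when d = n - m, and w (m ∸ 1) is w 0 at m = 0.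
    module Triple (c : Carrier) (w : ℕ → Carrier)
      (recurrence : ∀ m → q ^ m * (c * w m) ≈ w (suc m) + q ^ suc (m ℕ.+ m) * w (m ∸ 1))
      where

      factor : ℕ → Carrier
      factor n = 1# + c * q ^ n + q ^ suc (suc (n ℕ.+ n))

      -- Multiplication by `factor n` produces c q^n w m, which the recurrence splits into multiples
      -- of w (m + 1) and w (m - 1). For d = n + 1 - m, `u` is what summand m - 1 passes up to m,
      -- and `v` is what summand m passes down to m - 1. In `v` the product (1 - q^d) `poch⁻¹ d`
      -- stands for `poch⁻¹ (d - 1)` and makes the term 0 at d = 0.
      t u v : ℕ → ℕ → ℕ → Carrier
      t n d m = poch (suc (n ℕ.+ n)) * (poch⁻¹ d * poch⁻¹ (suc (n ℕ.+ m)))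
      u n d m = q ^ d * (poch (suc (n ℕ.+ n)) * (poch⁻¹ d * poch⁻¹ (n ℕ.+ m)) * w m)
      v n d m = q ^ suc (n ℕ.+ m) *
        (poch (suc (n ℕ.+ n)) * ((1# - q ^ d) * poch⁻¹ d * poch⁻¹ (suc (n ℕ.+ m))) * w (m ∸ 1))

      module Step (m d : ℕ) where
        n : ℕ
        n = m ℕ.+ d
        x y z W W⁻ : Carrier
        x = q ^ d
        y = q ^ m
        z = poch (suc (n ℕ.+ n)) * (poch⁻¹ (suc d) * poch⁻¹ (suc (suc (n ℕ.+ m))))
        W = w m
        W⁻ = w (m ∸ 1)

        q^n : q ^ n ≈ y * x
        q^n = ^-homo-* q m d
        q^2n : q ^ (n ℕ.+ n) ≈ (y * x) * (y * x)
        q^2n = trans (^-homo-* q n n) (*-cong q^n q^n)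
        q^n+m : q ^ (n ℕ.+ m) ≈ (y * x) * y
        q^n+m = trans (^-homo-* q n m) (*-congʳ q^n)

        W⁺ : w (suc m) ≈ y * (c * W) - q * (y * y) * W⁻
        W⁺ = begin
          w (suc m)                                                              ≈⟨ +-identityʳ _ ⟨
          w (suc m) + 0#                                                         ≈⟨ +-congˡ (-‿inverseʳ _) ⟨
          w (suc m) + (q ^ suc (m ℕ.+ m) * W⁻ - q ^ suc (m ℕ.+ m) * W⁻)          ≈⟨ +-assoc _ _ _ ⟨
          (w (suc m) + q ^ suc (m ℕ.+ m) * W⁻) - q ^ suc (m ℕ.+ m) * W⁻          ≈⟨ +-congʳ (recurrence m) ⟨
          y * (c * W) - q ^ suc (m ℕ.+ m) * W⁻                                   ≈⟨ +-congˡ (-‿cong (*-congʳ (*-congˡ (^-homo-* q m m)))) ⟩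
          y * (c * W) - q * (y * y) * W⁻                                         ∎

        x₁ y₁ y₂ : Carrier
        x₁ = 1# - q * x
        y₁ = 1# - q * ((y * x) * y)
        y₂ = 1# - q * (q * ((y * x) * y))

        ι-d : poch⁻¹ d ≈ x₁ * poch⁻¹ (suc d)
        ι-d = poch⁻¹-pred d
        ι-n+m+1 : poch⁻¹ (suc (n ℕ.+ m)) ≈ y₂ * poch⁻¹ (suc (suc (n ℕ.+ m)))
        ι-n+m+1 = trans (poch⁻¹-pred (suc (n ℕ.+ m))) (*-congʳ (+-congˡ (-‿cong (*-congˡ (*-congˡ q^n+m)))))
        ι-n+m : poch⁻¹ (n ℕ.+ m) ≈ y₁ * (y₂ * poch⁻¹ (suc (suc (n ℕ.+ m))))
        ι-n+m = trans (poch⁻¹-pred (n ℕ.+ m)) (*-cong (+-congˡ (-‿cong (*-congˡ q^n+m))) ι-n+m+1)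

        t-mid : t n d m ≈ x₁ * y₂ * z
        t-mid = trans (*-congˡ (*-cong ι-d ι-n+m+1))
          (solve 5 (λ p x a y b → p :* ((x :* a) :* (y :* b)) := x :* y :* (p :* (a :* b))) refl _ _ _ _ _)

        t-next : t (suc n) (suc d) m ≈ (1# - q * (q * ((y * x) * (y * x)))) * (1# - q * (q * (q * ((y * x) * (y * x))))) * z
        t-next = begin
          poch (suc (suc n ℕ.+ suc n)) * ι     ≡⟨ ≡.cong (λ k → poch (suc (suc k)) * ι) (ℕ.+-suc n n) ⟩
          (p * (1# - q ^ suc (suc (n ℕ.+ n))) * (1# - q ^ suc (suc (suc (n ℕ.+ n))))) * ι
            ≈⟨ *-congʳ (*-cong (*-congˡ (+-congˡ (-‿cong (*-congˡ (*-congˡ q^2n))))) (+-congˡ (-‿cong (*-congˡ (*-congˡ (*-congˡ q^2n)))))) ⟩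
          (p * (1# - q * (q * ((y * x) * (y * x)))) * (1# - q * (q * (q * ((y * x) * (y * x)))))) * ι
            ≈⟨ solve 4 (λ p a b i → (p :* a :* b) :* i := a :* b :* (p :* i)) refl _ _ _ _ ⟩
          (1# - q * (q * ((y * x) * (y * x)))) * (1# - q * (q * (q * ((y * x) * (y * x))))) * z ∎
          where
          p ι : Carrier
          p = poch (suc (n ℕ.+ n))
          ι = poch⁻¹ (suc d) * poch⁻¹ (suc (suc (n ℕ.+ m)))

        u-mid : u n (suc d) m ≈ q * x * (y₁ * y₂ * z * W)
        u-mid = *-congˡ (*-congʳ (trans (*-congˡ (*-congˡ ι-n+m))
          (solve 5 (λ p a y y′ b → p :* (a :* (y :* (y′ :* b))) := y :* y′ :* (p :* (a :* b))) refl _ _ _ _ _)))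

        v-mid : v n (suc d) m ≈ q * ((y * x) * y) * (x₁ * y₂ * z * W⁻)
        v-mid = *-cong (*-congˡ q^n+m) (*-congʳ (trans (*-congˡ (*-congˡ ι-n+m+1))
          (solve 5 (λ p x a y b → p :* ((x :* a) :* (y :* b)) := x :* y :* (p :* (a :* b))) refl _ _ _ _ _)))

        u-next : u n d (suc m) ≈ x * (x₁ * y₂ * z * (y * (c * W) - q * (y * y) * W⁻))
        u-next = *-congˡ (*-cong (trans (*-congˡ (*-congˡ (reflexive (≡.cong poch⁻¹ (ℕ.+-suc n m))))) t-mid) W⁺)

        v-next : v n d (suc m) ≈ q * (q * ((y * x) * y)) * ((1# - x) * x₁ * z * W)
        v-next = *-cong (trans (*-congˡ (reflexive (≡.cong (q ^_) (ℕ.+-suc n m)))) (*-congˡ (*-congˡ q^n+m)))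
          (*-congʳ (trans (*-congˡ (*-cong (*-congˡ ι-d) (reflexive (≡.cong (λ k → poch⁻¹ (suc k)) (ℕ.+-suc n m)))))
          (solve 5 (λ p e x a b → p :* ((e :* (x :* a)) :* b) := e :* x :* (p :* (a :* b))) refl _ _ _ _ _)))

        factor-n : factor n ≈ 1# + c * (y * x) + q * (q * ((y * x) * (y * x)))
        factor-n = +-cong (+-congˡ (*-congˡ q^n)) (*-congˡ (*-congˡ q^2n))

        -- With n = m + d, all powers of q are monomials in q, x = q^d and y = q^m, and all inverses
        -- have been brought to the common factor z. What is left is a single polynomial identity.
        step : t (suc n) (suc d) m * W + v n (suc d) m + u n d (suc m)
             ≈ factor n * (t n d m * W) + v n d (suc m) + u n (suc d) m
        step = begin
          t (suc n) (suc d) m * W + v n (suc d) m + u n d (suc m)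
            ≈⟨ +-cong (+-cong (*-congʳ t-next) v-mid) u-next ⟩
          _ ≈⟨ solve 7 (λ q x y c z W W⁻ →
               let x₁ = one :- q :* x
                   y₁ = one :- q :* ((y :* x) :* y)
                   y₂ = one :- q :* (q :* ((y :* x) :* y))
               in (one :- q :* (q :* ((y :* x) :* (y :* x)))) :* (one :- q :* (q :* (q :* ((y :* x) :* (y :* x))))) :* z :* W
                  :+ q :* ((y :* x) :* y) :* (x₁ :* y₂ :* z :* W⁻)
                  :+ x :* (x₁ :* y₂ :* z :* (y :* (c :* W) :- q :* (y :* y) :* W⁻))
                  := (one :+ c :* (y :* x) :+ q :* (q :* ((y :* x) :* (y :* x)))) :* (x₁ :* y₂ :* z :* W)
                  :+ q :* (q :* ((y :* x) :* y)) :* ((one :- x) :* x₁ :* z :* W)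
                  :+ q :* x :* (y₁ :* y₂ :* z :* W)) refl q x y c z W W⁻ ⟩
          _ ≈⟨ +-cong (+-cong (*-cong factor-n (*-congʳ t-mid)) v-next) u-mid ⟨
          factor n * (t n d m * W) + v n d (suc m) + u n (suc d) m ∎

      step-at : ∀ {n m d} → m ℕ.+ d ≡ n →
        t (suc n) (suc d) m * w m + v n (suc d) m + u n d (suc m)
        ≈ factor n * (t n d m * w m) + v n d (suc m) + u n (suc d) m
      step-at {m = m} {d} ≡.refl = Step.step m d

      -- Telescoping of `step`: the sum left of m passes from n to n + 1 correctly up to the flows
      -- `u` and `v` across the gap between m - 1 and m. At m = 0 the two flows agree, by the
      -- symmetry w (-1) = w 0 of the folded sum.
      partial-sum : ∀ n m → m ≤ suc n →
        ∑ m (λ i → t (suc n) (suc n ∸ i) i * w i) + u n (suc n ∸ m) m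
        ≈ factor n * ∑ m (λ i → t n (n ∸ i) i * w i) + v n (suc n ∸ m) m
      partial-sum n zero _ = begin
        0# + u n (suc n) 0                    ≈⟨ +-identityˡ _ ⟩
        u n (suc n) 0                         ≈⟨ *-cong (q^[n+0] (suc n)) (*-congʳ (*-congˡ (trans (*-comm _ _) (*-cong ι-n (reflexive (≡.cong (λ k → poch⁻¹ (suc k)) (≡.sym (ℕ.+-identityʳ n)))))))) ⟩
        v n (suc n) 0                         ≈⟨ +-identityˡ _ ⟨
        0# + v n (suc n) 0                    ≈⟨ +-congʳ (zeroʳ _) ⟨
        factor n * 0# + v n (suc n) 0         ∎
        where
        q^[n+0] : ∀ n → q ^ n ≈ q ^ (n ℕ.+ 0)
        q^[n+0] n = reflexive (≡.cong (q ^_) (≡.sym (ℕ.+-identityʳ n)))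
        ι-n : poch⁻¹ (n ℕ.+ 0) ≈ (1# - q ^ suc n) * poch⁻¹ (suc n)
        ι-n = trans (reflexive (≡.cong poch⁻¹ (ℕ.+-identityʳ n))) (poch⁻¹-pred n)
      partial-sum n (suc m) (s≤s m≤n) = begin
        (S′ + a) + d                ≈⟨ solve 3 (λ s a d → (s :+ a) :+ d := s :+ (a :+ d)) refl _ _ _ ⟩
        S′ + (a + d)                ≈⟨ +-congʳ (cancel ih) ⟩
        (F + b - e) + (a + d)       ≈⟨ solve 5 (λ f b e a d → (f :+ b :- e) :+ (a :+ d) := (f :- e) :+ (a :+ b :+ d)) refl _ _ _ _ _ ⟩
        (F - e) + (a + b + d)       ≈⟨ +-congˡ st ⟩
        (F - e) + (f * g + h + e)   ≈⟨ solve 5 (λ F e f g h → (F :- e) :+ (f :* g :+ h :+ e) := F :+ f :* g :+ h) refl _ _ _ _ _ ⟩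
        F + f * g + h               ≈⟨ +-congʳ (distribˡ f _ _) ⟨
        f * (S + g) + h             ∎
        where
        k = n ∸ m
        S′ = ∑ m (λ i → t (suc n) (suc n ∸ i) i * w i)
        S  = ∑ m (λ i → t n (n ∸ i) i * w i)
        a = t (suc n) (suc n ∸ m) m * w m
        b = v n (suc n ∸ m) m
        d = u n k (suc m)
        e = u n (suc n ∸ m) m
        f = factor n
        F = f * S
        g = t n k m * w m
        h = v n k (suc m)
        ih : S′ + e ≈ F + b
        ih = partial-sum n m (ℕ.m≤n⇒m≤1+n m≤n)
        st : a + b + d ≈ f * g + h + e
        st rewrite ℕ.+-∸-assoc 1 m≤n = step-at (ℕ.m+[n∸m]≡n m≤n)
        cancel : ∀ {s e r} → s + e ≈ r → s ≈ r - e
        cancel {s} {e} {r} eq = begin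
          s              ≈⟨ solve 2 (λ s e → s := (s :+ e) :- e) refl s e ⟩
          (s + e) - e    ≈⟨ +-congʳ eq ⟩
          r - e          ∎

      finite : ∀ n → ∑ (suc n) (λ i → t n (n ∸ i) i * w i) ≈ w 0 * ∏ n factor
      finite zero = begin
        0# + t 0 0 0 * w 0     ≈⟨ +-identityˡ _ ⟩
        t 0 0 0 * w 0          ≈⟨ *-congʳ (trans (*-congˡ (*-identityˡ _)) (poch-inverse 1)) ⟩
        1# * w 0               ≈⟨ *-comm _ _ ⟩
        w 0 * 1#               ∎
      finite (suc n) = begin
        S′ + t (suc n) (n ∸ n) (suc n) * w (suc n)   ≈⟨ +-congˡ (*-congʳ (t-diag (suc n))) ⟩
        S′ + 1# * w (suc n)                          ≈⟨ +-congˡ (*-congʳ (t-diag n)) ⟨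
        S′ + t n (n ∸ n) n * w (suc n)               ≈⟨ +-congˡ u-last ⟨
        S′ + u n (n ∸ n) (suc n)                     ≈⟨ partial-sum n (suc n) ℕ.≤-refl ⟩
        factor n * S + v n (n ∸ n) (suc n)           ≈⟨ +-cong (*-congˡ (finite n)) v-last ⟩
        factor n * (w 0 * ∏ n factor) + 0#           ≈⟨ solve 3 (λ f w p → f :* (w :* p) :+ con (+ 0) := w :* (p :* f)) refl _ _ _ ⟩
        w 0 * (∏ n factor * factor n)                ∎
        where
        S′ = ∑ (suc n) (λ i → t (suc n) (suc n ∸ i) i * w i)
        S  = ∑ (suc n) (λ i → t n (n ∸ i) i * w i)
        t-diag : ∀ n → t n (n ∸ n) n ≈ 1#
        t-diag n rewrite ℕ.n∸n≡0 n = trans (*-congˡ (*-identityˡ _)) (poch-inverse (suc (n ℕ.+ n)))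
        u-last : u n (n ∸ n) (suc n) ≈ t n (n ∸ n) n * w (suc n)
        u-last rewrite ℕ.n∸n≡0 n | ℕ.+-suc n n = *-identityˡ _
        v-last : v n (n ∸ n) (suc n) ≈ 0#
        v-last rewrite ℕ.n∸n≡0 n = solve 5 (λ x p a b w → x :* (p :* ((one :- one) :* a :* b) :* w) := con (+ 0)) refl _ _ _ _ _

      -- Taking n = 2K is enough: for i < K both n - i and n + i + 1 are at least K, where `poch`
      -- has become constant, so the q-binomial coefficient is 1 / `poch K`; for i ≥ K the weight
      -- itself is 0.
      triple-product : (∀ m → K ≤ m → w m ≈ 0#) →
        poch K * (w 0 * ∏ (K ℕ.+ K) factor) ≈ ∑ (suc (K ℕ.+ K)) w
      triple-product w-vanish = begin
        poch K * (w 0 * ∏ n factor)                              ≈⟨ *-congˡ (finite n) ⟨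
        poch K * ∑ (suc n) (λ i → t n (n ∸ i) i * w i)           ≈⟨ *-distribˡ-∑ (suc n) _ _ ⟩
        ∑ (suc n) (λ i → poch K * (t n (n ∸ i) i * w i))         ≈⟨ ∑-cong (suc n) (λ i _ → term i (ℕ.≤-<-connex K i)) ⟩
        ∑ (suc n) w                                              ∎
        where
        n = K ℕ.+ K
        term : ∀ i → K ≤ i ⊎ i < K → poch K * (t n (n ∸ i) i * w i) ≈ w i
        term i (inj₁ K≤i) = begin
          poch K * (t n (n ∸ i) i * w i)   ≈⟨ *-congˡ (*-congˡ (w-vanish i K≤i)) ⟩
          poch K * (t n (n ∸ i) i * 0#)    ≈⟨ solve 2 (λ p t → p :* (t :* con (+ 0)) := con (+ 0)) refl _ _ ⟩
          0#                               ≈⟨ w-vanish i K≤i ⟨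
          w i                              ∎
        term i (inj₂ i<K) = begin
          poch K * (poch (suc (n ℕ.+ n)) * (a * b) * w i)  ≈⟨ *-congˡ (*-congʳ (*-congʳ (poch-stable K≤2n+1))) ⟩
          poch K * (poch K * (a * b) * w i)  ≈⟨ solve 4 (λ p a b w → p :* (p :* (a :* b) :* w) := (p :* a) :* (p :* b) :* w) refl _ _ _ _ ⟩
          (poch K * a) * (poch K * b) * w i  ≈⟨ *-congʳ (*-cong (poch⁻¹-unique K≤n-i) (poch⁻¹-unique K≤1+n+i)) ⟩
          1# * 1# * w i                      ≈⟨ solve 1 (λ w → one :* one :* w := w) refl _ ⟩
          w i                                ∎
          where
          a = poch⁻¹ (n ∸ i)
          b = poch⁻¹ (suc (n ℕ.+ i))
          K≤n-i : K ≤ n ∸ i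
          K≤n-i = ℕ.≤-trans (ℕ.≤-reflexive (≡.sym (ℕ.m+n∸n≡m K K))) (ℕ.∸-monoʳ-≤ n (ℕ.<⇒≤ i<K))
          K≤n : K ≤ n
          K≤n = ℕ.m≤m+n K K
          K≤1+n+i : K ≤ suc (n ℕ.+ i)
          K≤1+n+i = ℕ.m≤n⇒m≤1+n (ℕ.≤-trans K≤n (ℕ.m≤m+n n i))
          K≤2n+1 : K ≤ suc (n ℕ.+ n)
          K≤2n+1 = ℕ.m≤n⇒m≤1+n (ℕ.≤-trans K≤n (ℕ.m≤m+n n n))

-- The identities of Gauss, Jacobi and Euler

module ThetaIdentities {c ℓ} (R : CommutativeRing c ℓ) where

  open import Data.Integer as ℤ using (ℤ; +_)
  import Data.Integer.Properties as ℤ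
  open import Data.Nat as ℕ using (ℕ; zero; suc; _≤_)
  import Data.Nat.Properties as ℕ
  open import Relation.Binary.PropositionalEquality as ≡ using (_≡_)

  open ThetaExponents

  open CommutativeRing R
  open import Algebra.Properties.Ring ring
  open import Relation.Binary.Reasoning.Setoid setoid
  open TripleProduct R

  module Identities (q : Carrier) (K : ℕ) (q^K≈0 : q ^ K ≈ 0#) where

    private
      one : ∀ {n} → Polynomial n
      one = con (+ 1)

    module N = Nilpotent q K q^K≈0
    open N using (poch; ^-vanish; poch-stable)

    q^k-nilpotent : ∀ k → (q ^ suc k) ^ K ≈ 0#
    q^k-nilpotent k = trans (^-assocʳ q (suc k) K) (^-vanish (ℕ.m≤m+n K (k ℕ.* K)))

    q^2n : ∀ n → q ^ (n ℕ.+ n) ≈ q ^ n * q ^ n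
    q^2n n = ^-homo-* q n n

    module Gauss where
      -- The case a = q, b = 1 of the triple product, with the constant factor 2 removed.
      w : ℕ → Carrier
      w m = q ^ tri m

      recurrence : ∀ m → q ^ m * ((q + q) * w m) ≈ w (suc m) + q ^ suc (m ℕ.+ m) * w (m ℕ.∸ 1)
      recurrence zero = solve 1 (λ q → one :* ((q :+ q) :* one) := q :* one :+ q :* one :* one) refl q
      recurrence (suc m) = begin
        q ^ suc m * ((q + q) * q ^ (suc m ℕ.+ tri m))
          ≈⟨ *-congˡ (*-congˡ (^-homo-* q (suc m) (tri m))) ⟩
        q * y * ((q + q) * (q * y * p))
          ≈⟨ solve 3 (λ q y p → q :* y :* ((q :+ q) :* (q :* y :* p))
               := (q :* (q :* y)) :* ((q :* y) :* p) :+ (q :* ((q :* y) :* (q :* y))) :* p) refl q y p ⟩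
        (q * (q * y)) * ((q * y) * p) + (q * ((q * y) * (q * y))) * p
          ≈⟨ +-cong (trans (^-homo-* q (suc (suc m)) _) (*-congˡ (^-homo-* q (suc m) (tri m))))
                    (*-congʳ (*-congˡ (q^2n (suc m)))) ⟨
        q ^ tri (suc (suc m)) + q ^ suc (suc m ℕ.+ suc m) * p ∎
        where
        y = q ^ m
        p = q ^ tri m

      open N.Triple (q + q) w recurrence

      poch-q² : ℕ → Carrier
      poch-q² = Nilpotent.poch (q ^ 2) K (q^k-nilpotent 1)

      factor≈ : ∀ n → factor n ≈ (1# + q ^ suc n) * (1# + q ^ suc n)
      factor≈ n = trans (+-congˡ (*-congˡ (*-congˡ (q^2n n))))
        (solve 2 (λ q y → one :+ (q :+ q) :* y :+ q :* (q :* (y :* y)) := (one :+ q :* y) :* (one :+ q :* y)) refl q (q ^ n))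

      poch-double : ∀ n → poch n * ∏ n (λ i → 1# + q ^ suc i) ≈ poch-q² n
      poch-double n = trans (sym (∏-* n _ _)) (∏-cong n λ i _ → begin
        (1# - q ^ suc i) * (1# + q ^ suc i)   ≈⟨ solve 1 (λ x → (one :- x) :* (one :+ x) := one :- x :* x) refl _ ⟩
        1# - q ^ suc i * q ^ suc i            ≈⟨ +-congˡ (-‿cong (^-homo-* q (suc i) (suc i))) ⟨
        1# - q ^ (suc i ℕ.+ suc i)            ≡⟨ ≡.cong (λ k → 1# - q ^ (suc i ℕ.+ k)) (ℕ.+-identityʳ (suc i)) ⟨
        1# - q ^ (2 ℕ.* suc i)                ≈⟨ +-congˡ (-‿cong (^-assocʳ q 2 (suc i))) ⟨
        1# - (q ^ 2) ^ suc i                  ∎)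

      gauss : ∑ (suc (K ℕ.+ K)) w * poch K ≈ poch-q² K * poch-q² K
      gauss = begin
        ∑ (suc (K ℕ.+ K)) w * poch K              ≈⟨ *-congʳ (triple-product (λ m K≤m → ^-vanish (ℕ.≤-trans K≤m (m≤tri m)))) ⟨
        poch K * (1# * ∏ (K ℕ.+ K) factor) * poch K
          ≈⟨ *-congʳ (*-congˡ (*-congˡ (trans (∏-cong (K ℕ.+ K) (λ i _ → factor≈ i)) (trans (∏-* (K ℕ.+ K) _ _) (*-cong stable stable))))) ⟩
        poch K * (1# * (e * e)) * poch K
          ≈⟨ solve 2 (λ p e → p :* (one :* (e :* e)) :* p := (p :* e) :* (p :* e)) refl _ _ ⟩
        (poch K * e) * (poch K * e)               ≈⟨ *-cong (poch-double K) (poch-double K) ⟩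
        poch-q² K * poch-q² K                     ∎
        where
        e : Carrier
        e = ∏ K (λ i → 1# + q ^ suc i)
        stable : ∏ (K ℕ.+ K) (λ i → 1# + q ^ suc i) ≈ e
        stable = ∏-stable _ K (λ i K≤i → trans (+-congˡ (^-vanish (ℕ.m≤n⇒m≤1+n K≤i))) (+-identityʳ 1#))

    module Jacobi where
      -- The case a = -q, b = -1, in which 1 + b^(2m+1) is 0. These weights are the limits after
      -- division by 1 + b, whence the factor 2m + 1; that they satisfy the recurrence is checked
      -- directly.
      w : ℕ → Carrier
      w m = fromℤ (jac m) * q ^ tri m

      recurrence : ∀ m → q ^ m * ((- (q + q)) * w m) ≈ w (suc m) + q ^ suc (m ℕ.+ m) * w (m ℕ.∸ 1)
      recurrence zero = solve 1 (λ q → one :* ((:- (q :+ q)) :* (one :* one))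
        := con (ℤ.- (+ 3)) :* (q :* one) :+ q :* one :* (one :* one)) refl q
      recurrence (suc m) = begin
        q ^ suc m * (- (q + q) * (k * q ^ (suc m ℕ.+ tri m)))
          ≈⟨ *-congˡ (*-congˡ (*-congˡ (^-homo-* q (suc m) (tri m)))) ⟩
        q * y * (- (q + q) * (k * (q * y * p)))
          ≈⟨ solve 5 (λ q y p k k⁻ → q :* y :* (:- (q :+ q) :* (k :* (q :* y :* p)))
               := (con (ℤ.- (+ 2)) :* k :- k⁻) :* ((q :* (q :* y)) :* ((q :* y) :* p)) :+ (q :* ((q :* y) :* (q :* y))) :* (k⁻ :* p)) refl q y p k k⁻ ⟩
        (fromℤ (ℤ.- (+ 2)) * k - k⁻) * ((q * (q * y)) * ((q * y) * p)) + (q * ((q * y) * (q * y))) * (k⁻ * p)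
          ≈⟨ +-cong (*-cong k⁺ (trans (^-homo-* q (suc (suc m)) _) (*-congˡ (^-homo-* q (suc m) (tri m)))))
                    (*-congʳ (*-congˡ (q^2n (suc m)))) ⟨
        w (suc (suc m)) + q ^ suc (suc m ℕ.+ suc m) * w m ∎
        where
        y = q ^ m
        p = q ^ tri m
        k = fromℤ (jac (suc m))
        k⁻ = fromℤ (jac m)
        k⁺ : fromℤ (jac (suc (suc m))) ≈ fromℤ (ℤ.- (+ 2)) * k - k⁻
        k⁺ = begin
          fromℤ (jac (suc (suc m)))                                    ≡⟨ ≡.cong fromℤ (jac-recurrence m) ⟩
          fromℤ (ℤ.- (+ 2) ℤ.* jac (suc m) ℤ.- jac m)                  ≈⟨ fromℤ-+ (ℤ.- (+ 2) ℤ.* jac (suc m)) (ℤ.- jac m) ⟩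
          fromℤ (ℤ.- (+ 2) ℤ.* jac (suc m)) + fromℤ (ℤ.- jac m)        ≈⟨ +-cong (fromℤ-* (ℤ.- (+ 2)) (jac (suc m))) (fromℤ-neg (jac m)) ⟩
          fromℤ (ℤ.- (+ 2)) * k - k⁻                                   ∎

      open N.Triple (- (q + q)) w recurrence

      factor≈ : ∀ n → factor n ≈ (1# - q ^ suc n) * (1# - q ^ suc n)
      factor≈ n = trans (+-congˡ (*-congˡ (*-congˡ (q^2n n))))
        (solve 2 (λ q y → one :+ :- (q :+ q) :* y :+ q :* (q :* (y :* y)) := (one :- q :* y) :* (one :- q :* y)) refl q (q ^ n))

      jacobi : ∑ (suc (K ℕ.+ K)) w ≈ poch K ^ 3
      jacobi = begin
        ∑ (suc (K ℕ.+ K)) w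
          ≈⟨ triple-product (λ m K≤m → trans (*-congˡ (^-vanish (ℕ.≤-trans K≤m (m≤tri m)))) (zeroʳ _)) ⟨
        poch K * (1# * 1# * ∏ (K ℕ.+ K) factor)
          ≈⟨ *-congˡ (*-congˡ (trans (∏-cong (K ℕ.+ K) (λ i _ → factor≈ i)) (trans (∏-* (K ℕ.+ K) _ _) (*-cong stable stable)))) ⟩
        poch K * (1# * 1# * (poch K * poch K))
          ≈⟨ solve 1 (λ p → p :* (one :* one :* (p :* p)) := p :* (p :* (p :* one))) refl _ ⟩
        poch K ^ 3 ∎
        where
        stable : poch (K ℕ.+ K) ≈ poch K
        stable = poch-stable (ℕ.m≤m+n K K)

    module Euler where
      -- The case a = -q, b = -q² over the base Q = q³, so that c₀ = a + bQ = -(q + q⁵) and w 0 = 1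
      -- + b = 1 - q².
      w : ℕ → Carrier
      w m = fromℤ (sgn m) * (q ^ pent m - q ^ (pent m ℕ.+ (4 ℕ.* m ℕ.+ 2)))

      Q c₀ : Carrier
      Q  = q ^ 3
      c₀ = - (q + q ^ 5)

      q^3m : ∀ m → q ^ (m ℕ.+ (m ℕ.+ m) ℕ.+ 1) ≈ q ^ m * (q ^ m * q ^ m) * (q * 1#)
      q^3m m = trans (^-homo-* q (m ℕ.+ (m ℕ.+ m)) 1) (*-congʳ (trans (^-homo-* q m _) (*-congˡ (q^2n m))))

      Q^m : ∀ m → Q ^ m ≈ q ^ m * (q ^ m * q ^ m)
      Q^m m = begin
        (q ^ 3) ^ m                  ≈⟨ ^-assocʳ q 3 m ⟩
        q ^ (m ℕ.+ (m ℕ.+ (m ℕ.+ 0))) ≡⟨ ≡.cong (λ k → q ^ (m ℕ.+ (m ℕ.+ k))) (ℕ.+-identityʳ m) ⟩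
        q ^ (m ℕ.+ (m ℕ.+ m))        ≈⟨ trans (^-homo-* q m _) (*-congˡ (q^2n m)) ⟩
        q ^ m * (q ^ m * q ^ m)      ∎

      q^[4m+2] : ∀ m → q ^ (4 ℕ.* m ℕ.+ 2) ≈ (q ^ m) ^ 4 * q ^ 2
      q^[4m+2] m = trans (^-homo-* q (4 ℕ.* m) 2) (*-congʳ (trans (reflexive (≡.cong (q ^_) (ℕ.*-comm 4 m))) (sym (^-assocʳ q m 4))))

      w-factored : ∀ m → w m ≈ fromℤ (sgn m) * (q ^ pent m * (1# - (q ^ m) ^ 4 * q ^ 2))
      w-factored m = *-congˡ (trans (+-congˡ (-‿cong (trans (^-homo-* q (pent m) _) (*-congˡ (q^[4m+2] m)))))
        (solve 2 (λ p x → p :- p :* x := p :* (one :- x)) refl _ _))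

      w-suc : ∀ m → w (suc m) ≈ - fromℤ (sgn m) * ((q ^ m * (q ^ m * q ^ m) * (q * 1#)) * q ^ pent m * (1# - (q * q ^ m) ^ 4 * q ^ 2))
      w-suc m = trans (w-factored (suc m)) (*-cong (fromℤ-neg (sgn m))
        (*-congʳ (trans (^-homo-* q (m ℕ.+ (m ℕ.+ m) ℕ.+ 1) (pent m)) (*-congʳ (q^3m m)))))

      recurrence : ∀ m → Q ^ m * (c₀ * w m) ≈ w (suc m) + Q ^ suc (m ℕ.+ m) * w (m ℕ.∸ 1)
      recurrence zero = begin
        1# * (c₀ * w 0)   ≈⟨ *-congˡ (*-congˡ (w-factored 0)) ⟩
        _ ≈⟨ solve 1 (λ q → one :* (:- (q :+ q :^ 5) :* (one :* (one :* (one :- one :^ 4 :* q :^ 2))))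
             := :- one :* ((one :* (one :* one) :* (q :* one)) :* one :* (one :- (q :* one) :^ 4 :* q :^ 2))
               :+ (q :^ 3) :* one :* (one :* (one :* (one :- one :^ 4 :* q :^ 2)))) refl q ⟩
        _ ≈⟨ +-cong (w-suc 0) (*-congˡ (w-factored 0)) ⟨
        w 1 + Q ^ 1 * w 0 ∎
      recurrence (suc m) = begin
        Q ^ suc m * (c₀ * w (suc m))
          ≈⟨ *-cong (Q^m (suc m)) (*-congˡ (w-suc m)) ⟩
        _ ≈⟨ solve 4 (λ q x p s →
               q :* x :* (q :* x :* (q :* x)) :* (:- (q :+ q :^ 5) :* (:- s :* (x :* (x :* x) :* (q :* one) :* p :* (one :- (q :* x) :^ 4 :* q :^ 2))))
               := :- (:- s) :* (q :* x :* (q :* x :* (q :* x)) :* (q :* one) :* (x :* (x :* x) :* (q :* one) :* p) :* (one :- (q :* (q :* x)) :^ 4 :* q :^ 2))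
               :+ q :^ 3 :* ((q :* x :* (q :* x :* (q :* x))) :* (q :* x :* (q :* x :* (q :* x)))) :* (s :* (p :* (one :- x :^ 4 :* q :^ 2))))
               refl q (q ^ m) (q ^ pent m) (fromℤ (sgn m)) ⟩
        _ ≈⟨ +-cong (trans (w-suc (suc m)) (*-cong (-‿cong (fromℤ-neg (sgn m)))
                      (*-congʳ (*-congˡ (trans (^-homo-* q (m ℕ.+ (m ℕ.+ m) ℕ.+ 1) (pent m)) (*-congʳ (q^3m m)))))))
                    (*-cong (*-congˡ (trans (^-homo-* Q (suc m) (suc m)) (*-cong (Q^m (suc m)) (Q^m (suc m))))) (w-factored m)) ⟨
        w (suc (suc m)) + Q ^ suc (suc m ℕ.+ suc m) * w m ∎

      module NQ = Nilpotent Q K (q^k-nilpotent 2)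
      open NQ.Triple c₀ w recurrence

      factor≈ : ∀ n → factor n ≈ (1# - q * Q ^ n) * (1# - q ^ 5 * Q ^ n)
      factor≈ n = trans (+-congˡ (*-congˡ (*-congˡ (^-homo-* Q n n))))
        (solve 2 (λ q y → one :+ :- (q :+ q :^ 5) :* y :+ q :^ 3 :* (q :^ 3 :* (y :* y))
          := (one :- q :* y) :* (one :- q :^ 5 :* y)) refl q (Q ^ n))

      -- The factors have exponents 3i + 3, 3i + 1 and 3i + 5. The extra factor 1 - q², which is w
      -- 0, fills the gap at exponent 2, and after n rounds the exponent 3n + 2 sticks out above 3n.
      interleave : ∀ n → NQ.poch n * ((1# - q ^ 2) * ∏ n factor) ≈ poch (n ℕ.* 3) * (1# - q ^ 2 * Q ^ n)
      interleave zero = solve 1 (λ q → one :* ((one :- q :^ 2) :* one) := one :* (one :- q :^ 2 :* one)) refl q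
      interleave (suc n) = begin
        (NQ.poch n * (1# - Q ^ suc n)) * ((1# - q ^ 2) * (∏ n factor * factor n))
          ≈⟨ *-congˡ (*-congˡ (*-congˡ (factor≈ n))) ⟩
        (NQ.poch n * (1# - Q ^ suc n)) * ((1# - q ^ 2) * (∏ n factor * ((1# - q * Q ^ n) * (1# - q ^ 5 * Q ^ n))))
          ≈⟨ solve 6 (λ a b c d e f → (a :* b) :* (c :* (d :* (e :* f))) := a :* (c :* d) :* (e :* b :* f)) refl _ _ _ _ _ _ ⟩
        NQ.poch n * ((1# - q ^ 2) * ∏ n factor) * ((1# - q * Q ^ n) * (1# - Q ^ suc n) * (1# - q ^ 5 * Q ^ n))
          ≈⟨ *-congʳ (interleave n) ⟩
        poch (n ℕ.* 3) * (1# - q ^ 2 * Q ^ n) * ((1# - q * Q ^ n) * (1# - Q ^ suc n) * (1# - q ^ 5 * Q ^ n))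
          ≈⟨ solve 3 (λ p q y → p :* (one :- q :^ 2 :* y) :* ((one :- q :* y) :* (one :- q :^ 3 :* y) :* (one :- q :^ 5 :* y))
               := p :* (one :- q :* y) :* (one :- q :* (q :* y)) :* (one :- q :* (q :* (q :* y))) :* (one :- q :^ 2 :* (q :^ 3 :* y))) refl _ _ _ ⟩
        poch (n ℕ.* 3) * (1# - q * Q ^ n) * (1# - q * (q * Q ^ n)) * (1# - q * (q * (q * Q ^ n))) * (1# - q ^ 2 * Q ^ suc n)
          ≈⟨ *-congʳ (*-cong (*-cong (*-congˡ (+-congˡ (-‿cong (*-congˡ Q^n)))) (+-congˡ (-‿cong (*-congˡ (*-congˡ Q^n)))))
               (+-congˡ (-‿cong (*-congˡ (*-congˡ (*-congˡ Q^n)))))) ⟩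
        poch (suc n ℕ.* 3) * (1# - q ^ 2 * Q ^ suc n) ∎
        where
        Q^n : Q ^ n ≈ q ^ (n ℕ.* 3)
        Q^n = trans (^-assocʳ q 3 n) (reflexive (≡.cong (q ^_) (ℕ.*-comm 3 n)))

      w-vanish : ∀ m → K ≤ m → w m ≈ 0#
      w-vanish m K≤m = begin
        fromℤ (sgn m) * (q ^ pent m - q ^ (pent m ℕ.+ (4 ℕ.* m ℕ.+ 2)))
          ≈⟨ *-congˡ (+-cong (^-vanish K≤pent) (-‿cong (^-vanish (ℕ.≤-trans K≤pent (ℕ.m≤m+n (pent m) _))))) ⟩
        fromℤ (sgn m) * (0# - 0#)   ≈⟨ solve 1 (λ s → s :* (con (+ 0) :- con (+ 0)) := con (+ 0)) refl _ ⟩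
        0#                          ∎
        where
        K≤pent : K ≤ pent m
        K≤pent = ℕ.≤-trans K≤m (m≤pent m)

      euler : ∑ (suc (K ℕ.+ K)) w ≈ poch K
      euler = begin
        ∑ (suc (K ℕ.+ K)) w                           ≈⟨ triple-product w-vanish ⟨
        NQ.poch K * (w 0 * ∏ n factor)                ≈⟨ *-cong (sym (NQ.poch-stable K≤n)) (*-congʳ w-0) ⟩
        NQ.poch n * ((1# - q ^ 2) * ∏ n factor)       ≈⟨ interleave n ⟩
        poch (n ℕ.* 3) * (1# - q ^ 2 * Q ^ n)         ≈⟨ *-cong (poch-stable (ℕ.≤-trans K≤n (ℕ.m≤m*n n 3))) (+-congˡ (-‿cong (trans (*-congˡ (NQ.^-vanish K≤n)) (zeroʳ _)))) ⟩
        poch K * (1# - 0#)                            ≈⟨ solve 1 (λ p → p :* (one :- con (+ 0)) := p) refl _ ⟩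
        poch K                                        ∎
        where
        n = K ℕ.+ K
        K≤n : K ≤ n
        K≤n = ℕ.m≤m+n K K
        w-0 : w 0 ≈ 1# - q ^ 2
        w-0 = *-identityˡ _

-- Integer power series, truncated and reduced modulo p

module PowerSeries where

  open import Algebra.Bundles using (CommutativeRing)
  open import Data.Integer as ℤ using (ℤ; +_)
  import Data.Integer.Properties as ℤ
  open import Data.Integer.Divisibility.Signed using (_∣_; divides; ∣m∣n⇒∣m+n; ∣m⇒∣-m; ∣m⇒∣m*n; ∣n⇒∣m*n)
  import Data.Integer.Solver as ℤ
  open import Data.Nat as ℕ using (ℕ; zero; suc; _≤_; _<_; z≤n; s≤s)
  import Data.Nat.Properties as ℕ
  open import Data.Product using (_,_)
  open import Function using (_∘_)
  open import Level using (0ℓ)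
  open import Relation.Binary.PropositionalEquality
  open ≡-Reasoning

  ℤSeries : Set
  ℤSeries = ℕ → ℤ

  infixl 7 _⊛_
  infixl 6 _⊞_

  _⊞_ _⊛_ : ℤSeries → ℤSeries → ℤSeries
  (f ⊞ g) n = f n ℤ.+ g n
  (f ⊛ g) zero    = f 0 ℤ.* g 0
  (f ⊛ g) (suc n) = f 0 ℤ.* g (suc n) ℤ.+ ((f ∘ suc) ⊛ g) n

  ⊟_ : ℤSeries → ℤSeries
  (⊟ f) n = ℤ.- f n

  constant : ℤ → ℤSeries
  constant k zero    = k
  constant k (suc _) = + 0

  monomial : ℕ → ℤSeries
  monomial zero            = constant (+ 1)
  monomial (suc e) zero    = + 0
  monomial (suc e) (suc n) = monomial e n

  -- The product is defined by shifting the left factor; commutativity rests on being able to shift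
  -- the right one instead.
  ⊛-sucʳ : ∀ f g n → (f ⊛ g) (suc n) ≡ f (suc n) ℤ.* g 0 ℤ.+ (f ⊛ (g ∘ suc)) n
  ⊛-sucʳ f g zero    = ℤ.+-comm (f 0 ℤ.* g 1) (f 1 ℤ.* g 0)
  ⊛-sucʳ f g (suc n) = begin
    a ℤ.+ ((f ∘ suc) ⊛ g) (suc n)     ≡⟨ cong (λ x → a ℤ.+ x) (⊛-sucʳ (f ∘ suc) g n) ⟩
    a ℤ.+ (b ℤ.+ c)                   ≡⟨ solve 3 (λ a b c → a :+ (b :+ c) := b :+ (a :+ c)) refl a b c ⟩
    b ℤ.+ (a ℤ.+ c)                   ∎
    where
    open ℤ.+-*-Solver
    a b c : ℤ
    a = f 0 ℤ.* g (suc (suc n))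
    b = f (suc (suc n)) ℤ.* g 0
    c = ((f ∘ suc) ⊛ (g ∘ suc)) n

  ⊛-comm : ∀ f g n → (f ⊛ g) n ≡ (g ⊛ f) n
  ⊛-comm f g zero    = ℤ.*-comm (f 0) (g 0)
  ⊛-comm f g (suc n) = trans (cong₂ ℤ._+_ (ℤ.*-comm (f 0) (g (suc n))) (⊛-comm (f ∘ suc) g n)) (sym (⊛-sucʳ g f n))

  ⊛-distribʳ : ∀ h f g n → ((f ⊞ g) ⊛ h) n ≡ (f ⊛ h) n ℤ.+ (g ⊛ h) n
  ⊛-distribʳ h f g zero    = ℤ.*-distribʳ-+ (h 0) (f 0) (g 0)
  ⊛-distribʳ h f g (suc n) = trans (cong₂ ℤ._+_ (ℤ.*-distribʳ-+ (h (suc n)) (f 0) (g 0)) (⊛-distribʳ h (f ∘ suc) (g ∘ suc) n))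
    (solve 4 (λ a b c d → (a :+ b) :+ (c :+ d) := (a :+ c) :+ (b :+ d)) refl
      (f 0 ℤ.* h (suc n)) (g 0 ℤ.* h (suc n)) (((f ∘ suc) ⊛ h) n) (((g ∘ suc) ⊛ h) n))
    where open ℤ.+-*-Solver

  ⊛-scale : ∀ k f g n → ((λ i → k ℤ.* f i) ⊛ g) n ≡ k ℤ.* (f ⊛ g) n
  ⊛-scale k f g zero    = ℤ.*-assoc k (f 0) (g 0)
  ⊛-scale k f g (suc n) = trans (cong₂ ℤ._+_ (ℤ.*-assoc k (f 0) (g (suc n))) (⊛-scale k (f ∘ suc) g n))
    (sym (ℤ.*-distribˡ-+ k _ _))

  ⊛-assoc : ∀ f g h n → ((f ⊛ g) ⊛ h) n ≡ (f ⊛ (g ⊛ h)) n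
  ⊛-assoc f g h zero    = ℤ.*-assoc (f 0) (g 0) (h 0)
  ⊛-assoc f g h (suc n) = begin
    f 0 ℤ.* g 0 ℤ.* h (suc n) ℤ.+ (((λ i → f 0 ℤ.* g (suc i)) ⊞ ((f ∘ suc) ⊛ g)) ⊛ h) n
      ≡⟨ cong₂ ℤ._+_ (ℤ.*-assoc (f 0) (g 0) (h (suc n))) (⊛-distribʳ h (λ i → f 0 ℤ.* g (suc i)) ((f ∘ suc) ⊛ g) n) ⟩
    f 0 ℤ.* (g 0 ℤ.* h (suc n)) ℤ.+ (((λ i → f 0 ℤ.* g (suc i)) ⊛ h) n ℤ.+ (((f ∘ suc) ⊛ g) ⊛ h) n)
      ≡⟨ cong₂ (λ x y → f 0 ℤ.* (g 0 ℤ.* h (suc n)) ℤ.+ (x ℤ.+ y)) (⊛-scale (f 0) (g ∘ suc) h n) (⊛-assoc (f ∘ suc) g h n) ⟩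
    f 0 ℤ.* (g 0 ℤ.* h (suc n)) ℤ.+ (f 0 ℤ.* ((g ∘ suc) ⊛ h) n ℤ.+ ((f ∘ suc) ⊛ (g ⊛ h)) n)
      ≡⟨ solve 4 (λ a b c d → a :* b :+ (a :* c :+ d) := a :* (b :+ c) :+ d) refl (f 0) (g 0 ℤ.* h (suc n)) (((g ∘ suc) ⊛ h) n) (((f ∘ suc) ⊛ (g ⊛ h)) n) ⟩
    f 0 ℤ.* (g ⊛ h) (suc n) ℤ.+ ((f ∘ suc) ⊛ (g ⊛ h)) n ∎
    where open ℤ.+-*-Solver

  ⊛-zeroˡ : ∀ f n → ((λ _ → + 0) ⊛ f) n ≡ + 0
  ⊛-zeroˡ f zero    = ℤ.*-zeroˡ (f 0)
  ⊛-zeroˡ f (suc n) = trans (cong₂ ℤ._+_ (ℤ.*-zeroˡ (f (suc n))) (⊛-zeroˡ f n)) refl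

  constant-⊛ : ∀ k f n → (constant k ⊛ f) n ≡ k ℤ.* f n
  constant-⊛ k f zero    = refl
  constant-⊛ k f (suc n) = trans (cong (λ x → k ℤ.* f (suc n) ℤ.+ x) (⊛-zeroˡ f n)) (ℤ.+-identityʳ _)

  ⊛-identityˡ : ∀ f n → (constant (+ 1) ⊛ f) n ≡ f n
  ⊛-identityˡ f n = trans (constant-⊛ (+ 1) f n) (ℤ.*-identityˡ (f n))

  monomial-⊛-< : ∀ e f n → n < e → (monomial e ⊛ f) n ≡ + 0
  monomial-⊛-< (suc e) f zero    _ = ℤ.*-zeroˡ (f 0)
  monomial-⊛-< (suc e) f (suc n) (s≤s n<e) = trans (cong₂ ℤ._+_ (ℤ.*-zeroˡ (f (suc n))) (monomial-⊛-< e f n n<e)) refl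

  monomial-⊛-≥ : ∀ e f n → e ≤ n → (monomial e ⊛ f) n ≡ f (n ℕ.∸ e)
  monomial-⊛-≥ zero    f n       _ = ⊛-identityˡ f n
  monomial-⊛-≥ (suc e) f (suc n) (s≤s e≤n) =
    trans (cong₂ ℤ._+_ (ℤ.*-zeroˡ (f (suc n))) (monomial-⊛-≥ e f n e≤n)) (ℤ.+-identityˡ _)

  monomial-suc : ∀ e n → (monomial 1 ⊛ monomial e) n ≡ monomial (suc e) n
  monomial-suc e zero    = ℤ.*-zeroˡ (monomial e 0)
  monomial-suc e (suc n) = trans (cong₂ ℤ._+_ (ℤ.*-zeroˡ (monomial e (suc n))) (⊛-identityˡ (monomial e) n)) (ℤ.+-identityˡ _)

  monomial-≢ : ∀ e n → n ≢ e → monomial e n ≡ + 0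
  monomial-≢ zero    zero    n≢e with () ← n≢e refl
  monomial-≢ zero    (suc n) _   = refl
  monomial-≢ (suc e) zero    _   = refl
  monomial-≢ (suc e) (suc n) n≢e = monomial-≢ e n (n≢e ∘ cong suc)

  monomial-≡ : ∀ e → monomial e e ≡ + 1
  monomial-≡ zero    = refl
  monomial-≡ (suc e) = monomial-≡ e

  ∣-⊛ : ∀ {k} f g n → (∀ i j → i ℕ.+ j ≡ n → k ∣ f i ℤ.* g j) → k ∣ (f ⊛ g) n
  ∣-⊛ f g zero    h = h 0 0 refl
  ∣-⊛ f g (suc n) h = ∣m∣n⇒∣m+n (h 0 (suc n) refl) (∣-⊛ (f ∘ suc) g n (λ i j eq → h (suc i) j (cong suc eq)))

  module Truncated (p N : ℕ) where

    infix 4 _≋_ _≈_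

    record _≋_ (i j : ℤ) : Set where
      constructor mod
      field difference : + p ∣ i ℤ.- j
    open _≋_ public

    _≈_ : ℤSeries → ℤSeries → Set
    f ≈ g = ∀ n → n ≤ N → f n ≋ g n

    ≋-reflexive : ∀ {i j} → i ≡ j → i ≋ j
    ≋-reflexive {i} refl = mod (subst (+ p ∣_) (sym (ℤ.+-inverseʳ i)) (divides (+ 0) (sym (ℤ.*-zeroˡ (+ p)))))

    ≋-sym : ∀ {i j} → i ≋ j → j ≋ i
    ≋-sym {i} {j} (mod d) = mod (subst (+ p ∣_) (solve 2 (λ i j → :- (i :- j) := j :- i) refl i j) (∣m⇒∣-m d))
      where open ℤ.+-*-Solver

    ≋-trans : ∀ {i j k} → i ≋ j → j ≋ k → i ≋ k
    ≋-trans {i} {j} {k} (mod d) (mod e) = mod (subst (+ p ∣_)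
      (solve 3 (λ i j k → (i :- j) :+ (j :- k) := i :- k) refl i j k) (∣m∣n⇒∣m+n d e))
      where open ℤ.+-*-Solver

    ≋-+ : ∀ {i j k l} → i ≋ j → k ≋ l → i ℤ.+ k ≋ j ℤ.+ l
    ≋-+ {i} {j} {k} {l} (mod d) (mod e) = mod (subst (+ p ∣_)
      (solve 4 (λ i j k l → (i :- j) :+ (k :- l) := (i :+ k) :- (j :+ l)) refl i j k l) (∣m∣n⇒∣m+n d e))
      where open ℤ.+-*-Solver

    ≋-* : ∀ {i j k l} → i ≋ j → k ≋ l → i ℤ.* k ≋ j ℤ.* l
    ≋-* {i} {j} {k} {l} (mod d) (mod e) = mod (subst (+ p ∣_)
      (solve 4 (λ i j k l → (i :- j) :* k :+ j :* (k :- l) := i :* k :- j :* l) refl i j k l)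
      (∣m∣n⇒∣m+n (∣m⇒∣m*n k d) (∣n⇒∣m*n j e)))
      where open ℤ.+-*-Solver

    ≋-neg : ∀ {i j} → i ≋ j → ℤ.- i ≋ ℤ.- j
    ≋-neg {i} {j} (mod d) = mod (subst (+ p ∣_) (solve 2 (λ i j → :- (i :- j) := (:- i) :- (:- j)) refl i j) (∣m⇒∣-m d))
      where open ℤ.+-*-Solver

    ∣⇒≋0 : ∀ {i} → + p ∣ i → i ≋ + 0
    ∣⇒≋0 {i} d = mod (subst (+ p ∣_) (sym (ℤ.+-identityʳ i)) d)

    ≋0⇒∣ : ∀ {i} → i ≋ + 0 → + p ∣ i
    ≋0⇒∣ {i} (mod d) = subst (+ p ∣_) (ℤ.+-identityʳ i) d

    ⊛-≋ : ∀ n {f f′ g g′} → (∀ i → i ≤ n → f i ≋ f′ i) → (∀ i → i ≤ n → g i ≋ g′ i) → (f ⊛ g) n ≋ (f′ ⊛ g′) n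
    ⊛-≋ zero    ef eg = ≋-* (ef 0 z≤n) (eg 0 z≤n)
    ⊛-≋ (suc n) ef eg = ≋-+ (≋-* (ef 0 z≤n) (eg (suc n) ℕ.≤-refl))
      (⊛-≋ n (λ i i≤n → ef (suc i) (s≤s i≤n)) (λ i i≤n → eg i (ℕ.m≤n⇒m≤1+n i≤n)))

    pointwise : ∀ {f g} → (∀ n → f n ≡ g n) → f ≈ g
    pointwise eq n _ = ≋-reflexive (eq n)

    -- This is ℤ[[q]] modulo p and q^(N+1), presented by full integer series under a coarser
    -- equality. The product respects it because coefficient n of a product involves only
    -- coefficients up to n.
    ring : CommutativeRing 0ℓ 0ℓ
    ring = record
      { Carrier = ℤSeries
      ; _≈_ = _≈_
      ; _+_ = _⊞_
      ; _*_ = _⊛_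
      ; -_ = ⊟_
      ; 0# = λ _ → + 0
      ; 1# = constant (+ 1)
      ; isCommutativeRing = record
        { isRing = record
          { +-isAbelianGroup = record
            { isGroup = record
              { isMonoid = record
                { isSemigroup = record
                  { isMagma = record
                    { isEquivalence = record
                      { refl = λ _ _ → ≋-reflexive refl
                      ; sym = λ e n n≤N → ≋-sym (e n n≤N)
                      ; trans = λ e e′ n n≤N → ≋-trans (e n n≤N) (e′ n n≤N)
                      }
                    ; ∙-cong = λ e e′ n n≤N → ≋-+ (e n n≤N) (e′ n n≤N)
                    }
                  ; assoc = λ f g h → pointwise (λ n → ℤ.+-assoc (f n) (g n) (h n))
                  }
                ; identity = (λ f → pointwise (λ n → ℤ.+-identityˡ (f n))) , (λ f → pointwise (λ n → ℤ.+-identityʳ (f n)))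
                }
              ; inverse = (λ f → pointwise (λ n → ℤ.+-inverseˡ (f n))) , (λ f → pointwise (λ n → ℤ.+-inverseʳ (f n)))
              ; ⁻¹-cong = λ e n n≤N → ≋-neg (e n n≤N)
              }
            ; comm = λ f g → pointwise (λ n → ℤ.+-comm (f n) (g n))
            }
          ; *-cong = λ e e′ n n≤N → ⊛-≋ n (λ i i≤n → e i (ℕ.≤-trans i≤n n≤N)) (λ i i≤n → e′ i (ℕ.≤-trans i≤n n≤N))
          ; *-assoc = λ f g h → pointwise (⊛-assoc f g h)
          ; *-identity = (λ f → pointwise (⊛-identityˡ f)) , (λ f → pointwise (λ n → trans (⊛-comm f (constant (+ 1)) n) (⊛-identityˡ f n)))
          ; distrib = (λ f g h → pointwise (λ n → trans (⊛-comm f (g ⊞ h) n) (trans (⊛-distribʳ f g h n) (cong₂ ℤ._+_ (⊛-comm g f n) (⊛-comm h f n)))))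
                    , (λ h f g → pointwise (⊛-distribʳ h f g))
          }
        ; *-comm = λ f g → pointwise (⊛-comm f g)
        }
      }

-- The operation of dividing by 1 - q^m as multiplication in the truncated ring

module SeriesModulo (p N : ℕ) where

  open import Data.Nat as ℕ using (ℕ; zero; suc; s≤s)
  open import Algebra.Bundles using (CommutativeRing)
  open import Data.Integer as ℤ using (ℤ; +_)
  import Data.Integer.Properties as ℤ
  import Data.Nat.Properties as ℕ
  open import Defs using (Series; divGeom)
  import Defs
  open import Relation.Binary.PropositionalEquality as ≡ using (_≡_)
  open import Relation.Nullary using (yes; no)
  open PowerSeries

  open Truncated p N using (_≋_; mod; ≋-reflexive; ≋-sym; ≋-trans; ≋-+; ≋-*; ≋-neg; ∣⇒≋0; ≋0⇒∣; pointwise; ring) public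
  open CommutativeRing ring hiding (ring) public
  open ThetaIdentities ring public
  open TripleProduct ring public

  X : Carrier
  X = monomial 1

  X^-monomial : ∀ e n → (X ^ e) n ≡ monomial e n
  X^-monomial zero    n = ≡.refl
  X^-monomial (suc e) n = ≡.trans (⊛-congʳ n (X^-monomial e)) (monomial-suc e n)
    where
    ⊛-congʳ : ∀ n {f g g′} → (∀ i → g i ≡ g′ i) → (f ⊛ g) n ≡ (f ⊛ g′) n
    ⊛-congʳ zero    {f} eq = ≡.cong (f 0 ℤ.*_) (eq 0)
    ⊛-congʳ (suc n) {f} eq = ≡.cong₂ ℤ._+_ (≡.cong (f 0 ℤ.*_) (eq (suc n))) (⊛-congʳ n eq)

  X^≈monomial : ∀ e → X ^ e ≈ monomial e
  X^≈monomial e = pointwise (X^-monomial e)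

  X-nilpotent : X ^ suc N ≈ 0#
  X-nilpotent n n≤N = ≋-reflexive (≡.trans (X^-monomial (suc N) n) (monomial-≢ (suc N) n (ℕ.<⇒≢ (s≤s n≤N))))

  embed : (ℕ → ℕ) → Carrier
  embed f n = + f n

  embed-one : embed Defs.one ≈ 1#
  embed-one zero    _ = ≋-reflexive ≡.refl
  embed-one (suc n) _ = ≋-reflexive ≡.refl

  geometricMonomials : ℕ → ℕ → Carrier
  geometricMonomials m j = ∑ j (λ i → monomial (i ℕ.* m))

  geometricSum : Series → ℕ → ℕ → ℕ → ℕ
  geometricSum f m n zero    = f n
  geometricSum f m n (suc j) with suc j ℕ.* m ℕ.≤? n
  ... | yes _ = f (n ℕ.∸ suc j ℕ.* m) ℕ.+ geometricSum f m n j
  ... | no  _ = geometricSum f m n j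

  -- The recursion behind divGeom is private to its module: the placeholder stands
  -- for it, and is filled in by unification in the clauses for divGeom.
  mutual
    hiddenSum≡ : ∀ f m n j → _ ≡ geometricSum f m n j

    divGeom≡ : ∀ f m n → divGeom m f n ≡ geometricSum f m n n
    divGeom≡ f m zero = ≡.refl
    divGeom≡ f m (suc n) with suc n ℕ.* m ℕ.≤? suc n
    ... | no  _ with suc n
    ...   | k = hiddenSum≡ f m k n
    divGeom≡ f m (suc n) | yes _ with suc n
    ...   | k = ≡.cong (f (k ℕ.∸ (m ℕ.+ n ℕ.* m)) ℕ.+_) (hiddenSum≡ f m k n)

    hiddenSum≡ f m n zero = ≡.refl
    hiddenSum≡ f m n (suc j) with suc j ℕ.* m ℕ.≤? n
    ... | yes _ = ≡.cong (f (n ℕ.∸ suc j ℕ.* m) ℕ.+_) (hiddenSum≡ f m n j)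
    ... | no  _ = hiddenSum≡ f m n j

  geometricSum-coefficient : ∀ f m n j → + geometricSum f m n j ≡ (geometricMonomials m (suc j) ⊛ embed f) n
  geometricSum-coefficient f m n zero = ≡.sym (≡.trans (⊛-distribʳ (embed f) (λ _ → + 0) (monomial 0) n)
    (≡.trans (≡.cong₂ ℤ._+_ (⊛-zeroˡ (embed f) n) (⊛-identityˡ (embed f) n)) (ℤ.+-identityˡ _)))
  geometricSum-coefficient f m n (suc j)
    rewrite ⊛-distribʳ (embed f) (geometricMonomials m (suc j)) (monomial (suc j ℕ.* m)) n
    with suc j ℕ.* m ℕ.≤? n
  ... | yes le rewrite monomial-⊛-≥ (suc j ℕ.* m) (embed f) n le
    = ≡.trans (ℤ.+-comm (+ f (n ℕ.∸ suc j ℕ.* m)) (+ geometricSum f m n j)) (≡.cong (ℤ._+ (+ f (n ℕ.∸ suc j ℕ.* m))) (geometricSum-coefficient f m n j))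
  ... | no gt rewrite monomial-⊛-< (suc j ℕ.* m) (embed f) n (ℕ.≰⇒> gt)
    = ≡.trans (geometricSum-coefficient f m n j) (≡.sym (ℤ.+-identityʳ _))

  -- The fuel of `divGeom` at coefficient n is n itself. A longer sum only adds monomials of degree
  -- above n, so one multiplier with N + 1 terms serves all coefficients up to N.
  geometricMonomials-stable : ∀ m .{{_ : ℕ.NonZero m}} g n k →
    (geometricMonomials m (k ℕ.+ suc n) ⊛ g) n ≡ (geometricMonomials m (suc n) ⊛ g) n
  geometricMonomials-stable m g n zero    = ≡.refl
  geometricMonomials-stable m g n (suc k) =
    ≡.trans (⊛-distribʳ g (geometricMonomials m (k ℕ.+ suc n)) (monomial ((k ℕ.+ suc n) ℕ.* m)) n)
    (≡.trans (≡.cong₂ ℤ._+_ (geometricMonomials-stable m g n k)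
      (monomial-⊛-< ((k ℕ.+ suc n) ℕ.* m) g n (ℕ.≤-trans (ℕ.m≤n+m (suc n) k) (ℕ.m≤m*n (k ℕ.+ suc n) m))))
    (ℤ.+-identityʳ _))

  divGeom-multiplier : ∀ m .{{_ : ℕ.NonZero m}} f →
    embed (divGeom m f) ≈ ∑ (suc N) ((X ^ m) ^_) * embed f
  divGeom-multiplier m f = trans
    (λ n n≤N → ≋-reflexive (≡.trans (≡.cong +_ (divGeom≡ f m n))
      (≡.trans (geometricSum-coefficient f m n n)
      (≡.trans (≡.sym (geometricMonomials-stable m (embed f) n (N ℕ.∸ n)))
        (≡.cong (λ k → (geometricMonomials m k ⊛ embed f) n)
          (≡.trans (ℕ.+-suc (N ℕ.∸ n) n) (≡.cong suc (ℕ.m∸n+n≡m n≤N))))))))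
    (*-congʳ (∑-cong (suc N) λ i _ → sym (trans (^-assocʳ X m i)
      (trans (reflexive (≡.cong (X ^_) (ℕ.*-comm m i))) (X^≈monomial (i ℕ.* m))))))

  divGeom-inverse : ∀ k f → (1# - X ^ suc k) * embed (divGeom (suc k) f) ≈ embed f
  divGeom-inverse k f = begin
    (1# - X ^ suc k) * embed (divGeom (suc k) f)                        ≈⟨ *-congˡ (divGeom-multiplier (suc k) f) ⟩
    (1# - X ^ suc k) * (∑ (suc N) ((X ^ suc k) ^_) * embed f)           ≈⟨ *-assoc _ _ _ ⟨
    (1# - X ^ suc k) * ∑ (suc N) ((X ^ suc k) ^_) * embed f             ≈⟨ *-congʳ (Nilpotent.1-q^i-inverse X (suc N) X-nilpotent k) ⟩
    1# * embed f                                                        ≈⟨ *-identityˡ _ ⟩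
    embed f                                                             ∎
    where open import Relation.Binary.Reasoning.Setoid setoid

-- Product formulas, Frobenius and the factorisations modulo p

module Products {c ℓ} (R : CommutativeRing c ℓ) where

  open import Data.Integer using (+_)
  open import Data.Nat as ℕ using (ℕ; zero; suc)
  import Data.Nat.Properties as ℕ
  open import Defs using (one; divGeom; iter; partialProd)
  open import Relation.Binary.PropositionalEquality as ≡ using (_≡_)

  open CommutativeRing R
  open import Algebra.Properties.Ring ring
  open import Relation.Binary.Reasoning.Setoid setoid
  open TripleProduct R
  open ThetaIdentities R using (module Identities)

  1^ : ∀ r → 1# ^ r ≈ 1#
  1^ zero    = refl
  1^ (suc r) = trans (*-identityˡ _) (1^ r)

  module ColouredPartitions (q : Carrier) (embed : (ℕ → ℕ) → Carrier) (embed-one : embed one ≈ 1#)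
    (divGeom-inverse : ∀ k f → (1# - q ^ suc k) * embed (divGeom (suc k) f) ≈ embed f)
    where

    iter-divGeom-inverse : ∀ k r f → (1# - q ^ suc k) ^ r * embed (iter r (divGeom (suc k)) f) ≈ embed f
    iter-divGeom-inverse k zero    f = *-identityˡ _
    iter-divGeom-inverse k (suc r) f = begin
      (e * e ^ r) * embed (divGeom (suc k) g)    ≈⟨ solve 3 (λ a b c → (a :* b) :* c := b :* (a :* c)) refl e (e ^ r) _ ⟩
      e ^ r * (e * embed (divGeom (suc k) g))    ≈⟨ *-congˡ (divGeom-inverse k g) ⟩
      e ^ r * embed g                            ≈⟨ iter-divGeom-inverse k r f ⟩
      embed f                                    ∎
      where
      e : Carrier
      e = 1# - q ^ suc k
      g : ℕ → ℕ
      g = iter r (divGeom (suc k)) f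

    partialProd-inverse : ∀ r n →
      ∏ n (λ i → 1# - q ^ suc i) * ∏ n (λ i → 1# - (q ^ 2) ^ suc i) ^ r * embed (partialProd (suc r) n) ≈ 1#
    partialProd-inverse r zero = begin
      1# * 1# ^ r * embed one    ≈⟨ *-cong (*-congˡ (1^ r)) embed-one ⟩
      1# * 1# * 1#               ≈⟨ solve 0 (con (+ 1) :* con (+ 1) :* con (+ 1) := con (+ 1)) refl ⟩
      1#                         ∎
    partialProd-inverse r (suc n) = begin
      (P * a) * (P₂ * b) ^ r * g              ≈⟨ *-congʳ (*-congˡ (^-distrib-* P₂ b r)) ⟩
      (P * a) * (P₂ ^ r * b ^ r) * g          ≈⟨ solve 5 (λ P a P₂ b g → (P :* a) :* (P₂ :* b) :* g := P :* P₂ :* (a :* (b :* g))) refl P a (P₂ ^ r) (b ^ r) g ⟩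
      P * P₂ ^ r * (a * (b ^ r * g))          ≈⟨ *-congˡ (*-congˡ (*-congʳ (^-congˡ r (+-congˡ (-‿cong (^-assocʳ q 2 (suc n))))))) ⟩
      P * P₂ ^ r * (a * ((1# - q ^ (2 ℕ.* suc n)) ^ r * g))
        ≈⟨ *-congˡ (*-congˡ (iter-divGeom-inverse (n ℕ.+ suc (n ℕ.+ 0)) r (divGeom (suc n) f))) ⟩
      P * P₂ ^ r * (a * embed (divGeom (suc n) f))   ≈⟨ *-congˡ (divGeom-inverse n f) ⟩
      P * P₂ ^ r * embed f                    ≈⟨ partialProd-inverse r n ⟩
      1#                                      ∎
      where
      f : ℕ → ℕ
      f = partialProd (suc r) n
      P P₂ a b g : Carrier
      P  = ∏ n (λ i → 1# - q ^ suc i)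
      P₂ = ∏ n (λ i → 1# - (q ^ 2) ^ suc i)
      a  = 1# - q ^ suc n
      b  = 1# - (q ^ 2) ^ suc n
      g  = embed (partialProd (suc r) (suc n))

    -- The theta identities use K = n + 1 factors, one more than `partialProd` at n; the additional
    -- factors equal 1 because q^(n+1) ≈ 0.
    partialProd-inverse-stable : ∀ r n → q ^ suc n ≈ 0# →
      ∏ (suc n) (λ i → 1# - q ^ suc i) * ∏ (suc n) (λ i → 1# - (q ^ 2) ^ suc i) ^ r * embed (partialProd (suc r) n) ≈ 1#
    partialProd-inverse-stable r n q^≈0 = trans
      (*-congʳ (*-cong (last≈1 q^≈0) (^-congˡ r (last≈1 (trans (^-assocʳ q 2 (suc n))
        (trans (^-homo-* q (suc n) (suc n ℕ.+ 0)) (trans (*-congʳ q^≈0) (zeroˡ _))))))))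
      (partialProd-inverse r n)
      where
      last≈1 : ∀ {x y} → y ≈ 0# → x * (1# - y) ≈ x
      last≈1 y≈0 = trans (*-congˡ (trans (+-congˡ (trans (-‿cong y≈0) -0#≈0#)) (+-identityʳ 1#))) (*-identityʳ _)

  -- The cofactor of 7 has the coefficients C(7, i)/7 up to sign; the version for 11 uses C(11,
  -- i)/11 in the same way.
  frobenius-7 : fromℤ (+ 7) ≈ 0# → ∀ x → (1# - x) ^ 7 ≈ 1# - x ^ 7
  frobenius-7 7≈0 x = trans
    (solve 1 (λ x → (con (+ 1) :- x) :^ 7 := (con (+ 1) :- x :^ 7) :+ con (+ 7) :*
       (con (+ 3) :* x :^ 2 :- x :- con (+ 5) :* x :^ 3 :+ con (+ 5) :* x :^ 4 :- con (+ 3) :* x :^ 5 :+ x :^ 6)) refl x)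
    (trans (+-congˡ (trans (*-congʳ 7≈0) (zeroˡ _))) (+-identityʳ _))

  frobenius-11 : fromℤ (+ 11) ≈ 0# → ∀ x → (1# - x) ^ 11 ≈ 1# - x ^ 11
  frobenius-11 11≈0 x = trans
    (solve 1 (λ x → (con (+ 1) :- x) :^ 11 := (con (+ 1) :- x :^ 11) :+ con (+ 11) :*
       (con (+ 5) :* x :^ 2 :- x :- con (+ 15) :* x :^ 3 :+ con (+ 30) :* x :^ 4 :- con (+ 42) :* x :^ 5
        :+ con (+ 42) :* x :^ 6 :- con (+ 30) :* x :^ 7 :+ con (+ 15) :* x :^ 8 :- con (+ 5) :* x :^ 9 :+ x :^ 10)) refl x)
    (trans (+-congˡ (trans (*-congʳ 11≈0) (zeroˡ _))) (+-identityʳ _))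

  module Frobenius (p : ℕ) (frobenius : ∀ x → (1# - x) ^ p ≈ 1# - x ^ p) where

    poch^p : ∀ q n → ∏ n (λ i → 1# - q ^ suc i) ^ p ≈ ∏ n (λ i → 1# - (q ^ p) ^ suc i)
    poch^p q n = trans (sym (∏-^ n _ p)) (∏-cong n λ i _ → begin
      (1# - q ^ suc i) ^ p     ≈⟨ frobenius _ ⟩
      1# - (q ^ suc i) ^ p     ≈⟨ +-congˡ (-‿cong (^-assocʳ q (suc i) p)) ⟩
      1# - q ^ (suc i ℕ.* p)   ≡⟨ ≡.cong (λ k → 1# - q ^ k) (ℕ.*-comm (suc i) p) ⟩
      1# - q ^ (p ℕ.* suc i)   ≈⟨ +-congˡ (-‿cong (^-assocʳ q p (suc i))) ⟨
      1# - (q ^ p) ^ suc i     ∎)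

  module Factorisation (r : ℕ) (q : Carrier) (K : ℕ) (q^K≈0 : q ^ K ≈ 0#)
    (s-nilpotent : ((q ^ 2) ^ (r ℕ.+ 3)) ^ K ≈ 0#)
    (frobenius : ∀ x → (1# - x) ^ (r ℕ.+ 3) ≈ 1# - x ^ (r ℕ.+ 3))
    (A : Carrier)
    (A-inverse : ∏ K (λ i → 1# - q ^ suc i) * ∏ K (λ i → 1# - (q ^ 2) ^ suc i) ^ r * A ≈ 1#)
    where

    private
      p : ℕ
      p = r ℕ.+ 3
      nilpotent : ∀ k → (q ^ suc k) ^ K ≈ 0#
      nilpotent = Identities.q^k-nilpotent q K q^K≈0
      module N₂ = Nilpotent (q ^ 2) K (nilpotent 1)

    -- E₂³/E₁ with E_k = ∏ (1 - q^(ki)).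
    theta : Carrier
    theta = ∑ (suc (K ℕ.+ K)) (Identities.Gauss.w q K q^K≈0) * ∑ (suc (K ℕ.+ K)) (Identities.Euler.w (q ^ 2) K (nilpotent 1))

    module Nₛ = Nilpotent ((q ^ 2) ^ p) K s-nilpotent

    -- Here r = d - 1, so E₁ E₂^r A ≈ 1 and p = r + 3. Inserting E₂^p H ≈ 1 therefore supplies the
    -- factors E₂^r and E₂³; Gauss's identity ψ E₁ ≈ E₂² turns E₂³ into the missing E₁ times ψ E₂,
    -- and ψ E₂ is `theta`.
    factorisation : A ≈ theta * Nₛ.poch⁻¹ K
    factorisation = begin
      A                                  ≈⟨ *-identityʳ A ⟨
      A * 1#                             ≈⟨ *-congˡ (Nₛ.poch-inverse K) ⟨
      A * (Nₛ.poch K * H)                ≈⟨ *-congˡ (*-congʳ (Frobenius.poch^p p frobenius (q ^ 2) K)) ⟨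
      A * (E₂ ^ p * H)                   ≈⟨ *-congˡ (*-congʳ (^-homo-* E₂ r 3)) ⟩
      A * (E₂ ^ r * E₂ ^ 3 * H)          ≈⟨ solve 4 (λ a b e h → a :* (b :* (e :* (e :* (e :* con (+ 1)))) :* h) := a :* b :* h :* e :* (e :* e)) refl A (E₂ ^ r) E₂ H ⟩
      A * E₂ ^ r * H * E₂ * (E₂ * E₂)    ≈⟨ *-congˡ (Identities.Gauss.gauss q K q^K≈0) ⟨
      A * E₂ ^ r * H * E₂ * (ψ * E₁)     ≈⟨ solve 6 (λ a b h e ψ f → a :* b :* h :* e :* (ψ :* f) := (f :* b :* a) :* (ψ :* e :* h)) refl A (E₂ ^ r) H E₂ ψ E₁ ⟩
      (E₁ * E₂ ^ r * A) * (ψ * E₂ * H)   ≈⟨ *-cong A-inverse (*-congʳ (*-congˡ (sym (Identities.Euler.euler (q ^ 2) K (nilpotent 1))))) ⟩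
      1# * (theta * H)                   ≈⟨ *-identityˡ _ ⟩
      theta * H                          ∎
      where
      H E₁ E₂ ψ : Carrier
      H = Nₛ.poch⁻¹ K
      E₁ = ∏ K (λ i → 1# - q ^ suc i)
      E₂ = N₂.poch K
      ψ = ∑ (suc (K ℕ.+ K)) (Identities.Gauss.w q K q^K≈0)

  module PartitionInverse (p : ℕ) (frobenius : ∀ x → (1# - x) ^ p ≈ 1# - x ^ p)
    (q : Carrier) (K : ℕ) (q^K≈0 : q ^ K ≈ 0#) (q^pK≈0 : (q ^ p) ^ K ≈ 0#) where

    open Identities q K q^K≈0
    module Nₚ = Nilpotent (q ^ p) K q^pK≈0

    H J E Z Eₚ : Carrier
    H = N.poch⁻¹ K
    J = ∑ (suc (K ℕ.+ K)) Jacobi.w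
    E = N.poch K
    Z = Nₚ.poch⁻¹ K
    Eₚ = Nₚ.poch K

    E^p : E ^ p ≈ Eₚ
    E^p = Frobenius.poch^p p frobenius q K

    E^p*Z : E ^ p * Z ≈ 1#
    E^p*Z = trans (*-congʳ E^p) (Nₚ.poch-inverse K)

    E*H : E * H ≈ 1#
    E*H = N.poch-inverse K

    J^k : ∀ k → J ^ k ≈ E ^ (3 ℕ.* k)
    J^k k = trans (^-congˡ k Jacobi.jacobi) (^-assocʳ E 3 k)

    -- 1/E = E⁶/E⁷, and E⁶ = (E³)².
    H-7 : p ≡ 7 → H ≈ J ^ 2 * Z
    H-7 ≡.refl = begin
      H                          ≈⟨ *-identityʳ H ⟨
      H * 1#                     ≈⟨ *-congˡ E^p*Z ⟨
      H * (E ^ 7 * Z)            ≈⟨ solve 3 (λ e h z → h :* (e :^ 7 :* z) := (e :* h) :* (e :^ 6 :* z)) refl E H Z ⟩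
      (E * H) * (E ^ 6 * Z)      ≈⟨ *-cong E*H (*-congʳ (sym (J^k 2))) ⟩
      1# * (J ^ 2 * Z)           ≈⟨ *-identityˡ _ ⟩
      J ^ 2 * Z                  ∎

    -- The exponent 10 is not a multiple of 3, so 1/E is written as E²¹/E²² with E²¹ = (E³)⁷.
    H-11 : p ≡ 11 → H ≈ J ^ 7 * (Z * Z)
    H-11 ≡.refl = begin
      H                                       ≈⟨ solve 1 (λ h → h := h :* (con (+ 1) :* con (+ 1))) refl H ⟩
      H * (1# * 1#)                           ≈⟨ *-congˡ (*-cong E^p*Z E^p*Z) ⟨
      H * ((E ^ 11 * Z) * (E ^ 11 * Z))       ≈⟨ solve 3 (λ e h z → h :* ((e :^ 11 :* z) :* (e :^ 11 :* z)) := (e :* h) :* (e :^ 21 :* (z :* z))) refl E H Z ⟩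
      (E * H) * (E ^ 21 * (Z * Z))            ≈⟨ *-cong E*H (*-congʳ (sym (J^k 7))) ⟩
      1# * (J ^ 7 * (Z * Z))                  ≈⟨ *-identityˡ _ ⟩
      J ^ 7 * (Z * Z)                         ∎

    -- E¹² read in two ways: as (E³)⁴, and as Euler's series times a series in q^11.
    J^4-11 : p ≡ 11 → J ^ 4 ≈ ∑ (suc (K ℕ.+ K)) Euler.w * Eₚ
    J^4-11 ≡.refl = begin
      J ^ 4               ≈⟨ J^k 4 ⟩
      E * E ^ 11          ≈⟨ *-cong (sym Euler.euler) E^p ⟩
      ∑ (suc (K ℕ.+ K)) Euler.w * Eₚ ∎

-- Sign-reversing reflections for the form 3x² + 2y²

module Cancellations where

  open import Data.Bool using (if_then_else_)
  open import Data.Empty using (⊥; ⊥-elim)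
  open import Data.Integer as ℤ using (ℤ; +_; -[1+_]; _+_; _*_; _-_; -_)
  import Data.Integer.Properties as ℤ
  open import Data.Integer.Divisibility.Signed using (_∣_; divides; _∣?_; ∣⇒∣ᵤ; ∣ᵤ⇒∣; ∣n⇒∣m*n; ∣m∣n⇒∣m-n)
  open import Data.Integer.Solver using (module +-*-Solver)
  open import Data.List using (List; []; _∷_; _++_; map; cartesianProduct)
  open import Data.List.Membership.Propositional using (_∈_)
  open import Data.List.Membership.Propositional.Properties using (∈-cartesianProduct⁺)
  open import Data.List.Relation.Unary.All as All using (All; []; _∷_)
  open import Data.List.Relation.Unary.AllPairs using ([]; _∷_)
  open import Data.List.Relation.Unary.Any using (here; there)
  open import Data.List.Relation.Unary.Unique.Propositional using (Unique)
  open import Data.List.Relation.Unary.Unique.Propositional.Properties using (cartesianProduct⁺)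
  open import Data.Nat as ℕ using (ℕ; zero; suc; s≤s)
  import Data.Nat.Properties as ℕ
  import Data.Nat.Divisibility as ℕ
  open import Data.Nat.Primality using (Prime; euclidsLemma; prime⇒nonZero)
  open import Data.Product using (∃; _×_; _,_; proj₁; proj₂)
  open import Data.Product.Properties using (≡-dec)
  open import Data.Sum using (_⊎_; inj₁; inj₂)
  open import Relation.Binary using (DecidableEquality)
  open import Relation.Binary.PropositionalEquality
  open import Relation.Nullary using (yes; no; ¬_; does)
  open import Relation.Nullary.Decidable using (dec-true; dec-false)

  open ThetaExponents using (sgn; tri; pent; m≤tri; m≤pent)
  open TripleProduct ℤ.+-*-commutativeRing using (∑; ∑-cong; *-distribˡ-∑)
  open PowerSeries using (monomial; monomial-≡; monomial-≢)

  open +-*-Solver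

  sumOver : ∀ {A : Set} → List A → (A → ℤ) → ℤ
  sumOver []       f = + 0
  sumOver (x ∷ xs) f = f x + sumOver xs f

  sumOver-cong : ∀ {A : Set} (xs : List A) {f g : A → ℤ} → (∀ x → f x ≡ g x) → sumOver xs f ≡ sumOver xs g
  sumOver-cong []       eq = refl
  sumOver-cong (x ∷ xs) eq = cong₂ _+_ (eq x) (sumOver-cong xs eq)

  sumOver-zero : ∀ {A : Set} (xs : List A) → sumOver xs (λ _ → + 0) ≡ + 0
  sumOver-zero []       = refl
  sumOver-zero (x ∷ xs) = trans (ℤ.+-identityˡ _) (sumOver-zero xs)

  sumOver-+ : ∀ {A : Set} (xs : List A) (f g : A → ℤ) → sumOver xs (λ x → f x + g x) ≡ sumOver xs f + sumOver xs g
  sumOver-+ []       f g = refl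
  sumOver-+ (x ∷ xs) f g = trans (cong (λ y → f x + g x + y) (sumOver-+ xs f g))
    (solve 4 (λ a b c d → (a :+ b) :+ (c :+ d) := (a :+ c) :+ (b :+ d)) refl (f x) (g x) (sumOver xs f) (sumOver xs g))

  sumOver-neg : ∀ {A : Set} (xs : List A) (f : A → ℤ) → sumOver xs (λ x → - f x) ≡ - sumOver xs f
  sumOver-neg []       f = refl
  sumOver-neg (x ∷ xs) f = trans (cong (λ y → - f x + y) (sumOver-neg xs f)) (sym (ℤ.neg-distrib-+ (f x) (sumOver xs f)))

  sumOver-swap : ∀ {A B : Set} (xs : List A) (ys : List B) (f : A → B → ℤ) →
    sumOver xs (λ x → sumOver ys (f x)) ≡ sumOver ys (λ y → sumOver xs (λ x → f x y))
  sumOver-swap []       ys f = sym (sumOver-zero ys)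
  sumOver-swap (x ∷ xs) ys f = trans (cong (λ z → sumOver ys (f x) + z) (sumOver-swap xs ys f)) (sym (sumOver-+ ys (f x) _))

  sumOver-++ : ∀ {A : Set} (xs ys : List A) (f : A → ℤ) → sumOver (xs ++ ys) f ≡ sumOver xs f + sumOver ys f
  sumOver-++ []       ys f = sym (ℤ.+-identityˡ _)
  sumOver-++ (x ∷ xs) ys f = trans (cong (λ y → f x + y) (sumOver-++ xs ys f)) (sym (ℤ.+-assoc (f x) (sumOver xs f) (sumOver ys f)))

  sumOver-map : ∀ {A B : Set} (g : A → B) (xs : List A) (f : B → ℤ) → sumOver (map g xs) f ≡ sumOver xs (λ x → f (g x))
  sumOver-map g []       f = refl
  sumOver-map g (x ∷ xs) f = cong (λ y → f (g x) + y) (sumOver-map g xs f)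

  sumOver-product : ∀ {A B : Set} (xs : List A) (ys : List B) (f : A × B → ℤ) →
    sumOver (cartesianProduct xs ys) f ≡ sumOver xs (λ x → sumOver ys (λ y → f (x , y)))
  sumOver-product []       ys f = refl
  sumOver-product (x ∷ xs) ys f = trans (sumOver-++ (map (x ,_) ys) (cartesianProduct xs ys) f)
    (cong₂ _+_ (sumOver-map (x ,_) ys f) (sumOver-product xs ys f))

  module _ {A : Set} (_≟_ : DecidableEquality A) where

    indicator : A → A → ℤ
    indicator a b = if does (a ≟ b) then + 1 else + 0

    indicator-≢ : ∀ {a b} → a ≢ b → indicator a b ≡ + 0
    indicator-≢ {a} {b} a≢b rewrite dec-false (a ≟ b) a≢b = refl

    indicator-≡ : ∀ a → indicator a a ≡ + 1
    indicator-≡ a rewrite dec-true (a ≟ a) refl = refl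

    sumOver-∉ : ∀ xs c z → All (c ≢_) xs → sumOver xs (λ b → indicator b c * z) ≡ + 0
    sumOver-∉ []       c z _ = refl
    sumOver-∉ (x ∷ xs) c z (c≢x ∷ c∉xs) rewrite indicator-≢ (≢-sym c≢x) = trans (ℤ.+-identityˡ _) (sumOver-∉ xs c z c∉xs)

    sumOver-indicator : ∀ {xs} c z → Unique xs → c ∈ xs → sumOver xs (λ b → indicator b c * z) ≡ z
    sumOver-indicator {x ∷ xs} c z (x∉xs ∷ _) (here refl) rewrite indicator-≡ c | sumOver-∉ xs c z x∉xs =
      trans (ℤ.+-identityʳ _) (ℤ.*-identityˡ z)
    sumOver-indicator {x ∷ xs} c z (x∉xs ∷ uniq) (there c∈xs) rewrite indicator-≢ (All.lookup x∉xs c∈xs) =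
      trans (ℤ.+-identityˡ _) (sumOver-indicator c z uniq c∈xs)

    i≡-i⇒i≡0 : ∀ i → i ≡ - i → i ≡ + 0
    i≡-i⇒i≡0 (+ zero)  _ = refl
    i≡-i⇒i≡0 (+ suc n) ()
    i≡-i⇒i≡0 -[1+ n ]  ()

    -- Both sides of Σₐ w(a) = Σₐ Σ_b [b = σ a] w(a) = - Σₐ Σ_b [a = σ b] w(b) range over the same list.
    involution-cancels : ∀ {xs} → Unique xs → (σ : A → A) (w : A → ℤ) →
      (∀ a → w a ≡ + 0 ⊎ (σ a ∈ xs × σ (σ a) ≡ a × w (σ a) ≡ - w a)) → sumOver xs w ≡ + 0
    involution-cancels {xs} uniq σ w h = i≡-i⇒i≡0 (sumOver xs w) (begin
      sumOver xs w                                                   ≡⟨ sumOver-cong xs (λ a → sym (expand a)) ⟩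
      sumOver xs (λ a → sumOver xs (λ b → indicator b (σ a) * w a))  ≡⟨ sumOver-swap xs xs _ ⟩
      sumOver xs (λ b → sumOver xs (λ a → indicator b (σ a) * w a))  ≡⟨ sumOver-cong xs (λ b → sumOver-cong xs (λ a → flip a b)) ⟩
      sumOver xs (λ b → sumOver xs (λ a → - (indicator a (σ b) * w b)))  ≡⟨ sumOver-cong xs (λ b → sumOver-neg xs _) ⟩
      sumOver xs (λ b → - sumOver xs (λ a → indicator a (σ b) * w b))    ≡⟨ sumOver-neg xs _ ⟩
      - sumOver xs (λ b → sumOver xs (λ a → indicator a (σ b) * w b))    ≡⟨ cong -_ (sumOver-cong xs expand) ⟩
      - sumOver xs w                                                 ∎)
      where
      open ≡-Reasoning
      times-zero : ∀ a b {c} → w c ≡ + 0 → indicator a b * w c ≡ + 0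
      times-zero a b {c} eq = trans (cong (indicator a b *_) eq) (ℤ.*-zeroʳ (indicator a b))
      expand : ∀ a → sumOver xs (λ b → indicator b (σ a) * w a) ≡ w a
      expand a with h a
      ... | inj₁ wa≡0 = trans (sumOver-cong xs (λ b → times-zero b (σ a) wa≡0)) (trans (sumOver-zero xs) (sym wa≡0))
      ... | inj₂ (σa∈ , _) = sumOver-indicator (σ a) (w a) uniq σa∈
      0≡-0 : ∀ {i j} → i ≡ + 0 → j ≡ + 0 → i ≡ - j
      0≡-0 refl refl = refl
      flip : ∀ a b → indicator b (σ a) * w a ≡ - (indicator a (σ b) * w b)
      flip a b with h a | h b
      ... | inj₁ wa | inj₁ wb = 0≡-0 (times-zero b (σ a) wa) (times-zero a (σ b) wb)
      ... | inj₁ wa | inj₂ (_ , σσb , wσb) with a ≟ σ b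
      ...   | yes refl = 0≡-0 (times-zero b (σ a) wa) (trans (ℤ.*-identityˡ (w b)) (trans (sym (ℤ.neg-involutive (w b))) (cong -_ (trans (sym wσb) wa))))
      ...   | no _     = 0≡-0 (times-zero b (σ a) wa) refl
      flip a b | inj₂ (_ , σσa , wσa) | r with b ≟ σ a
      ... | yes refl rewrite σσa | indicator-≡ a | wσa = trans (ℤ.*-identityˡ (w a)) (trans (sym (ℤ.neg-involutive (w a))) (cong -_ (sym (ℤ.*-identityˡ (- w a)))))
      flip a b | inj₂ (_ , σσa , wσa) | inj₁ wb | no _ = 0≡-0 refl (times-zero a (σ b) wb)
      flip a b | inj₂ (_ , σσa , wσa) | inj₂ (_ , σσb , _) | no b≢σa
        rewrite indicator-≢ {a} {σ b} (λ a≡σb → b≢σa (sym (trans (cong σ a≡σb) σσb))) = refl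

  -- The range -n, ..., n - 1 is symmetric under i ↦ -1 - i, the symmetry by which sums over ℤ fold
  -- to sums over ℕ.
  ints : ℕ → List ℤ
  ints zero    = []
  ints (suc n) = + n ∷ -[1+ n ] ∷ ints n

  sumOver-ints : ∀ n f → sumOver (ints n) f ≡ ∑ n (λ i → f (+ i) + f -[1+ i ])
  sumOver-ints zero    f = refl
  sumOver-ints (suc n) f = trans (cong (λ x → f (+ n) + (f -[1+ n ] + x)) (sumOver-ints n f))
    (solve 3 (λ a b c → a :+ (b :+ c) := c :+ (a :+ b)) refl (f (+ n)) (f -[1+ n ]) (∑ n (λ i → f (+ i) + f -[1+ i ])))

  pos∈ints : ∀ {i n} → i ℕ.< n → + i ∈ ints n
  pos∈ints {i} {suc n} (s≤s i≤n) with ℕ.m≤n⇒m<n∨m≡n i≤n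
  ... | inj₁ i<n  = there (there (pos∈ints i<n))
  ... | inj₂ refl = here refl

  neg∈ints : ∀ {i n} → i ℕ.< n → -[1+ i ] ∈ ints n
  neg∈ints {i} {suc n} (s≤s i≤n) with ℕ.m≤n⇒m<n∨m≡n i≤n
  ... | inj₁ i<n  = there (there (neg∈ints i<n))
  ... | inj₂ refl = there (here refl)

  ints-unique : ∀ n → Unique (ints n)
  ints-unique zero    = []
  ints-unique (suc n) = ((λ ()) ∷ pos-fresh n ℕ.≤-refl) ∷ neg-fresh n ℕ.≤-refl ∷ ints-unique n
    where
    pos-fresh : ∀ {i} n → n ℕ.≤ i → All (+ i ≢_) (ints n)
    pos-fresh zero    _   = []
    pos-fresh (suc n) n<i = (λ { refl → ℕ.<-irrefl refl n<i }) ∷ (λ ()) ∷ pos-fresh n (ℕ.<⇒≤ n<i)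
    neg-fresh : ∀ {i} n → n ℕ.≤ i → All (-[1+ i ] ≢_) (ints n)
    neg-fresh zero    _   = []
    neg-fresh (suc n) n<i = (λ ()) ∷ (λ { refl → ℕ.<-irrefl refl n<i }) ∷ neg-fresh n (ℕ.<⇒≤ n<i)

  sgnℤ : ℤ → ℤ
  sgnℤ k = sgn ℤ.∣ k ∣

  sgnℤ-suc : ∀ k → sgnℤ (k + + 1) ≡ - sgnℤ k
  sgnℤ-suc (+ n) rewrite ℕ.+-comm n 1 = refl
  sgnℤ-suc -[1+ zero ]  = refl
  sgnℤ-suc -[1+ suc n ] = sym (ℤ.neg-involutive _)

  sgnℤ-+2 : ∀ k → sgnℤ (k + + 2) ≡ sgnℤ k
  sgnℤ-+2 k = begin
    sgnℤ (k + + 2)           ≡⟨ cong sgnℤ (ℤ.+-assoc k (+ 1) (+ 1)) ⟨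
    sgnℤ (k + + 1 + + 1)     ≡⟨ sgnℤ-suc (k + + 1) ⟩
    - sgnℤ (k + + 1)         ≡⟨ cong -_ (sgnℤ-suc k) ⟩
    - - sgnℤ k               ≡⟨ ℤ.neg-involutive (sgnℤ k) ⟩
    sgnℤ k                   ∎
    where open ≡-Reasoning

  sgnℤ-even : ∀ k h → sgnℤ (k + + 2 * h) ≡ sgnℤ k
  sgnℤ-even k (+ zero)  = cong sgnℤ (ℤ.+-identityʳ k)
  sgnℤ-even k (+ suc n) = trans (cong sgnℤ (solve 2 (λ k n → k :+ con (+ 2) :* (con (+ 1) :+ n) := k :+ con (+ 2) :* n :+ con (+ 2)) refl k (+ n)))
    (trans (sgnℤ-+2 (k + + 2 * + n)) (sgnℤ-even k (+ n)))
  sgnℤ-even k -[1+ zero ]  = trans (sym (sgnℤ-+2 (k + + 2 * -[1+ 0 ])))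
    (cong sgnℤ (solve 1 (λ k → k :+ con (+ 2) :* con -[1+ 0 ] :+ con (+ 2) := k) refl k))
  sgnℤ-even k -[1+ suc n ] = trans (sym (sgnℤ-+2 (k + + 2 * -[1+ suc n ])))
    (trans (cong sgnℤ (solve 2 (λ k n → k :+ con (+ 2) :* (con -[1+ 0 ] :+ n) :+ con (+ 2) := k :+ con (+ 2) :* n) refl k -[1+ n ]))
    (sgnℤ-even k -[1+ n ]))

  sgnℤ-odd : ∀ k h → sgnℤ (k + (+ 2 * h + + 1)) ≡ - sgnℤ k
  sgnℤ-odd k h = trans (cong sgnℤ (sym (ℤ.+-assoc k (+ 2 * h) (+ 1)))) (trans (sgnℤ-suc (k + + 2 * h)) (cong -_ (sgnℤ-even k h)))

  -- With x = 2m + 1 and y = 6k - 1, 3x² + 2y² = 12 (form m k) + 5.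
  form : ℤ → ℤ → ℤ
  form m k = m * (m + + 1) + + 2 * (k * (+ 3 * k - + 1))


  -- The substitution m ↦ -1 - m is x ↦ -x.
  form-+ : ∀ i k → form (+ i) k ≡ form -[1+ i ] k
  form-+ i k = cong (λ x → x + + 2 * (k * (+ 3 * k - + 1)))
    (solve 1 (λ i → i :* (i :+ con (+ 1)) := (:- (con (+ 1) :+ i)) :* ((:- (con (+ 1) :+ i)) :+ con (+ 1))) refl (+ i))

  tri-double : ∀ i → + i * (+ i + + 1) ≡ + 2 * + tri i
  tri-double zero    = refl
  tri-double (suc i) = begin
    (+ 1 + + i) * (+ 1 + + i + + 1)                  ≡⟨ solve 1 (λ i → (con (+ 1) :+ i) :* (con (+ 1) :+ i :+ con (+ 1)) := con (+ 2) :* (con (+ 1) :+ i) :+ i :* (i :+ con (+ 1))) refl (+ i) ⟩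
    + 2 * (+ 1 + + i) + + i * (+ i + + 1)            ≡⟨ cong (λ x → + 2 * (+ 1 + + i) + x) (tri-double i) ⟩
    + 2 * (+ 1 + + i) + + 2 * + tri i                ≡⟨ ℤ.*-distribˡ-+ (+ 2) (+ 1 + + i) (+ tri i) ⟨
    + 2 * + tri (suc i)                              ∎
    where open ≡-Reasoning

  pent-double : ∀ i → + i * (+ 3 * + i - + 1) ≡ + 2 * + pent i
  pent-double zero    = refl
  pent-double (suc i) = begin
    (+ 1 + + i) * (+ 3 * (+ 1 + + i) - + 1)
      ≡⟨ solve 1 (λ i → (con (+ 1) :+ i) :* (con (+ 3) :* (con (+ 1) :+ i) :- con (+ 1)) := con (+ 2) :* (i :+ (i :+ i) :+ con (+ 1)) :+ i :* (con (+ 3) :* i :- con (+ 1))) refl (+ i) ⟩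
    + 2 * (+ i + (+ i + + i) + + 1) + + i * (+ 3 * + i - + 1)   ≡⟨ cong (λ x → + 2 * (+ i + (+ i + + i) + + 1) + x) (pent-double i) ⟩
    + 2 * (+ i + (+ i + + i) + + 1) + + 2 * + pent i            ≡⟨ ℤ.*-distribˡ-+ (+ 2) (+ i + (+ i + + i) + + 1) (+ pent i) ⟨
    + 2 * + pent (suc i)                                        ∎
    where open ≡-Reasoning

  -- The values of `form`/2 at k = j and at k = -1 - j, the two monomials of one term of Euler's
  -- series in q².
  exponent₁ exponent₂ : ℕ → ℕ → ℕ
  exponent₁ i j = tri i ℕ.+ 2 ℕ.* pent j
  exponent₂ i j = tri i ℕ.+ 2 ℕ.* (pent j ℕ.+ (4 ℕ.* j ℕ.+ 2))

  form-exponent₁ : ∀ i j → form (+ i) (+ j) ≡ + 2 * + exponent₁ i j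
  form-exponent₁ i j = trans (cong₂ (λ x y → x + + 2 * y) (tri-double i) (pent-double j))
    (trans (cong (λ x → + 2 * + tri i + + 2 * x) (sym (ℤ.pos-* 2 (pent j)))) (sym (ℤ.*-distribˡ-+ (+ 2) (+ tri i) (+ (2 ℕ.* pent j)))))

  form-exponent₂ : ∀ i j → form (+ i) -[1+ j ] ≡ + 2 * + exponent₂ i j
  form-exponent₂ i j = begin
    + i * (+ i + + 1) + + 2 * (-[1+ j ] * (+ 3 * -[1+ j ] - + 1))
      ≡⟨ cong₂ (λ x y → x + + 2 * y) (tri-double i) (solve 1 (λ j → (:- (con (+ 1) :+ j)) :* (con (+ 3) :* (:- (con (+ 1) :+ j)) :- con (+ 1))
           := j :* (con (+ 3) :* j :- con (+ 1)) :+ con (+ 2) :* (con (+ 4) :* j :+ con (+ 2))) refl (+ j)) ⟩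
    + 2 * + tri i + + 2 * (+ j * (+ 3 * + j - + 1) + + 2 * (+ 4 * + j + + 2))
      ≡⟨ cong₂ (λ x y → + 2 * + tri i + + 2 * (x + + 2 * (y + + 2))) (pent-double j) (sym (ℤ.pos-* 4 j)) ⟩
    + 2 * + tri i + + 2 * (+ 2 * + pent j + + 2 * + (4 ℕ.* j ℕ.+ 2))
      ≡⟨ solve 3 (λ t p r → con (+ 2) :* t :+ con (+ 2) :* (con (+ 2) :* p :+ con (+ 2) :* r) := con (+ 2) :* (t :+ con (+ 2) :* (p :+ r))) refl (+ tri i) (+ pent j) (+ (4 ℕ.* j ℕ.+ 2)) ⟩
    + 2 * (+ tri i + + 2 * + (pent j ℕ.+ (4 ℕ.* j ℕ.+ 2)))
      ≡⟨ cong (λ x → + 2 * (+ tri i + x)) (sym (ℤ.pos-* 2 (pent j ℕ.+ (4 ℕ.* j ℕ.+ 2)))) ⟩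
    + 2 * + exponent₂ i j ∎
    where open ≡-Reasoning

  i≤exponent₁ : ∀ i j → i ℕ.≤ exponent₁ i j
  i≤exponent₁ i j = ℕ.≤-trans (m≤tri i) (ℕ.m≤m+n (tri i) _)

  i≤exponent₂ : ∀ i j → i ℕ.≤ exponent₂ i j
  i≤exponent₂ i j = ℕ.≤-trans (m≤tri i) (ℕ.m≤m+n (tri i) _)

  j≤exponent₁ : ∀ i j → j ℕ.≤ exponent₁ i j
  j≤exponent₁ i j = ℕ.≤-trans (ℕ.≤-trans (m≤pent j) (ℕ.m≤m+n (pent j) _)) (ℕ.m≤n+m _ (tri i))

  j≤exponent₂ : ∀ i j → j ℕ.≤ exponent₂ i j
  j≤exponent₂ i j = ℕ.≤-trans (ℕ.≤-trans (m≤pent j) (ℕ.≤-trans (ℕ.m≤m+n (pent j) _) (ℕ.m≤m+n (pent j ℕ.+ (4 ℕ.* j ℕ.+ 2)) _))) (ℕ.m≤n+m _ (tri i))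

  double-injective : ∀ {a b} → + 2 * + a ≡ + 2 * + b → a ≡ b
  double-injective {a} {b} eq = ℤ.+-injective (ℤ.*-cancelˡ-≡ (+ 2) (+ a) (+ b) eq)

  exponent-bounded : ∀ {x n L} e → x ≡ + 2 * + e → x ≡ + 2 * + n → n ℕ.< L → e ℕ.< L
  exponent-bounded {n = n} e eq eq′ n<L = subst (ℕ._< _) (double-injective {n} {e} (trans (sym eq′) eq)) n<L

  -- The reflections need not preserve the box of summation, but they preserve the ellipse `form` =
  -- 2n, and this lemma puts the ellipse inside the box. Each of the triangular and pentagonal
  -- numbers dominates its index.
  form-bounded : ∀ {n L} m k → n ℕ.< L → form m k ≡ + 2 * + n → m ∈ ints L × k ∈ ints L
  form-bounded (+ i) (+ j) n<L eq = pos∈ints (ℕ.≤-<-trans (i≤exponent₁ i j) e<L) , pos∈ints (ℕ.≤-<-trans (j≤exponent₁ i j) e<L)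
    where e<L = exponent-bounded (exponent₁ i j) (form-exponent₁ i j) eq n<L
  form-bounded (+ i) -[1+ j ] n<L eq = pos∈ints (ℕ.≤-<-trans (i≤exponent₂ i j) e<L) , neg∈ints (ℕ.≤-<-trans (j≤exponent₂ i j) e<L)
    where e<L = exponent-bounded (exponent₂ i j) (form-exponent₂ i j) eq n<L
  form-bounded -[1+ i ] (+ j) n<L eq = neg∈ints (ℕ.≤-<-trans (i≤exponent₁ i j) e<L) , pos∈ints (ℕ.≤-<-trans (j≤exponent₁ i j) e<L)
    where e<L = exponent-bounded (exponent₁ i j) (form-exponent₁ i j) (trans (form-+ i (+ j)) eq) n<L
  form-bounded -[1+ i ] -[1+ j ] n<L eq = neg∈ints (ℕ.≤-<-trans (i≤exponent₂ i j) e<L) , neg∈ints (ℕ.≤-<-trans (j≤exponent₂ i j) e<L)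
    where e<L = exponent-bounded (exponent₂ i j) (form-exponent₂ i j) (trans (form-+ i -[1+ j ]) eq) n<L

  -- The reflection (m , k) ↦ (m + u t , k + t) with t = ℓ m k / p.  It preserves the
  -- form, and since t is odd it changes the sign of sgnℤ k.
  record Reflection (p : ℤ) : Set where
    field
      ℓ          : ℤ → ℤ → ℤ
      u κ        : ℤ
      ℓ-odd      : ∀ m k → ∃ λ h → ℓ m k ≡ + 2 * h + + 1
      ℓ-shift    : ∀ m k t → ℓ (m + u * t) (k + t) ≡ ℓ m k - + 2 * (t * p)
      form-shift : ∀ m k t → form (m + u * t) (k + t) ≡ form m k + κ * (t * (t * p - ℓ m k))

  module Cancellation (p p′ : ℤ) .{{_ : ℤ.NonZero p}} (p-odd : p ≡ + 2 * p′ + + 1) (ρ₊ ρ₋ : Reflection p) (n L : ℕ) (n<L : n ℕ.< L)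
    (cover : ∀ m k → form m k ≡ + 2 * + n → p ∣ Reflection.ℓ ρ₊ m k ⊎ p ∣ Reflection.ℓ ρ₋ m k)
    (exclusive : ∀ m k → form m k ≡ + 2 * + n → p ∣ Reflection.ℓ ρ₊ m k → p ∣ Reflection.ℓ ρ₋ m k → ⊥)
    where

    Point : Set
    Point = ℤ × ℤ

    weight : Point → ℤ
    weight (m , k) = if does (form m k ℤ.≟ + 2 * + n) then sgnℤ k else + 0

    weight-on : ∀ {m k} → form m k ≡ + 2 * + n → weight (m , k) ≡ sgnℤ k
    weight-on {m} {k} eq rewrite dec-true (form m k ℤ.≟ + 2 * + n) eq = refl

    weight-off : ∀ {m k} → form m k ≢ + 2 * + n → weight (m , k) ≡ + 0
    weight-off {m} {k} neq rewrite dec-false (form m k ℤ.≟ + 2 * + n) neq = refl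

    module Reflect (ρ : Reflection p) where
      open Reflection ρ

      reflect : Point → ℤ → Point
      reflect (m , k) t = m + u * t , k + t

      ℓ-reflected : ∀ m k t → ℓ m k ≡ t * p → ℓ (m + u * t) (k + t) ≡ (- t) * p
      ℓ-reflected m k t eq = begin
        ℓ (m + u * t) (k + t)          ≡⟨ ℓ-shift m k t ⟩
        ℓ m k - + 2 * (t * p)          ≡⟨ cong (λ x → x - + 2 * (t * p)) eq ⟩
        t * p - + 2 * (t * p)          ≡⟨ solve 2 (λ t p → t :* p :- con (+ 2) :* (t :* p) := (:- t) :* p) refl t p ⟩
        (- t) * p                      ∎
        where open ≡-Reasoning

      form-reflected : ∀ m k t → ℓ m k ≡ t * p → form (m + u * t) (k + t) ≡ form m k
      form-reflected m k t eq = begin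
        form (m + u * t) (k + t)                     ≡⟨ form-shift m k t ⟩
        form m k + κ * (t * (t * p - ℓ m k))         ≡⟨ cong (λ x → form m k + κ * (t * (t * p - x))) eq ⟩
        form m k + κ * (t * (t * p - t * p))         ≡⟨ solve 4 (λ f κ t p → f :+ κ :* (t :* (t :* p :- t :* p)) := f) refl (form m k) κ t p ⟩
        form m k                                     ∎
        where open ≡-Reasoning

      -- In ℓ m k = t p both ℓ m k and p are odd, so t is odd; with p = 2p′ + 1 this reads t = ℓ m k
      -- - 2 t p′.
      sgn-reflected : ∀ m k t → ℓ m k ≡ t * p → sgnℤ (k + t) ≡ - sgnℤ k
      sgn-reflected m k t eq with h , ℓ≡ ← ℓ-odd m k = trans (cong (λ x → sgnℤ (k + x)) t-odd) (sgnℤ-odd k (h - t * p′))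
        where
        open ≡-Reasoning
        t-odd : t ≡ + 2 * (h - t * p′) + + 1
        t-odd = begin
          t                                            ≡⟨ solve 2 (λ t p′ → t := t :* (con (+ 2) :* p′ :+ con (+ 1)) :- con (+ 2) :* (t :* p′)) refl t p′ ⟩
          t * (+ 2 * p′ + + 1) - + 2 * (t * p′)        ≡⟨ cong (λ x → t * x - + 2 * (t * p′)) p-odd ⟨
          t * p - + 2 * (t * p′)                       ≡⟨ cong (λ x → x - + 2 * (t * p′)) (trans (sym eq) ℓ≡) ⟩
          (+ 2 * h + + 1) - + 2 * (t * p′)             ≡⟨ solve 2 (λ h x → (con (+ 2) :* h :+ con (+ 1)) :- con (+ 2) :* x := con (+ 2) :* (h :- x) :+ con (+ 1)) refl h (t * p′) ⟩
          + 2 * (h - t * p′) + + 1                     ∎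

      reflect-involutive : ∀ m k t t′ → ℓ m k ≡ t * p → ℓ (m + u * t) (k + t) ≡ t′ * p →
        reflect (reflect (m , k) t) t′ ≡ (m , k)
      reflect-involutive m k t t′ eq eq′
        with refl ← ℤ.*-cancelʳ-≡ (- t) t′ p (trans (sym (ℓ-reflected m k t eq)) eq′) =
        cong₂ _,_ (solve 3 (λ m u t → m :+ u :* t :+ u :* (:- t) := m) refl m u t)
                  (solve 2 (λ k t → k :+ t :+ :- t := k) refl k t)

    module R₊ = Reflect ρ₊
    module R₋ = Reflect ρ₋
    open Reflection ρ₊ using () renaming (ℓ to ℓ₊)
    open Reflection ρ₋ using () renaming (ℓ to ℓ₋)

    -- On the ellipse, `cover` makes one of the two reflections available and `exclusive` makes the
    -- choice unambiguous, so testing ℓ₊ first introduces no asymmetry. Elsewhere the weight is 0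
    -- and the value is immaterial.
    σ : Point → Point
    σ (m , k) with p ∣? ℓ₊ m k
    ... | yes (divides t _) = R₊.reflect (m , k) t
    ... | no _ with p ∣? ℓ₋ m k
    ...   | yes (divides t _) = R₋.reflect (m , k) t
    ...   | no _ = m , k

    module Image (m k m′ k′ : ℤ) (on : form m k ≡ + 2 * + n) (form′ : form m′ k′ ≡ form m k) (sgn′ : sgnℤ k′ ≡ - sgnℤ k) where
      on′ : form m′ k′ ≡ + 2 * + n
      on′ = trans form′ on
      member : (m′ , k′) ∈ cartesianProduct (ints L) (ints L)
      member = ∈-cartesianProduct⁺ (proj₁ (form-bounded m′ k′ n<L on′)) (proj₂ (form-bounded m′ k′ n<L on′))
      weight′ : weight (m′ , k′) ≡ - weight (m , k)
      weight′ = trans (weight-on {m′} {k′} on′) (trans sgn′ (cong -_ (sym (weight-on {m} {k} on))))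

    σ-image : ∀ m k → form m k ≡ + 2 * + n →
      σ (m , k) ∈ cartesianProduct (ints L) (ints L) × σ (σ (m , k)) ≡ (m , k) × weight (σ (m , k)) ≡ - weight (m , k)
    σ-image m k on with p ∣? ℓ₊ m k
    ... | yes (divides t eq) = I.member , back , I.weight′
      where
      module I = Image m k (m + Reflection.u ρ₊ * t) (k + t) on (R₊.form-reflected m k t eq) (R₊.sgn-reflected m k t eq)
      back : σ (R₊.reflect (m , k) t) ≡ (m , k)
      back with p ∣? ℓ₊ (m + Reflection.u ρ₊ * t) (k + t)
      ... | yes (divides t′ eq′) = R₊.reflect-involutive m k t t′ eq eq′
      ... | no ∤ = ⊥-elim (∤ (divides (- t) (R₊.ℓ-reflected m k t eq)))
    ... | no ∤₊ with p ∣? ℓ₋ m k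
    ...   | no ∤₋ with cover m k on
    ...     | inj₁ d = ⊥-elim (∤₊ d)
    ...     | inj₂ d = ⊥-elim (∤₋ d)
    σ-image m k on | no ∤₊ | yes (divides t eq) = I.member , back , I.weight′
      where
      module I = Image m k (m + Reflection.u ρ₋ * t) (k + t) on (R₋.form-reflected m k t eq) (R₋.sgn-reflected m k t eq)
      back : σ (R₋.reflect (m , k) t) ≡ (m , k)
      back with p ∣? ℓ₊ (m + Reflection.u ρ₋ * t) (k + t)
      -- The image lies on the ellipse again and p still divides its ℓ₋, so σ cannot switch to ρ₊
      -- there.
      ... | yes d = ⊥-elim (exclusive _ _ I.on′ d (divides (- t) (R₋.ℓ-reflected m k t eq)))
      ... | no _ with p ∣? ℓ₋ (m + Reflection.u ρ₋ * t) (k + t)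
      ...   | yes (divides t′ eq′) = R₋.reflect-involutive m k t t′ eq eq′
      ...   | no ∤ = ⊥-elim (∤ (divides (- t) (R₋.ℓ-reflected m k t eq)))

    cancellation : sumOver (ints L) (λ m → sumOver (ints L) (λ k → weight (m , k))) ≡ + 0
    cancellation = trans (sym (sumOver-product (ints L) (ints L) weight))
      (involution-cancels (≡-dec ℤ._≟_ ℤ._≟_) (cartesianProduct⁺ (ints-unique L) (ints-unique L)) σ weight dichotomy)
      where
      dichotomy : ∀ a → weight a ≡ + 0 ⊎ (σ a ∈ cartesianProduct (ints L) (ints L) × σ (σ a) ≡ a × weight (σ a) ≡ - weight a)
      dichotomy (m , k) with form m k ℤ.≟ + 2 * + n
      ... | no off = inj₁ refl
      ... | yes on with σ-image m k on
      ...   | mem , back , w = inj₂ (mem , back , trans w (cong -_ (weight-on {m} {k} on)))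

  discriminant : ℤ → ℤ → ℤ
  discriminant m k = + 12 * form m k + + 5

  discriminant-on : ∀ {m k n} → form m k ≡ + 2 * n → discriminant m k ≡ + 24 * n + + 5
  discriminant-on {n = n} eq = trans (cong (λ x → + 12 * x + + 5) eq)
    (solve 1 (λ n → con (+ 12) :* (con (+ 2) :* n) :+ con (+ 5) := con (+ 24) :* n :+ con (+ 5)) refl n)

  prime-divides-product : ∀ {p} → Prime p → ∀ a b → + p ∣ a * b → + p ∣ a ⊎ + p ∣ b
  prime-divides-product pr a b d with euclidsLemma ℤ.∣ a ∣ ℤ.∣ b ∣ pr (subst (_ ℕ.∣_) (ℤ.abs-* a b) (∣⇒∣ᵤ d))
  ... | inj₁ da = inj₁ (∣ᵤ⇒∣ da)
  ... | inj₂ db = inj₂ (∣ᵤ⇒∣ db)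

  divides-factor : ∀ {p} → Prime p → ¬ + p ∣ + 3 → ∀ a b c e D → + 3 * (a * b) ≡ c * + p - e * D →
    + p ∣ D → + p ∣ a ⊎ + p ∣ b
  divides-factor {p} pr ∤3 a b c e D eq d with prime-divides-product pr (+ 3) (a * b)
    (subst (+ p ∣_) (sym eq) (∣m∣n⇒∣m-n {+ p} {c * + p} {e * D} (divides c refl) (∣n⇒∣m*n e d)))
  ... | inj₁ d = ⊥-elim (∤3 d)
  ... | inj₂ d = prime-divides-product pr a b d

  square-divides : ∀ {p a b} α β D → + 16 * D ≡ α * ((a - b) * (a - b)) + β * ((a + b) * (a + b)) →
    p ∣ a → p ∣ b → p * p ∣ + 16 * D
  square-divides {p} α β D eq (divides s refl) (divides t refl) = divides (α * ((s - t) * (s - t)) + β * ((s + t) * (s + t)))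
    (trans eq (solve 5 (λ α β s t p → α :* ((s :* p :- t :* p) :* (s :* p :- t :* p)) :+ β :* ((s :* p :+ t :* p) :* (s :* p :+ t :* p))
      := (α :* ((s :- t) :* (s :- t)) :+ β :* ((s :+ t) :* (s :+ t))) :* (p :* p)) refl α β s t p))

  -- The reflections are conjugate under x ↦ - x, and modulo p the product ℓ₊ ℓ₋ is a multiple of 3x² + 2y².
  record ConjugateReflections (p : ℤ) : Set where
    field
      ρ₊ ρ₋     : Reflection p
      A         : ℤ → ℤ → ℤ
      e α β     : ℤ
      product   : ∀ m k → + 3 * (Reflection.ℓ ρ₊ m k * Reflection.ℓ ρ₋ m k) ≡ A m k * p - e * discriminant m k
      recombine : ∀ m k → let a = Reflection.ℓ ρ₊ m k; b = Reflection.ℓ ρ₋ m k in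
        + 16 * discriminant m k ≡ α * ((a - b) * (a - b)) + β * ((a + b) * (a + b))

  module ThetaVanishing (p : ℕ) (p′ : ℤ) (prime : Prime p) (p-odd : + p ≡ + 2 * p′ + + 1) (∤3 : ¬ + p ∣ + 3)
    (ρ : ConjugateReflections (+ p)) (n L : ℕ) (n<L : n ℕ.< L)
    (divides-p : + p ∣ + 24 * + n + + 5) (∤p² : ¬ + p * + p ∣ + 16 * (+ 24 * + n + + 5)) where

    open ConjugateReflections ρ
    open Reflection ρ₊ using () renaming (ℓ to ℓ₊)
    open Reflection ρ₋ using () renaming (ℓ to ℓ₋)

    instance
      p≢0 : ℤ.NonZero (+ p)
      p≢0 = prime⇒nonZero prime

    cover : ∀ m k → form m k ≡ + 2 * + n → + p ∣ ℓ₊ m k ⊎ + p ∣ ℓ₋ m k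
    cover m k on = divides-factor prime ∤3 (ℓ₊ m k) (ℓ₋ m k) (A m k) e (discriminant m k) (product m k)
      (subst (+ p ∣_) (sym (discriminant-on {m} {k} {+ n} on)) divides-p)

    exclusive : ∀ m k → form m k ≡ + 2 * + n → + p ∣ ℓ₊ m k → + p ∣ ℓ₋ m k → ⊥
    exclusive m k on d₊ d₋ = ∤p² (subst (λ D → + p * + p ∣ + 16 * D) (discriminant-on {m} {k} {+ n} on)
      (square-divides α β (discriminant m k) (recombine m k) d₊ d₋))

    open Cancellation (+ p) p′ p-odd ρ₊ ρ₋ n L n<L cover exclusive

    weight-form : ∀ m k e → form m k ≡ + 2 * + e → weight (m , k) ≡ sgnℤ k * monomial e n
    weight-form m k e eq with n ℕ.≟ e
    ... | yes refl = trans (weight-on {m} {k} eq) (sym (trans (cong (sgnℤ k *_) (monomial-≡ n)) (ℤ.*-identityʳ (sgnℤ k))))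
    ... | no n≢e   = trans (weight-off {m} {k} (λ on → n≢e (double-injective {n} {e} (trans (sym on) eq))))
      (sym (trans (cong (sgnℤ k *_) (monomial-≢ e n n≢e)) (ℤ.*-zeroʳ (sgnℤ k))))

    summand : ℕ → ℕ → ℤ
    summand i j = sgn j * (monomial (exponent₁ i j) n - monomial (exponent₂ i j) n)

    weight-pair : ∀ m i j → (∀ k → form m k ≡ form (+ i) k) → weight (m , + j) + weight (m , -[1+ j ]) ≡ summand i j
    weight-pair m i j eq = trans
      (cong₂ _+_ (weight-form m (+ j) (exponent₁ i j) (trans (eq (+ j)) (form-exponent₁ i j)))
                 (weight-form m -[1+ j ] (exponent₂ i j) (trans (eq -[1+ j ]) (form-exponent₂ i j))))
      (solve 3 (λ s a b → s :* a :+ (:- s) :* b := s :* (a :- b)) refl (sgn j) (monomial (exponent₁ i j) n) (monomial (exponent₂ i j) n))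

    weight-row : ∀ m i → (∀ k → form m k ≡ form (+ i) k) → sumOver (ints L) (λ k → weight (m , k)) ≡ ∑ L (summand i)
    weight-row m i eq = trans (sumOver-ints L (λ k → weight (m , k))) (∑-cong L (λ j _ → weight-pair m i j eq))

    -- The lattice sum runs over m in ℤ and meets each triangular exponent twice, at i and at -1 -
    -- i; the resulting factor 2 is cancelled in ℤ.
    vanishing : ∑ L (λ i → ∑ L (summand i)) ≡ + 0
    vanishing = ℤ.*-cancelˡ-≡ (+ 2) (∑ L (λ i → ∑ L (summand i))) (+ 0) (begin
      + 2 * ∑ L (λ i → ∑ L (summand i))                    ≡⟨ *-distribˡ-∑ L (+ 2) (λ i → ∑ L (summand i)) ⟩
      ∑ L (λ i → + 2 * ∑ L (summand i))                    ≡⟨ ∑-cong L (λ i _ → twice i) ⟩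
      ∑ L (λ i → row (+ i) + row -[1+ i ])                 ≡⟨ sumOver-ints L row ⟨
      sumOver (ints L) row                                 ≡⟨ cancellation ⟩
      + 0                                                  ∎)
      where
      open ≡-Reasoning
      row : ℤ → ℤ
      row m = sumOver (ints L) (λ k → weight (m , k))
      twice : ∀ i → + 2 * ∑ L (summand i) ≡ row (+ i) + row -[1+ i ]
      twice i = trans (solve 1 (λ x → con (+ 2) :* x := x :+ x) refl (∑ L (summand i)))
        (sym (cong₂ _+_ (weight-row (+ i) i (λ _ → refl)) (weight-row -[1+ i ] i (λ k → sym (form-+ i k)))))

-- The reflections for 7 and 11

module Reflections where

  open import Data.Integer using (ℤ; +_; _+_; _*_; _-_; -_)
  open import Data.Integer.Solver using (module +-*-Solver)
  open import Data.Product using (_,_)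
  open import Relation.Binary.PropositionalEquality
  open Cancellations
  open +-*-Solver

  formP discriminantP : ∀ {n} → Polynomial n → Polynomial n → Polynomial n
  formP m k = m :* (m :+ con (+ 1)) :+ con (+ 2) :* (k :* (con (+ 3) :* k :- con (+ 1)))
  discriminantP m k = con (+ 12) :* formP m k :+ con (+ 5)

  -- The shift by t moves (x, y) by t(2u, 6). This vector has norm 3(2u)² + 2 · 6² = 12(u² + 6) =
  -- 12κp, and u = ±1 gives u² + 6 = 7. The linear forms are ℓ₊ = x - 2y and ℓ₋ = -x - 2y, so 3ℓ₊ℓ₋
  -- = 14y² - (3x² + 2y²). From ℓ₊ - ℓ₋ = 2x and ℓ₊ + ℓ₋ = -4y come α = 12 and β = 2.
  ρ₇ : ConjugateReflections (+ 7)
  ρ₇ = record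
    { ρ₊ = record
      { ℓ = λ m k → + 2 * m - + 12 * k + + 3 ; u = - + 1 ; κ = + 1
      ; ℓ-odd = λ m k → m - + 6 * k + + 1 , solve 2 (λ m k → con (+ 2) :* m :- con (+ 12) :* k :+ con (+ 3) := con (+ 2) :* (m :- con (+ 6) :* k :+ con (+ 1)) :+ con (+ 1)) refl m k
      ; ℓ-shift = λ m k t → solve 3 (λ m k t → con (+ 2) :* (m :+ con (- + 1) :* t) :- con (+ 12) :* (k :+ t) :+ con (+ 3)
          := con (+ 2) :* m :- con (+ 12) :* k :+ con (+ 3) :- con (+ 2) :* (t :* con (+ 7))) refl m k t
      ; form-shift = λ m k t → solve 3 (λ m k t → formP (m :+ con (- + 1) :* t) (k :+ t)
          := formP m k :+ con (+ 1) :* (t :* (t :* con (+ 7) :- (con (+ 2) :* m :- con (+ 12) :* k :+ con (+ 3))))) refl m k t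
      }
    ; ρ₋ = record
      { ℓ = λ m k → - + 2 * m - + 12 * k + + 1 ; u = + 1 ; κ = + 1
      ; ℓ-odd = λ m k → - m - + 6 * k , solve 2 (λ m k → con (- + 2) :* m :- con (+ 12) :* k :+ con (+ 1) := con (+ 2) :* (:- m :- con (+ 6) :* k) :+ con (+ 1)) refl m k
      ; ℓ-shift = λ m k t → solve 3 (λ m k t → con (- + 2) :* (m :+ con (+ 1) :* t) :- con (+ 12) :* (k :+ t) :+ con (+ 1)
          := con (- + 2) :* m :- con (+ 12) :* k :+ con (+ 1) :- con (+ 2) :* (t :* con (+ 7))) refl m k t
      ; form-shift = λ m k t → solve 3 (λ m k t → formP (m :+ con (+ 1) :* t) (k :+ t)
          := formP m k :+ con (+ 1) :* (t :* (t :* con (+ 7) :- (con (- + 2) :* m :- con (+ 12) :* k :+ con (+ 1))))) refl m k t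
      }
    ; A = λ m k → + 2 * ((+ 6 * k - + 1) * (+ 6 * k - + 1)) ; e = + 1 ; α = + 12 ; β = + 2
    ; product = λ m k → solve 2 (λ m k → con (+ 3) :* ((con (+ 2) :* m :- con (+ 12) :* k :+ con (+ 3)) :* (con (- + 2) :* m :- con (+ 12) :* k :+ con (+ 1)))
        := con (+ 2) :* ((con (+ 6) :* k :- con (+ 1)) :* (con (+ 6) :* k :- con (+ 1))) :* con (+ 7) :- con (+ 1) :* discriminantP m k) refl m k
    ; recombine = λ m k → solve 2 (λ m k → let a = con (+ 2) :* m :- con (+ 12) :* k :+ con (+ 3); b = con (- + 2) :* m :- con (+ 12) :* k :+ con (+ 1) in
        con (+ 16) :* discriminantP m k := con (+ 12) :* ((a :- b) :* (a :- b)) :+ con (+ 2) :* ((a :+ b) :* (a :+ b))) refl m k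
    }

  -- Now u = ±4 and u² + 6 = 2 · 11, hence κ = 2. The linear forms are ℓ₊ = 2x - y and ℓ₋ = -2x - y,
  -- with 3ℓ₊ℓ₋ = 11y² - 4(3x² + 2y²); their difference 4x and sum -2y give α = 3 and β = 8.
  ρ₁₁ : ConjugateReflections (+ 11)
  ρ₁₁ = record
    { ρ₊ = record
      { ℓ = λ m k → + 4 * m - + 6 * k + + 3 ; u = - + 4 ; κ = + 2
      ; ℓ-odd = λ m k → + 2 * m - + 3 * k + + 1 , solve 2 (λ m k → con (+ 4) :* m :- con (+ 6) :* k :+ con (+ 3) := con (+ 2) :* (con (+ 2) :* m :- con (+ 3) :* k :+ con (+ 1)) :+ con (+ 1)) refl m k
      ; ℓ-shift = λ m k t → solve 3 (λ m k t → con (+ 4) :* (m :+ con (- + 4) :* t) :- con (+ 6) :* (k :+ t) :+ con (+ 3)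
          := con (+ 4) :* m :- con (+ 6) :* k :+ con (+ 3) :- con (+ 2) :* (t :* con (+ 11))) refl m k t
      ; form-shift = λ m k t → solve 3 (λ m k t → formP (m :+ con (- + 4) :* t) (k :+ t)
          := formP m k :+ con (+ 2) :* (t :* (t :* con (+ 11) :- (con (+ 4) :* m :- con (+ 6) :* k :+ con (+ 3))))) refl m k t
      }
    ; ρ₋ = record
      { ℓ = λ m k → - + 4 * m - + 6 * k - + 1 ; u = + 4 ; κ = + 2
      ; ℓ-odd = λ m k → - + 2 * m - + 3 * k - + 1 , solve 2 (λ m k → con (- + 4) :* m :- con (+ 6) :* k :- con (+ 1) := con (+ 2) :* (con (- + 2) :* m :- con (+ 3) :* k :- con (+ 1)) :+ con (+ 1)) refl m k
      ; ℓ-shift = λ m k t → solve 3 (λ m k t → con (- + 4) :* (m :+ con (+ 4) :* t) :- con (+ 6) :* (k :+ t) :- con (+ 1)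
          := con (- + 4) :* m :- con (+ 6) :* k :- con (+ 1) :- con (+ 2) :* (t :* con (+ 11))) refl m k t
      ; form-shift = λ m k t → solve 3 (λ m k t → formP (m :+ con (+ 4) :* t) (k :+ t)
          := formP m k :+ con (+ 2) :* (t :* (t :* con (+ 11) :- (con (- + 4) :* m :- con (+ 6) :* k :- con (+ 1))))) refl m k t
      }
    ; A = λ m k → (+ 6 * k - + 1) * (+ 6 * k - + 1) ; e = + 4 ; α = + 3 ; β = + 8
    ; product = λ m k → solve 2 (λ m k → con (+ 3) :* ((con (+ 4) :* m :- con (+ 6) :* k :+ con (+ 3)) :* (con (- + 4) :* m :- con (+ 6) :* k :- con (+ 1)))
        := (con (+ 6) :* k :- con (+ 1)) :* (con (+ 6) :* k :- con (+ 1)) :* con (+ 11) :- con (+ 4) :* discriminantP m k) refl m k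
    ; recombine = λ m k → solve 2 (λ m k → let a = con (+ 4) :* m :- con (+ 6) :* k :+ con (+ 3); b = con (- + 4) :* m :- con (+ 6) :* k :- con (+ 1) in
        con (+ 16) :* discriminantP m k := con (+ 3) :* ((a :- b) :* (a :- b)) :+ con (+ 8) :* ((a :+ b) :* (a :+ b))) refl m k
    }

-- Coefficients of E₂³/E₁ as signed lattice sums

module ThetaCoefficients (p N : ℕ) where

  open import Data.Nat as ℕ using (ℕ; zero; suc; _≤_; _<_)
  open import Data.Integer as ℤ using (ℤ; +_; -[1+_])
  import Data.Integer.Properties as ℤ
  import Data.Nat.Properties as ℕ
  open import Relation.Binary.PropositionalEquality as ≡ using (_≡_)
  open PowerSeries
  open ThetaExponents using (tri; pent; sgn)
  open Cancellations using (exponent₁; exponent₂)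
  open SeriesModulo p N
  module ℤ∑ = TripleProduct ℤ.+-*-commutativeRing
  open import Relation.Binary.Reasoning.Setoid setoid

  ∑-coefficient : ∀ m f n → ∑ m f n ≡ ℤ∑.∑ m (λ i → f i n)
  ∑-coefficient zero    f n = ≡.refl
  ∑-coefficient (suc m) f n = ≡.cong (ℤ._+ f m n) (∑-coefficient m f n)

  fromℕ-constant : ∀ n → fromℤ (+ n) ≈ constant (+ n)
  fromℕ-constant zero    = pointwise λ { zero → ≡.refl ; (suc n) → ≡.refl }
  fromℕ-constant (suc n) = begin
    fromℤ (+ suc n)                  ≈⟨ fromℤ-+ (+ 1) (+ n) ⟩
    1# + fromℤ (+ n)                 ≈⟨ +-congˡ {1#} {fromℤ (+ n)} {constant (+ n)} (fromℕ-constant n) ⟩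
    1# + constant (+ n)              ≈⟨ pointwise (λ { zero → ≡.refl ; (suc i) → ≡.refl }) ⟩
    constant (+ suc n)               ∎

  fromℤ-constant : ∀ k → fromℤ k ≈ constant k
  fromℤ-constant (+ n)    = fromℕ-constant n
  fromℤ-constant -[1+ n ] = trans (-‿cong {x = fromℤ (+ suc n)} {constant (+ suc n)} (fromℕ-constant (suc n)))
    (pointwise λ { zero → ≡.refl ; (suc i) → ≡.refl })

  scaled-coefficient : ∀ k f {n} → n ≤ N → (fromℤ k * f) n ≋ k ℤ.* f n
  scaled-coefficient k f {n} n≤N = ≋-trans (*-cong {fromℤ k} {constant k} {f} {f} (fromℤ-constant k) refl n n≤N) (≋-reflexive (constant-⊛ k f n))

  ∑-≋ : ∀ m {f g : ℕ → ℤ} → (∀ i → i < m → f i ≋ g i) → ℤ∑.∑ m f ≋ ℤ∑.∑ m g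
  ∑-≋ zero    eq = ≋-reflexive ≡.refl
  ∑-≋ (suc m) eq = ≋-+ (∑-≋ m (λ i i<m → eq i (ℕ.m<n⇒m<1+n i<m))) (eq m ℕ.≤-refl)

  eulerTerm : ℕ → Carrier
  eulerTerm j = fromℤ (sgn j) * ((X ^ 2) ^ pent j - (X ^ 2) ^ (pent j ℕ.+ (4 ℕ.* j ℕ.+ 2)))

  theta-term : ∀ i j → X ^ tri i * eulerTerm j ≈ fromℤ (sgn j) * (X ^ exponent₁ i j - X ^ exponent₂ i j)
  theta-term i j = begin
    x * (s * (y - z))               ≈⟨ solve 4 (λ x s y z → x :* (s :* (y :- z)) := s :* (x :* y :- x :* z)) refl x s y z ⟩
    s * (x * y - x * z)             ≈⟨ *-congˡ {s} (+-cong {x * y} {X ^ exponent₁ i j} (combine (pent j)) (-‿cong {x * z} {X ^ exponent₂ i j} (combine (pent j ℕ.+ (4 ℕ.* j ℕ.+ 2))))) ⟩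
    s * (X ^ exponent₁ i j - X ^ exponent₂ i j)   ∎
    where
    x s y z : Carrier
    x = X ^ tri i
    s = fromℤ (sgn j)
    y = (X ^ 2) ^ pent j
    z = (X ^ 2) ^ (pent j ℕ.+ (4 ℕ.* j ℕ.+ 2))
    combine : ∀ e → X ^ tri i * (X ^ 2) ^ e ≈ X ^ (tri i ℕ.+ 2 ℕ.* e)
    combine e = trans (*-congˡ {X ^ tri i} (^-assocʳ X 2 e)) (sym (^-homo-* X (tri i) (2 ℕ.* e)))

  -- The bridge from `theta` to the lattice: the right side is word for word the integer sum that
  -- `ThetaVanishing.vanishing` shows to be 0.
  theta-coefficient : ∀ L {n} → n ≤ N →
    (∑ L (λ i → X ^ tri i) * ∑ L eulerTerm) n ≋
    ℤ∑.∑ L (λ i → ℤ∑.∑ L (λ j → sgn j ℤ.* (monomial (exponent₁ i j) n ℤ.- monomial (exponent₂ i j) n)))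
  theta-coefficient L {n} n≤N = ≋-trans (expand n n≤N) (≋-trans
    (≋-reflexive (∑-coefficient L (λ i → ∑ L (λ j → term i j)) n))
    (∑-≋ L λ i _ → ≋-trans (≋-reflexive (∑-coefficient L (term i) n)) (∑-≋ L λ j _ → ≋-trans
      (scaled-coefficient (sgn j) (X ^ exponent₁ i j - X ^ exponent₂ i j) n≤N)
      (≋-reflexive (≡.cong (sgn j ℤ.*_) (≡.cong₂ ℤ._-_ (X^-monomial (exponent₁ i j) n) (X^-monomial (exponent₂ i j) n)))))))
    where
    term : ℕ → ℕ → Carrier
    term i j = fromℤ (sgn j) * (X ^ exponent₁ i j - X ^ exponent₂ i j)
    expand : ∑ L (λ i → X ^ tri i) * ∑ L eulerTerm ≈ ∑ L (λ i → ∑ L (term i))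
    expand = begin
      ∑ L (λ i → X ^ tri i) * ∑ L eulerTerm            ≈⟨ *-comm (∑ L (λ i → X ^ tri i)) (∑ L eulerTerm) ⟩
      ∑ L eulerTerm * ∑ L (λ i → X ^ tri i)            ≈⟨ *-distribˡ-∑ L (∑ L eulerTerm) (λ i → X ^ tri i) ⟩
      ∑ L (λ i → ∑ L eulerTerm * X ^ tri i)            ≈⟨ ∑-cong L (λ i _ → trans (*-comm (∑ L eulerTerm) (X ^ tri i))
                                                            (trans (*-distribˡ-∑ L (X ^ tri i) eulerTerm) (∑-cong L (λ j _ → theta-term i j)))) ⟩
      ∑ L (λ i → ∑ L (term i))                         ∎

-- Sparse polynomials for computation modulo p

module Polynomials where

  open import Data.Bool using (Bool; true; false; _∧_; if_then_else_)
  open import Data.List using (List; []; _∷_; map)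
  open import Data.Nat as ℕ using (ℕ; zero; suc)
  open import Data.Nat.DivMod using (_%_)
  open import Data.Product using (_×_; _,_)
  open import Data.Vec as Vec using (Vec; []; _∷_)
  import Data.Vec.Properties as Vec
  open import Relation.Nullary using (yes; no; does)

  Exponents : ℕ → Set
  Exponents k = Vec ℕ k

  -- Coefficients can be natural numbers because results are only read modulo p, where negative
  -- numbers have positive representatives.
  Poly : ℕ → Set
  Poly k = List (ℕ × Exponents k)

  infix 4 _≺_
  _≺_ : ∀ {k} → Exponents k → Exponents k → Bool
  []       ≺ []       = false
  (d ∷ ds) ≺ (e ∷ es) = if d ℕ.≡ᵇ e then ds ≺ es else d ℕ.<ᵇ e

  -- Like terms meet only if both lists are sorted, which affects the normal form but not the value.
  merge : ∀ {k} → Poly k → Poly k → Poly k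
  merge []            Q             = Q
  merge (t ∷ P)       []            = t ∷ P
  merge ((a , e) ∷ P) ((b , f) ∷ Q) =
    if does (Vec.≡-dec ℕ._≟_ e f) then (a ℕ.+ b , e) ∷ merge P Q
    else if e ≺ f then (a , e) ∷ merge P ((b , f) ∷ Q)
    else (b , f) ∷ merge ((a , e) ∷ P) Q

  multiply : ∀ {k} → ℕ → Exponents k → Poly k → Poly k
  multiply c e = map (λ (a , f) → c ℕ.* a , Vec.zipWith ℕ._+_ e f)

  sumOfMultiples : ∀ {k} → List (Exponents k) → Poly k → Poly k
  sumOfMultiples []       P = []
  sumOfMultiples (e ∷ es) P = merge (multiply 1 e P) (sumOfMultiples es P)

  powerOfSum : ∀ {k} → List (Exponents k) → ℕ → Poly k
  powerOfSum es zero    = (1 , Vec.replicate _ 0) ∷ []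
  powerOfSum es (suc n) = sumOfMultiples es (powerOfSum es n)

  -- Certificate for ideal membership: a triple (c , e , P) stands for the multiple c x^e P, and T
  -- is in the ideal modulo p as soon as T plus these multiples vanishes modulo p.
  combination : ∀ {k} → Poly k → List (ℕ × Exponents k × Poly k) → Poly k
  combination T []                 = T
  combination T ((c , e , P) ∷ cs) = merge (multiply c e P) (combination T cs)

  vanishesMod : ∀ {k} p .{{_ : ℕ.NonZero p}} → Poly k → Bool
  vanishesMod p []            = true
  vanishesMod p ((a , _) ∷ P) = (a % p ℕ.≡ᵇ 0) ∧ vanishesMod p P

  degree : ∀ {k} → Vec ℕ k → Exponents k → ℕ
  degree []       []       = 0
  degree (d ∷ ds) (e ∷ es) = e ℕ.* d ℕ.+ degree ds es

  -- The syntactic counterpart of selecting one residue class of exponents, when variable number i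
  -- is a series whose exponents all lie in the class of entry i of d.
  component : ∀ {k} M .{{_ : ℕ.NonZero M}} → Vec ℕ k → ℕ → Poly k → Poly k
  component M d r []            = []
  component M d r ((a , e) ∷ P) with degree d e % M ℕ.≟ r % M
  ... | yes _ = (a , e) ∷ component M d r P
  ... | no  _ = component M d r P

-- Soundness of the polynomial computations

module PolynomialEvaluation {c ℓ} (R : CommutativeRing c ℓ) where

  open import Data.Bool using (Bool; true; false; if_then_else_)
  open import Data.Integer as ℤ using (+_)
  open import Data.List using (List; []; _∷_)
  open import Data.List.Relation.Unary.All using (All; []; _∷_)
  open import Data.Nat as ℕ using (ℕ; zero; suc)
  open import Data.Nat.DivMod using (_%_; _/_; m≡m%n+[m/n]*n)
  open import Data.Product using (_,_)
  open import Data.Vec as Vec using (Vec; []; _∷_)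
  import Data.Integer.Properties as ℤ
  import Data.Vec.Properties as Vec
  open import Relation.Binary.PropositionalEquality as ≡ using (_≡_)
  open import Relation.Nullary using (Dec; yes; no; does)

  open Polynomials
  open CommutativeRing R
  open import Relation.Binary.Reasoning.Setoid setoid
  open TripleProduct R

  power : ∀ {k} → Vec Carrier k → Exponents k → Carrier
  power []       []       = 1#
  power (x ∷ xs) (e ∷ es) = x ^ e * power xs es

  power-+ : ∀ {k} (ρ : Vec Carrier k) e f → power ρ (Vec.zipWith ℕ._+_ e f) ≈ power ρ e * power ρ f
  power-+ []      []       []       = sym (*-identityˡ 1#)
  power-+ (x ∷ ρ) (d ∷ ds) (e ∷ es) = trans (*-cong (^-homo-* x d e) (power-+ ρ ds es))
    (solve 4 (λ a b c d → (a :* b) :* (c :* d) := (a :* c) :* (b :* d)) refl _ _ _ _)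

  power-0 : ∀ {k} (ρ : Vec Carrier k) → power ρ (Vec.replicate k 0) ≈ 1#
  power-0 []      = refl
  power-0 (x ∷ ρ) = trans (*-identityˡ _) (power-0 ρ)

  module Evaluation {k : ℕ} (ρ : Vec Carrier k) where

    eval : Poly k → Carrier
    eval []            = 0#
    eval ((a , e) ∷ P) = fromℤ (+ a) * power ρ e + eval P

    eval-merge : ∀ P Q → eval (merge P Q) ≈ eval P + eval Q
    eval-merge []            Q             = sym (+-identityˡ _)
    eval-merge (t ∷ P)       []            = sym (+-identityʳ _)
    eval-merge ((a , e) ∷ P) ((b , f) ∷ Q) =
      step (Vec.≡-dec ℕ._≟_ e f) (e ≺ f) (eval-merge P Q) (eval-merge P ((b , f) ∷ Q)) (eval-merge ((a , e) ∷ P) Q)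
      where
      step : ∀ {M₁ M₂ M₃} (e≟f : Dec (e ≡ f)) e≺f →
        eval M₁ ≈ eval P + eval Q → eval M₂ ≈ eval P + eval ((b , f) ∷ Q) → eval M₃ ≈ eval ((a , e) ∷ P) + eval Q →
        eval (if does e≟f then (a ℕ.+ b , e) ∷ M₁ else if e≺f then (a , e) ∷ M₂ else (b , f) ∷ M₃)
          ≈ eval ((a , e) ∷ P) + eval ((b , f) ∷ Q)
      step (yes ≡.refl) _ eq₁ _ _ = trans (+-cong (*-congʳ (fromℤ-+ (+ a) (+ b))) eq₁)
        (solve 5 (λ a b x p q → (a :+ b) :* x :+ (p :+ q) := (a :* x :+ p) :+ (b :* x :+ q)) refl _ _ _ _ _)
      step (no _) true  _ eq₂ _ = trans (+-congˡ eq₂) (sym (+-assoc _ _ _))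
      step (no _) false _ _ eq₃ = trans (+-congˡ eq₃) (solve 3 (λ a b c → a :+ (b :+ c) := b :+ (a :+ c)) refl _ _ _)

    eval-multiply : ∀ c e P → eval (multiply c e P) ≈ fromℤ (+ c) * power ρ e * eval P
    eval-multiply c e []            = sym (zeroʳ _)
    eval-multiply c e ((a , f) ∷ P) = begin
      fromℤ (+ (c ℕ.* a)) * power ρ (Vec.zipWith ℕ._+_ e f) + eval (multiply c e P)
        ≈⟨ +-cong (*-cong (trans (reflexive (≡.cong fromℤ (ℤ.pos-* c a))) (fromℤ-* (+ c) (+ a))) (power-+ ρ e f)) (eval-multiply c e P) ⟩
      (fromℤ (+ c) * fromℤ (+ a)) * (power ρ e * power ρ f) + fromℤ (+ c) * power ρ e * eval P
        ≈⟨ solve 5 (λ c a x y p → (c :* a) :* (x :* y) :+ c :* x :* p := c :* x :* (a :* y :+ p)) refl _ _ _ _ _ ⟩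
      fromℤ (+ c) * power ρ e * (fromℤ (+ a) * power ρ f + eval P) ∎

    powers : List (Exponents k) → Carrier
    powers []       = 0#
    powers (e ∷ es) = power ρ e + powers es

    eval-sumOfMultiples : ∀ es P → eval (sumOfMultiples es P) ≈ powers es * eval P
    eval-sumOfMultiples []       P = sym (zeroˡ _)
    eval-sumOfMultiples (e ∷ es) P = begin
      eval (merge (multiply 1 e P) (sumOfMultiples es P))   ≈⟨ eval-merge (multiply 1 e P) _ ⟩
      eval (multiply 1 e P) + eval (sumOfMultiples es P)    ≈⟨ +-cong (eval-multiply 1 e P) (eval-sumOfMultiples es P) ⟩
      1# * power ρ e * eval P + powers es * eval P          ≈⟨ solve 3 (λ x s p → con (+ 1) :* x :* p :+ s :* p := (x :+ s) :* p) refl _ _ _ ⟩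
      (power ρ e + powers es) * eval P                      ∎

    eval-powerOfSum : ∀ es n → eval (powerOfSum es n) ≈ powers es ^ n
    eval-powerOfSum es zero    = trans (+-congʳ (*-congˡ (power-0 ρ))) (solve 0 (con (+ 1) :* con (+ 1) :+ con (+ 0) := con (+ 1)) refl)
    eval-powerOfSum es (suc n) = trans (eval-sumOfMultiples es (powerOfSum es n)) (*-congˡ (eval-powerOfSum es n))

    eval-combination : ∀ T cs → All (λ (_ , _ , P) → eval P ≈ 0#) cs → eval (combination T cs) ≈ eval T
    eval-combination T []                 []       = refl
    eval-combination T ((c , e , P) ∷ cs) (z ∷ zs) = begin
      eval (merge (multiply c e P) (combination T cs))           ≈⟨ eval-merge (multiply c e P) _ ⟩
      eval (multiply c e P) + eval (combination T cs)            ≈⟨ +-cong (trans (eval-multiply c e P) (trans (*-congˡ z) (zeroʳ _))) (eval-combination T cs zs) ⟩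
      0# + eval T                                                ≈⟨ +-identityˡ _ ⟩
      eval T                                                     ∎

    eval-vanishes : ∀ p .{{_ : ℕ.NonZero p}} → fromℤ (+ p) ≈ 0# → ∀ P → vanishesMod p P ≡ true → eval P ≈ 0#
    eval-vanishes p p≈0 []            _  = refl
    eval-vanishes p p≈0 ((a , e) ∷ P) eq with a % p in a%p
    ... | zero = begin
      fromℤ (+ a) * power ρ e + eval P                     ≡⟨ ≡.cong (λ x → fromℤ (+ x) * power ρ e + eval P) (≡.trans (m≡m%n+[m/n]*n a p) (≡.cong (ℕ._+ a / p ℕ.* p) a%p)) ⟩
      fromℤ (+ (a / p ℕ.* p)) * power ρ e + eval P         ≈⟨ +-cong (*-congʳ (trans (reflexive (≡.cong fromℤ (ℤ.pos-* (a / p) p))) (fromℤ-* (+ (a / p)) (+ p)))) (eval-vanishes p p≈0 P eq) ⟩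
      fromℤ (+ (a / p)) * fromℤ (+ p) * power ρ e + 0#     ≈⟨ +-congʳ (*-congʳ (*-congˡ p≈0)) ⟩
      fromℤ (+ (a / p)) * 0# * power ρ e + 0#              ≈⟨ solve 2 (λ a x → a :* con (+ 0) :* x :+ con (+ 0) := con (+ 0)) refl _ _ ⟩
      0#                                                   ∎

    eval-certified : ∀ p .{{_ : ℕ.NonZero p}} → fromℤ (+ p) ≈ 0# → ∀ T cs → All (λ (_ , _ , P) → eval P ≈ 0#) cs →
      vanishesMod p (combination T cs) ≡ true → eval T ≈ 0#
    eval-certified p p≈0 T cs zs eq = trans (sym (eval-combination T cs zs)) (eval-vanishes p p≈0 (combination T cs) eq)

-- Series supported on residue classes of exponents

module Support (p N M : ℕ) .{{_ : ℕ.NonZero M}} where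

  open import Data.Nat as ℕ using (zero; suc; _≤_; _<_)
  open import Data.Integer as ℤ using (ℤ; +_)
  import Data.Integer.Properties as ℤ
  open import Data.Integer.Divisibility.Signed using (_∣_; ∣m⇒∣m*n; ∣n⇒∣m*n)
  open import Data.Empty using (⊥-elim)
  open import Data.List using (List; []; _∷_)
  open import Data.List.Membership.Propositional using (_∈_)
  open import Data.List.Relation.Unary.All as All using (All; []; _∷_)
  open import Data.List.Relation.Unary.All.Properties using (¬Any⇒All¬)
  open import Data.List.Relation.Unary.Unique.Propositional using (Unique)
  open import Data.List.Membership.DecPropositional ℕ._≟_ using (_∈?_)
  open import Data.Nat.DivMod using (_%_; %-distribˡ-+; m<n⇒m%n≡m)
  import Data.Nat.Properties as ℕ
  open import Data.Product using (_×_; _,_)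
  open import Data.Vec using (Vec; []; _∷_)
  open import Data.Unit using (⊤)
  open import Relation.Binary.PropositionalEquality as ≡ using (_≡_; _≢_)
  open import Relation.Nullary using (yes; no; ¬_)
  open PowerSeries
  open Cancellations using (sumOver; indicator; indicator-≢; sumOver-∉; sumOver-indicator)
  open SeriesModulo p N
  open ThetaCoefficients p N using (fromℕ-constant)
  open import Relation.Binary.Reasoning.Setoid setoid

  -- Three choices of S occur: `_∈ rs` lists the admissible classes, `_≡ r` makes the series
  -- homogeneous, and `_≢ r` says that class r is missing, as in Ramanujan's congruences.
  record Supported (S : ℕ → Set) (f : Carrier) : Set where
    constructor supported
    field off : ∀ {n} → n ≤ N → ¬ S (n % M) → f n ≋ + 0
  open Supported public

  Homogeneous : ℕ → Carrier → Set
  Homogeneous r = Supported (_≡ r % M)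

  supported-≈ : ∀ {S f g} → f ≈ g → Supported S g → Supported S f
  supported-≈ f≈g h = supported λ n≤N n∉S → ≋-trans (f≈g _ n≤N) (off h n≤N n∉S)

  homogeneous-* : ∀ r s {f g} → Homogeneous r f → Homogeneous s g → Homogeneous (r ℕ.+ s) (f * g)
  homogeneous-* r s {f} {g} hf hg = supported λ {n} n≤N n≢ → ∣⇒≋0 (∣-⊛ f g n (term n≤N n≢))
    where
    term : ∀ {n} → n ≤ N → n % M ≢ (r ℕ.+ s) % M → ∀ i j → i ℕ.+ j ≡ n → + p ∣ f i ℤ.* g j
    term n≤N n≢ i j ≡.refl with i % M ℕ.≟ r % M
    ... | no i≢ = ∣m⇒∣m*n (g j) (≋0⇒∣ (off hf (ℕ.≤-trans (ℕ.m≤m+n i j) n≤N) i≢))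
    ... | yes i≡ = ∣n⇒∣m*n (f i) (≋0⇒∣ (off hg (ℕ.≤-trans (ℕ.m≤n+m j i) n≤N)
      (λ j≡ → n≢ (≡.trans (%-distribˡ-+ i j M) (≡.trans (≡.cong₂ (λ a b → (a ℕ.+ b) % M) i≡ j≡) (≡.sym (%-distribˡ-+ r s M)))))))

  -- If n = i + j with j divisible by M, then n and i are in the same class. Thus a series in q^M,
  -- such as a product over exponents divisible by M or its inverse, can be multiplied in freely.
  supported-* : ∀ {S f g} → Supported S f → Homogeneous 0 g → Supported S (f * g)
  supported-* {S} {f} {g} hf hg = supported λ {n} n≤N n∉S → ∣⇒≋0 (∣-⊛ f g n (term n≤N n∉S))
    where
    term : ∀ {n} → n ≤ N → ¬ S (n % M) → ∀ i j → i ℕ.+ j ≡ n → + p ∣ f i ℤ.* g j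
    term n≤N n∉S i j ≡.refl with j % M ℕ.≟ 0 % M
    ... | no j≢ = ∣n⇒∣m*n (f i) (≋0⇒∣ (off hg (ℕ.≤-trans (ℕ.m≤n+m j i) n≤N) j≢))
    ... | yes j≡ = ∣m⇒∣m*n (g j) (≋0⇒∣ (off hf (ℕ.≤-trans (ℕ.m≤m+n i j) n≤N) (λ i∈S → n∉S (≡.subst S i≡n i∈S))))
      where
      i≡n : i % M ≡ (i ℕ.+ j) % M
      i≡n = ≡.sym (≡.trans (%-distribˡ-+ i j M) (≡.trans (≡.cong (λ b → (i % M ℕ.+ b) % M) j≡)
        (≡.trans (≡.sym (%-distribˡ-+ i 0 M)) (≡.cong (_% M) (ℕ.+-identityʳ i)))))

  supported-+ : ∀ {S f g} → Supported S f → Supported S g → Supported S (f + g)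
  supported-+ hf hg = supported λ n≤N n∉S → ≋-+ (off hf n≤N n∉S) (off hg n≤N n∉S)

  supported-neg : ∀ {S f} → Supported S f → Supported S (- f)
  supported-neg hf = supported λ n≤N n∉S → ≋-neg (off hf n≤N n∉S)

  supported-0 : ∀ {S} → Supported S 0#
  supported-0 = supported λ _ _ → ≋-reflexive ≡.refl

  homogeneous-constant : ∀ k → Homogeneous 0 (constant k)
  homogeneous-constant k = supported λ { {zero} _ n≢ → ⊥-elim (n≢ ≡.refl) ; {suc n} _ _ → ≋-reflexive ≡.refl }

  homogeneous-^ : ∀ r {x} e → Homogeneous r x → Homogeneous (e ℕ.* r) (x ^ e)
  homogeneous-^ r zero    h = homogeneous-constant (+ 1)
  homogeneous-^ r (suc e) h = homogeneous-* r (e ℕ.* r) h (homogeneous-^ r e h)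

  homogeneous-0-^ : ∀ {f} k → Homogeneous 0 f → Homogeneous 0 (f ^ k)
  homogeneous-0-^ zero    hf = homogeneous-constant (+ 1)
  homogeneous-0-^ (suc k) hf = homogeneous-* 0 0 hf (homogeneous-0-^ k hf)

  supported-∑ : ∀ {S} n {f} → (∀ i → Supported S (f i)) → Supported S (∑ n f)
  supported-∑ zero    h = supported-0
  supported-∑ (suc n) h = supported-+ (supported-∑ n h) (h n)

  homogeneous-0-∏ : ∀ n {f} → (∀ i → Homogeneous 0 (f i)) → Homogeneous 0 (∏ n f)
  homogeneous-0-∏ zero    h = homogeneous-constant (+ 1)
  homogeneous-0-∏ (suc n) h = homogeneous-* 0 0 (homogeneous-0-∏ n h) (h n)

  module _ {q : Carrier} (hq : Homogeneous 0 q) {K : ℕ} (nilpotent : q ^ K ≈ 0#) where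

    open Nilpotent q K nilpotent

    homogeneous-poch : ∀ n → Homogeneous 0 (poch n)
    homogeneous-poch n = homogeneous-0-∏ n (λ i → supported-+ (homogeneous-constant (+ 1)) (supported-neg (homogeneous-0-^ (suc i) hq)))

    homogeneous-poch⁻¹ : ∀ n → Homogeneous 0 (poch⁻¹ n)
    homogeneous-poch⁻¹ n = homogeneous-0-∏ n (λ i → supported-∑ K (λ j → homogeneous-0-^ j (homogeneous-0-^ (suc i) hq)))

  homogeneous-X^ : ∀ e → Homogeneous e (X ^ e)
  homogeneous-X^ e = supported λ {n} _ n≢ → ≋-reflexive (≡.trans (X^-monomial e n) (monomial-≢ e n (λ { ≡.refl → n≢ ≡.refl })))

  module Graded {k : ℕ} (d : Vec ℕ k) where

    open Polynomials
    open PolynomialEvaluation ring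

    HomogeneousVec : ∀ {k} → Vec ℕ k → Vec Carrier k → Set
    HomogeneousVec []       []       = ⊤
    HomogeneousVec (d ∷ ds) (x ∷ xs) = Homogeneous d x × HomogeneousVec ds xs

    homogeneous-power : ∀ {k} (d : Vec ℕ k) ρ e → HomogeneousVec d ρ → Homogeneous (degree d e) (power ρ e)
    homogeneous-power []       []       []       _        = homogeneous-constant (+ 1)
    homogeneous-power (d ∷ ds) (x ∷ xs) (e ∷ es) (h , hs) =
      homogeneous-* (e ℕ.* d) (degree ds es) (homogeneous-^ d e h) (homogeneous-power ds xs es hs)

    module _ (ρ : Vec Carrier k) (hρ : HomogeneousVec d ρ) where

      open Evaluation ρ

      homogeneous-term : ∀ a e → Homogeneous (degree d e) (fromℤ (+ a) * power ρ e)
      homogeneous-term a e = supported-≈ {f = fromℤ (+ a) * power ρ e} {power ρ e * constant (+ a)}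
        (trans (*-congʳ {power ρ e} {fromℤ (+ a)} {constant (+ a)} (fromℕ-constant a)) (*-comm (constant (+ a)) (power ρ e)))
        (supported-* (homogeneous-power d ρ e hρ) (homogeneous-constant (+ a)))

      -- Every term of P lives in the single class of its weighted degree, so class r sees only the
      -- terms that `component` keeps.
      component-coefficient : ∀ r P {n} → n ≤ N → n % M ≡ r % M → eval P n ≋ eval (component M d r P) n
      component-coefficient r []            n≤N n≡r = ≋-reflexive ≡.refl
      component-coefficient r ((a , e) ∷ P) {n} n≤N n≡r with degree d e % M ℕ.≟ r % M
      ... | yes _ = ≋-+ {(fromℤ (+ a) * power ρ e) n} (≋-reflexive ≡.refl) (component-coefficient r P n≤N n≡r)
      ... | no ≢r = ≋-trans (≋-+ (off (homogeneous-term a e) n≤N (λ n≡ → ≢r (≡.trans (≡.sym n≡) n≡r))) (component-coefficient r P n≤N n≡r))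
        (≋-reflexive (ℤ.+-identityˡ (eval (component M d r P) n)))

      component-homogeneous : ∀ r P → Homogeneous r (eval (component M d r P))
      component-homogeneous r [] = supported-0
      component-homogeneous r ((a , e) ∷ P) with degree d e % M ℕ.≟ r % M
      ... | yes ≡r = supported-+ (supported λ n≤N n≢ → off (homogeneous-term a e) n≤N (λ n≡ → n≢ (≡.trans n≡ ≡r))) (component-homogeneous r P)
      ... | no _ = component-homogeneous r P

      -- Turns missing coefficients into an equation of the ring, which can then be multiplied by
      -- other series: inside class r the component agrees with P, and outside it has no
      -- coefficients.
      component-vanishes : ∀ r P → Supported (_≢ r % M) (eval P) → eval (component M d r P) ≈ 0#
      component-vanishes r P h n n≤N with n % M ℕ.≟ r % M
      ... | yes n≡ = ≋-trans {eval (component M d r P) n} {eval P n} (≋-sym {eval P n} (component-coefficient r P n≤N n≡)) (off h n≤N (λ n≢ → n≢ n≡))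
      ... | no n≢  = off (component-homogeneous r P) n≤N n≢

  part : Carrier → ℕ → Carrier
  part f r n = indicator ℕ._≟_ r (n % M) ℤ.* f n

  part-homogeneous : ∀ f {r} → r < M → Homogeneous r (part f r)
  part-homogeneous f r<M = supported λ {n} _ n≢ → ≋-reflexive (≡.trans (≡.cong (ℤ._* f n)
    (indicator-≢ ℕ._≟_ (λ r≡ → n≢ (≡.trans (≡.sym r≡) (≡.sym (m<n⇒m%n≡m r<M)))))) (ℤ.*-zeroˡ (f n)))

  parts-sum : ∀ f rs → Unique rs → Supported (_∈ rs) f → ∀ {n} → n ≤ N → sumOver rs (λ r → part f r n) ≋ f n
  parts-sum f rs unique supp {n} n≤N with (n % M) ∈? rs
  ... | yes n∈ = ≋-reflexive (sumOver-indicator ℕ._≟_ (n % M) (f n) unique n∈)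
  ... | no n∉  = ≋-trans (≋-reflexive (sumOver-∉ ℕ._≟_ rs (n % M) (f n) (¬Any⇒All¬ rs n∉))) (≋-sym (off supp n≤N n∉))

-- The elimination certificate modulo 11

module Multipliers where

  open import Data.Bool using (true)
  open import Data.List using (List; []; _∷_)
  open import Data.List.Relation.Unary.All using (All; []; _∷_)
  open import Data.Nat using (ℕ)
  open import Data.Product using (_×_; _,_)
  open import Data.Vec using (Vec; []; _∷_)
  open import Relation.Binary.PropositionalEquality as ≡ using (_≡_)
  open Polynomials

  module Certificate₁₁ where

    units : List (Exponents 5)
    units = (1 ∷ 0 ∷ 0 ∷ 0 ∷ 0 ∷ []) ∷ (0 ∷ 1 ∷ 0 ∷ 0 ∷ 0 ∷ []) ∷ (0 ∷ 0 ∷ 1 ∷ 0 ∷ 0 ∷ [])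
      ∷ (0 ∷ 0 ∷ 0 ∷ 1 ∷ 0 ∷ []) ∷ (0 ∷ 0 ∷ 0 ∷ 0 ∷ 1 ∷ []) ∷ []

    -- 22 t modulo 121 for the surviving triangular classes t = 0, 1, 3, 6, 10 modulo 11: the
    -- exponents of Jacobi's series in q^22.
    degrees : Vec ℕ 5
    degrees = 0 ∷ 22 ∷ 66 ∷ 11 ∷ 99 ∷ []

    -- The component of J⁷ containing n = 11 lies modulo 11 in the ideal of the components R of J⁴ that
    -- Euler's theorem forces to vanish; the multipliers solve a linear system over 𝔽₁₁.
    certificate : (ℕ → Poly 5) → List (ℕ × Exponents 5 × Poly 5)
    certificate R =
        (7 , 2 ∷ 0 ∷ 1 ∷ 0 ∷ 0 ∷ [] , R 66) ∷ (1 , 0 ∷ 3 ∷ 0 ∷ 0 ∷ 0 ∷ [] , R 66) ∷ (1 , 0 ∷ 1 ∷ 1 ∷ 0 ∷ 1 ∷ [] , R 66)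
      ∷ (1 , 3 ∷ 0 ∷ 0 ∷ 0 ∷ 0 ∷ [] , R 11) ∷ (1 , 1 ∷ 1 ∷ 0 ∷ 0 ∷ 1 ∷ [] , R 11) ∷ (7 , 0 ∷ 0 ∷ 0 ∷ 2 ∷ 1 ∷ [] , R 11)
      ∷ (1 , 1 ∷ 0 ∷ 1 ∷ 1 ∷ 0 ∷ [] , R 55) ∷ (7 , 1 ∷ 0 ∷ 0 ∷ 0 ∷ 2 ∷ [] , R 55) ∷ (1 , 0 ∷ 0 ∷ 3 ∷ 0 ∷ 0 ∷ [] , R 55)
      ∷ (7 , 0 ∷ 2 ∷ 0 ∷ 1 ∷ 0 ∷ [] , R 77) ∷ (1 , 0 ∷ 0 ∷ 1 ∷ 1 ∷ 1 ∷ [] , R 77) ∷ (1 , 0 ∷ 0 ∷ 0 ∷ 0 ∷ 3 ∷ [] , R 77)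
      ∷ (1 , 1 ∷ 1 ∷ 0 ∷ 1 ∷ 0 ∷ [] , R 99) ∷ (7 , 0 ∷ 1 ∷ 2 ∷ 0 ∷ 0 ∷ [] , R 99) ∷ (1 , 0 ∷ 0 ∷ 0 ∷ 3 ∷ 0 ∷ [] , R 99) ∷ []

    certificate-all : ∀ {V : Poly 5 → Set} R → V (R 66) → V (R 11) → V (R 55) → V (R 77) → V (R 99) →
      All (λ (_ , _ , P) → V P) (certificate R)
    certificate-all R z₁ z₂ z₃ z₄ z₅ = z₁ ∷ z₁ ∷ z₁ ∷ z₂ ∷ z₂ ∷ z₂ ∷ z₃ ∷ z₃ ∷ z₃ ∷ z₄ ∷ z₄ ∷ z₄ ∷ z₅ ∷ z₅ ∷ z₅ ∷ []

    -- All that remains visible of the expansions once they are opaque: that they are powers of the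
    -- sum of the five variables, and that the certificate checks.
    record Expansions : Set where
      field
        J⁴ J⁷     : Poly 5
        J⁴-power  : J⁴ ≡ powerOfSum units 4
        J⁷-power  : J⁷ ≡ powerOfSum units 7
        certified : vanishesMod 11 (combination (component 121 degrees 11 J⁷) (certificate (λ r → component 121 degrees r J⁴))) ≡ true

    -- Abstract, so that later conversion checks do not unfold the large normal forms.
    abstract

      expansions : Expansions
      expansions = record
        { J⁴ = powerOfSum units 4
        ; J⁷ = powerOfSum units 7
        ; J⁴-power  = ≡.refl
        ; J⁷-power  = ≡.refl
        ; certified = ≡.refl
        }

    open Expansions expansions public

    R : ℕ → Poly 5
    R r = component 121 degrees r J⁴

    T : Poly 5
    T = component 121 degrees 11 J⁷

-- Ramanujan's congruences modulo 7 and 11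

module PartitionSeries where

  open import Data.Empty using (⊥-elim)
  open import Data.Integer as ℤ using (ℤ; +_)
  import Data.Integer.Properties as ℤ
  open import Data.Integer.Divisibility.Signed using (_∣_; divides; ∣ᵤ⇒∣; ∣m⇒∣m*n; ∣n⇒∣m*n)
  open import Data.List using (List; []; _∷_)
  open import Data.List.Membership.DecPropositional as Membership using ()
  open import Data.List.Membership.Propositional using (_∈_)
  open import Data.List.Relation.Unary.All using (All; []; _∷_)
  open import Data.List.Relation.Unary.Unique.DecPropositional using (unique?)
  open import Data.Nat as ℕ using (ℕ; zero; suc; _≤_)
  import Data.Nat.Divisibility as ℕ
  open import Data.Nat.DivMod using (_%_; [m+kn]%n≡m%n)
  import Data.Nat.Properties as ℕ
  open import Data.Nat.Solver using (module +-*-Solver)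
  open import Data.Product using (_×_; _,_)
  open import Data.Sum using (_⊎_; inj₁; inj₂)
  open import Data.Unit using (tt)
  open import Data.Vec as Vec using ([]; _∷_)
  open import Relation.Binary.PropositionalEquality as ≡ using (_≡_; _≢_)
  open import Relation.Nullary.Decidable using (from-yes; from-no)
  open import Relation.Nullary using (¬_; Dec; yes; no)
  open PowerSeries
  open Polynomials
  open Multipliers
  open ThetaExponents using (tri; pent; sgn; jac)

  open Membership ℕ._≟_ using (_∈?_)

  module Shift where
    open +-*-Solver

    -- tri (m + 7) - tri m = 7(m + 4), and 14 · 7 = 2 · 49.
    tri-7 : ∀ m → 14 ℕ.* tri (7 ℕ.+ m) ≡ 14 ℕ.* tri m ℕ.+ 2 ℕ.* (m ℕ.+ 4) ℕ.* 49
    tri-7 m = solve 2 (λ m t → con 14 :* (con 7 :+ m :+ (con 6 :+ m :+ (con 5 :+ m :+ (con 4 :+ m :+ (con 3 :+ m :+ (con 2 :+ m :+ (con 1 :+ m :+ t)))))))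
      := con 14 :* t :+ con 2 :* (m :+ con 4) :* con 49) ≡.refl m (tri m)

    tri-11 : ∀ m → 22 ℕ.* tri (11 ℕ.+ m) ≡ 22 ℕ.* tri m ℕ.+ 2 ℕ.* (m ℕ.+ 6) ℕ.* 121
    tri-11 m = solve 2 (λ m t → con 22 :* (con 11 :+ m :+ (con 10 :+ m :+ (con 9 :+ m :+ (con 8 :+ m :+ (con 7 :+ m :+ (con 6 :+ m :+ (con 5 :+ m :+ (con 4 :+ m :+ (con 3 :+ m :+ (con 2 :+ m :+ (con 1 :+ m :+ t)))))))))))
      := con 22 :* t :+ con 2 :* (m :+ con 6) :* con 121) ≡.refl m (tri m)

    pent-11 : ∀ m → pent (11 ℕ.+ m) ≡ pent m ℕ.+ (3 ℕ.* m ℕ.+ 16) ℕ.* 11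
    pent-11 m = solve 2 (λ m t →
      let g = λ k → con k :+ m :+ (con k :+ m :+ (con k :+ m)) :+ con 1
      in g 10 :+ (g 9 :+ (g 8 :+ (g 7 :+ (g 6 :+ (g 5 :+ (g 4 :+ (g 3 :+ (g 2 :+ (g 1 :+ (m :+ (m :+ m) :+ con 1 :+ t))))))))))
      := t :+ (con 3 :* m :+ con 16) :* con 11) ≡.refl m (pent m)

    pent-11-22 : ∀ m → 22 ℕ.* pent (11 ℕ.+ m) ≡ 22 ℕ.* pent m ℕ.+ 2 ℕ.* (3 ℕ.* m ℕ.+ 16) ℕ.* 121
    pent-11-22 m = ≡.trans (≡.cong (22 ℕ.*_) (pent-11 m)) (solve 2 (λ m t → con 22 :* (t :+ (con 3 :* m :+ con 16) :* con 11) := con 22 :* t :+ con 2 :* (con 3 :* m :+ con 16) :* con 121) ≡.refl m (pent m))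

    pent′-11-22 : ∀ m → 22 ℕ.* (pent (11 ℕ.+ m) ℕ.+ (4 ℕ.* (11 ℕ.+ m) ℕ.+ 2)) ≡ 22 ℕ.* (pent m ℕ.+ (4 ℕ.* m ℕ.+ 2)) ℕ.+ 2 ℕ.* (3 ℕ.* m ℕ.+ 20) ℕ.* 121
    pent′-11-22 m = ≡.trans (≡.cong (λ x → 22 ℕ.* (x ℕ.+ (4 ℕ.* (11 ℕ.+ m) ℕ.+ 2))) (pent-11 m)) (solve 2 (λ m t → con 22 :* ((t :+ (con 3 :* m :+ con 16) :* con 11) :+ (con 4 :* (con 11 :+ m) :+ con 2))
      := con 22 :* (t :+ (con 4 :* m :+ con 2)) :+ con 2 :* (con 3 :* m :+ con 20) :* con 121) ≡.refl m (pent m))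

    odd-shift : ∀ p m → suc (p ℕ.+ m ℕ.+ (p ℕ.+ m)) ≡ 2 ℕ.* p ℕ.+ suc (m ℕ.+ m)
    odd-shift p m = solve 2 (λ p m → con 1 :+ (p :+ m :+ (p :+ m)) := con 2 :* p :+ (con 1 :+ (m :+ m))) ≡.refl p m

  periodic : ∀ {M rs} .{{_ : ℕ.NonZero M}} {a b} k → a ≡ b ℕ.+ k ℕ.* M → b % M ∈ rs → a % M ∈ rs
  periodic {M} {rs} {a} {b} k ≡.refl b∈ = ≡.subst (_∈ rs) (≡.sym ([m+kn]%n≡m%n b k M)) b∈

  odd-periodic : ∀ p m → p ℕ.∣ suc (m ℕ.+ m) → p ℕ.∣ suc (p ℕ.+ m ℕ.+ (p ℕ.+ m))
  odd-periodic p m d = ≡.subst (p ℕ.∣_) (≡.sym (Shift.odd-shift p m)) (ℕ.∣m∣n⇒∣m+n (ℕ.n∣m*n 2) d)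

  module Residues₇ where

    rs : List ℕ
    rs = 0 ∷ 14 ∷ 42 ∷ []

    -- The remaining class tri m ≡ 6 (mod 7) occurs only for m ≡ 3 (mod 7), where 7 divides the
    -- coefficient 2m + 1 of Jacobi's series.
    tri-residue : ∀ m → (14 ℕ.* tri m) % 49 ∈ rs ⊎ 7 ℕ.∣ suc (m ℕ.+ m)
    tri-residue 0 = inj₁ (from-yes (0 ∈? rs))
    tri-residue 1 = inj₁ (from-yes (14 ∈? rs))
    tri-residue 2 = inj₁ (from-yes (42 ∈? rs))
    tri-residue 3 = inj₂ (from-yes (7 ℕ.∣? 7))
    tri-residue 4 = inj₁ (from-yes (42 ∈? rs))
    tri-residue 5 = inj₁ (from-yes (14 ∈? rs))
    tri-residue 6 = inj₁ (from-yes (0 ∈? rs))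
    tri-residue (suc (suc (suc (suc (suc (suc (suc m))))))) with tri-residue m
    ... | inj₁ r = inj₁ (periodic (2 ℕ.* (m ℕ.+ 4)) (Shift.tri-7 m) r)
    ... | inj₂ d = inj₂ (odd-periodic 7 m d)

  module Residues₁₁ where

    -- 22 times the triangular classes, and 22 times the pentagonal classes 0, 1, 2, 5, 7, 4 modulo
    -- 11. The absent pentagonal classes 3, 6, 8, 9, 10 become 66, 11, 55, 77, 99 modulo 121, the
    -- indices of the quartic relations.
    rs es : List ℕ
    rs = 0 ∷ 22 ∷ 66 ∷ 11 ∷ 99 ∷ []
    es = 0 ∷ 22 ∷ 44 ∷ 110 ∷ 33 ∷ 88 ∷ []

    tri-residue : ∀ m → (22 ℕ.* tri m) % 121 ∈ rs ⊎ 11 ℕ.∣ suc (m ℕ.+ m)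
    tri-residue 0  = inj₁ (from-yes (0 ∈? rs))
    tri-residue 1  = inj₁ (from-yes (22 ∈? rs))
    tri-residue 2  = inj₁ (from-yes (66 ∈? rs))
    tri-residue 3  = inj₁ (from-yes (11 ∈? rs))
    tri-residue 4  = inj₁ (from-yes (99 ∈? rs))
    tri-residue 5  = inj₂ (from-yes (11 ℕ.∣? 11))
    tri-residue 6  = inj₁ (from-yes (99 ∈? rs))
    tri-residue 7  = inj₁ (from-yes (11 ∈? rs))
    tri-residue 8  = inj₁ (from-yes (66 ∈? rs))
    tri-residue 9  = inj₁ (from-yes (22 ∈? rs))
    tri-residue 10 = inj₁ (from-yes (0 ∈? rs))
    tri-residue (suc (suc (suc (suc (suc (suc (suc (suc (suc (suc (suc m))))))))))) with tri-residue m
    ... | inj₁ r = inj₁ (periodic (2 ℕ.* (m ℕ.+ 6)) (Shift.tri-11 m) r)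
    ... | inj₂ d = inj₂ (odd-periodic 11 m d)

    pent-residue : ∀ m → (22 ℕ.* pent m) % 121 ∈ es × (22 ℕ.* (pent m ℕ.+ (4 ℕ.* m ℕ.+ 2))) % 121 ∈ es
    pent-residue 0  = from-yes (0 ∈? es) , from-yes (44 ∈? es)
    pent-residue 1  = from-yes (22 ∈? es) , from-yes (33 ∈? es)
    pent-residue 2  = from-yes (110 ∈? es) , from-yes (88 ∈? es)
    pent-residue 3  = from-yes (22 ∈? es) , from-yes (88 ∈? es)
    pent-residue 4  = from-yes (0 ∈? es) , from-yes (33 ∈? es)
    pent-residue 5  = from-yes (44 ∈? es) , from-yes (44 ∈? es)
    pent-residue 6  = from-yes (33 ∈? es) , from-yes (0 ∈? es)
    pent-residue 7  = from-yes (88 ∈? es) , from-yes (22 ∈? es)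
    pent-residue 8  = from-yes (88 ∈? es) , from-yes (110 ∈? es)
    pent-residue 9  = from-yes (33 ∈? es) , from-yes (22 ∈? es)
    pent-residue 10 = from-yes (44 ∈? es) , from-yes (0 ∈? es)
    pent-residue (suc (suc (suc (suc (suc (suc (suc (suc (suc (suc (suc m))))))))))) with pent-residue m
    ... | r , r′ = periodic (2 ℕ.* (3 ℕ.* m ℕ.+ 16)) (Shift.pent-11-22 m) r , periodic (2 ℕ.* (3 ℕ.* m ℕ.+ 20)) (Shift.pent′-11-22 m) r′

  module Terms (p N M : ℕ) .{{_ : ℕ.NonZero M}} .{{_ : ℕ.NonZero (2 ℕ.* p)}} where

    open SeriesModulo p N
    open Support p N M public
    open ThetaCoefficients p N using (scaled-coefficient)
    open import Relation.Binary.Reasoning.Setoid setoid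

    -- The variable q^(2p) of 1/E_2p. Class t modulo p for exponents of s is class 2pt modulo p² for
    -- exponents of q.
    s : Carrier
    s = (X ^ 2) ^ p

    s^≈X^ : ∀ e → s ^ e ≈ X ^ (2 ℕ.* p ℕ.* e)
    s^≈X^ e = trans (^-congˡ e (^-assocʳ X 2 p)) (^-assocʳ X (2 ℕ.* p) e)

    s-nilpotent : s ^ suc N ≈ 0#
    s-nilpotent = trans (s^≈X^ (suc N)) (Nilpotent.^-vanish X (suc N) X-nilpotent (ℕ.m≤n*m (suc N) (2 ℕ.* p)))

    p≈0 : fromℤ (+ p) ≈ 0#
    p≈0 = trans (ThetaCoefficients.fromℕ-constant p N p) λ
      { zero n≤N → ∣⇒≋0 (divides (+ 1) (≡.sym (ℤ.*-identityˡ (+ p)))) ; (suc n) n≤N → ≋-reflexive ≡.refl }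

    scaled-supported : ∀ {S} k {f} → Supported S f ⊎ + p ∣ k → Supported S (fromℤ k * f)
    scaled-supported k {f} h = supported λ {n} n≤N n∉S → ≋-trans (scaled-coefficient k f n≤N) (∣⇒≋0 (case h n≤N n∉S))
      where
      case : ∀ {S} → Supported S f ⊎ + p ∣ k → ∀ {n} → n ≤ N → ¬ S (n % M) → + p ∣ k ℤ.* f n
      case (inj₁ hf) n≤N n∉S = ∣n⇒∣m*n k (≋0⇒∣ (off hf n≤N n∉S))
      case (inj₂ d) {n} _ _  = ∣m⇒∣m*n (f n) d

    power-supported : ∀ {S : ℕ → Set} e → S ((2 ℕ.* p ℕ.* e) % M) → Supported S (s ^ e)
    power-supported {S} e e∈S = supported-≈ (s^≈X^ e)
      (supported λ n≤N n∉S → off (homogeneous-X^ (2 ℕ.* p ℕ.* e)) n≤N (λ n≡ → n∉S (≡.subst S (≡.sym n≡) e∈S)))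

    jacobi-supported : ∀ {rs} L → (∀ m → (2 ℕ.* p ℕ.* tri m) % M ∈ rs ⊎ p ℕ.∣ suc (m ℕ.+ m)) →
      Supported (_∈ rs) (∑ L (Identities.Jacobi.w s (suc N) s-nilpotent))
    jacobi-supported {rs} L h = supported-∑ L λ m → scaled-supported (jac m) (dichotomy m (h m))
      where
      dichotomy : ∀ m → (2 ℕ.* p ℕ.* tri m) % M ∈ rs ⊎ p ℕ.∣ suc (m ℕ.+ m) → Supported (_∈ rs) (s ^ tri m) ⊎ + p ∣ jac m
      dichotomy m (inj₁ r) = inj₁ (power-supported {_∈ rs} (tri m) r)
      dichotomy m (inj₂ d) = inj₂ (∣n⇒∣m*n (sgn m) (∣ᵤ⇒∣ d))

    euler-supported : ∀ {es} L → (∀ m → (2 ℕ.* p ℕ.* pent m) % M ∈ es × (2 ℕ.* p ℕ.* (pent m ℕ.+ (4 ℕ.* m ℕ.+ 2))) % M ∈ es) →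
      Supported (_∈ es) (∑ L (Identities.Euler.w s (suc N) s-nilpotent))
    euler-supported {es} L h = supported-∑ L λ m → scaled-supported (sgn m) (inj₁ (difference m (h m)))
      where
      difference : ∀ m → (2 ℕ.* p ℕ.* pent m) % M ∈ es × (2 ℕ.* p ℕ.* (pent m ℕ.+ (4 ℕ.* m ℕ.+ 2))) % M ∈ es →
        Supported (_∈ es) (s ^ pent m - s ^ (pent m ℕ.+ (4 ℕ.* m ℕ.+ 2)))
      difference m (e , e′) = supported-+ (power-supported {_∈ es} (pent m) e)
        (supported-neg (power-supported {_∈ es} (pent m ℕ.+ (4 ℕ.* m ℕ.+ 2)) e′))

  module Partitions₇ (N : ℕ) where

    open SeriesModulo 7 N
    open Terms 7 N 49 public
    open Products ring
    open PolynomialEvaluation ring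
    open import Relation.Binary.Reasoning.Setoid setoid

    frobenius : ∀ x → (1# - x) ^ 7 ≈ 1# - x ^ 7
    frobenius = frobenius-7 p≈0

    s^7-nilpotent : (s ^ 7) ^ suc N ≈ 0#
    s^7-nilpotent = Identities.q^k-nilpotent s (suc N) s-nilpotent 6

    open PartitionInverse 7 frobenius s (suc N) s-nilpotent s^7-nilpotent

    ρ : Vec.Vec Carrier 3
    ρ = part J 0 ∷ part J 14 ∷ part J 42 ∷ []

    units : List (Exponents 3)
    units = (1 ∷ 0 ∷ 0 ∷ []) ∷ (0 ∷ 1 ∷ 0 ∷ []) ∷ (0 ∷ 0 ∷ 1 ∷ []) ∷ []

    open Evaluation ρ
    open Graded (0 ∷ 14 ∷ 42 ∷ [])

    J-parts : powers units ≈ J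
    J-parts = trans
      -- The left side is `powers units` unfolded; each i is a trivial factor 1 left over from an
      -- exponent 0 or 1.
      (solve 3 (λ x y z → let i = con (+ 1) in x :* i :* (i :* (i :* i)) :+ (i :* (y :* i :* (i :* i)) :+ (i :* (i :* (z :* i :* i)) :+ con (+ 0)))
        := x :+ (y :+ (z :+ con (+ 0)))) refl (part J 0) (part J 14) (part J 42))
      (λ n n≤N → parts-sum J Residues₇.rs (from-yes (unique? ℕ._≟_ Residues₇.rs))
        (jacobi-supported (suc (suc N ℕ.+ suc N)) Residues₇.tri-residue) n≤N)

    ρ-homogeneous : HomogeneousVec (0 ∷ 14 ∷ 42 ∷ []) ρ
    ρ-homogeneous = part-homogeneous J (from-yes (0 ℕ.<? 49)) , part-homogeneous J (from-yes (14 ℕ.<? 49)) , part-homogeneous J (from-yes (42 ℕ.<? 49)) , tt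

    -- No two of the residues 0, 14, 42 add up to 21 modulo 49.
    J²-supported : Supported (_≢ 21) (J ^ 2)
    J²-supported = supported-≈ (sym (trans (eval-powerOfSum units 2) (^-congˡ 2 J-parts)))
      (supported λ {n} n≤N n∉ → case n≤N (n % 49 ℕ.≟ 21) n∉)
      where
      case : ∀ {n} → n ≤ N → Dec (n % 49 ≡ 21) → ¬ (n % 49 ≢ 21) → eval (powerOfSum units 2) n ≋ + 0
      -- The component of class 21 computes to the empty polynomial, so its value is 0
      -- definitionally.
      case n≤N (yes n≡) _ = component-coefficient ρ ρ-homogeneous 21 (powerOfSum units 2) n≤N n≡
      case n≤N (no n≢) n∉ = ⊥-elim (n∉ n≢)

    H-supported : Supported (_≢ 21) H
    H-supported = supported-≈ (H-7 ≡.refl) (supported-* J²-supported (homogeneous-poch⁻¹ s^7-homogeneous {suc N} s^7-nilpotent (suc N)))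
      where
      s^7-homogeneous : Homogeneous 0 (s ^ 7)
      -- s^7 = q^98 and 98 = 2 · 49.
      s^7-homogeneous = power-supported {_≡ 0} 7 ≡.refl

  module Partitions₁₁ (N : ℕ) where

    open SeriesModulo 11 N
    open Terms 11 N 121 public
    open Products ring
    open PolynomialEvaluation ring
    open import Relation.Binary.Reasoning.Setoid setoid

    frobenius : ∀ x → (1# - x) ^ 11 ≈ 1# - x ^ 11
    frobenius = frobenius-11 p≈0

    s^11-nilpotent : (s ^ 11) ^ suc N ≈ 0#
    s^11-nilpotent = Identities.q^k-nilpotent s (suc N) s-nilpotent 10

    open PartitionInverse 11 frobenius s (suc N) s-nilpotent s^11-nilpotent

    ρ : Vec.Vec Carrier 5
    ρ = part J 0 ∷ part J 22 ∷ part J 66 ∷ part J 11 ∷ part J 99 ∷ []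

    open Evaluation ρ
    open Certificate₁₁
    open Graded degrees

    J-parts : powers units ≈ J
    J-parts = trans
      (solve 5 (λ x y z u v → let i = con (+ 1) in
        x :* i :* (i :* (i :* (i :* (i :* i)))) :+ (i :* (y :* i :* (i :* (i :* (i :* i)))) :+ (i :* (i :* (z :* i :* (i :* (i :* i))))
          :+ (i :* (i :* (i :* (u :* i :* (i :* i)))) :+ (i :* (i :* (i :* (i :* (v :* i :* i)))) :+ con (+ 0)))))
        := x :+ (y :+ (z :+ (u :+ (v :+ con (+ 0)))))) refl (part J 0) (part J 22) (part J 66) (part J 11) (part J 99))
      (λ n n≤N → parts-sum J Residues₁₁.rs (from-yes (unique? ℕ._≟_ Residues₁₁.rs))
        (jacobi-supported (suc (suc N ℕ.+ suc N)) Residues₁₁.tri-residue) n≤N)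

    ρ-homogeneous : HomogeneousVec degrees ρ
    ρ-homogeneous = part-homogeneous J (from-yes (0 ℕ.<? 121)) , part-homogeneous J (from-yes (22 ℕ.<? 121))
      , part-homogeneous J (from-yes (66 ℕ.<? 121)) , part-homogeneous J (from-yes (11 ℕ.<? 121)) , part-homogeneous J (from-yes (99 ℕ.<? 121)) , tt

    eval-power : ∀ k {P} → P ≡ powerOfSum units k → eval P ≈ J ^ k
    eval-power k ≡.refl = trans (eval-powerOfSum units k) (^-congˡ k J-parts)

    s^11-homogeneous : Homogeneous 0 (s ^ 11)
    s^11-homogeneous = power-supported {_≡ 0} 11 ≡.refl

    J⁴-supported : Supported (_∈ Residues₁₁.es) (J ^ 4)
    J⁴-supported = supported-≈ (J^4-11 ≡.refl) (supported-* (euler-supported (suc (suc N ℕ.+ suc N)) Residues₁₁.pent-residue)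
      (homogeneous-poch s^11-homogeneous {suc N} s^11-nilpotent (suc N)))

    -- The quartic relations among the parts of J: the terms of class r in the expansion of J⁴ must
    -- sum to 0, because Euler's series and E₁₁, both taken in s, leave no exponents there.
    J⁴-component : ∀ r → ¬ (r % 121 ∈ Residues₁₁.es) → eval (R r) ≈ 0#
    J⁴-component r r∉ = component-vanishes ρ ρ-homogeneous r J⁴
      (supported λ n≤N n∉ → off (supported-≈ (eval-power 4 J⁴-power) J⁴-supported) n≤N (λ n∈ → n∉ (λ { n≡ → r∉ (≡.subst (_∈ Residues₁₁.es) n≡ n∈) })))

    certificate-vanishes : All (λ (_ , _ , P) → eval P ≈ 0#) (certificate R)
    certificate-vanishes = certificate-all {V = λ P → eval P ≈ 0#} R
      (J⁴-component 66 (from-no (66 ∈? Residues₁₁.es))) (J⁴-component 11 (from-no (11 ∈? Residues₁₁.es)))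
      (J⁴-component 55 (from-no (55 ∈? Residues₁₁.es))) (J⁴-component 77 (from-no (77 ∈? Residues₁₁.es)))
      (J⁴-component 99 (from-no (99 ∈? Residues₁₁.es)))

    J⁷-component : eval T ≈ 0#
    J⁷-component = eval-certified 11 p≈0 T (certificate R) certificate-vanishes certified

    J⁷-supported : Supported (_≢ 11) (J ^ 7)
    J⁷-supported = supported-≈ (sym (eval-power 7 J⁷-power)) (supported λ {n} n≤N n∉ → case n≤N (n % 121 ℕ.≟ 11) n∉)
      where
      case : ∀ {n} → n ≤ N → Dec (n % 121 ≡ 11) → ¬ (n % 121 ≢ 11) → eval J⁷ n ≋ + 0
      case {n} n≤N (yes n≡) _ = ≋-trans {eval J⁷ n} {eval T n} (component-coefficient ρ ρ-homogeneous 11 J⁷ n≤N n≡) (J⁷-component n n≤N)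
      case n≤N (no n≢) n∉ = ⊥-elim (n∉ n≢)

    H-supported : Supported (_≢ 11) H
    H-supported = supported-≈ (H-11 ≡.refl) (supported-* J⁷-supported
      (homogeneous-* 0 0 Z-homogeneous Z-homogeneous))
      where
      Z-homogeneous : Homogeneous 0 Z
      Z-homogeneous = homogeneous-poch⁻¹ s^11-homogeneous {suc N} s^11-nilpotent (suc N)

-- Splitting the coefficient of `theta` times 1/E_2p

module Congruences where

  open import Data.Integer as ℤ using (ℤ; +_)
  import Data.Integer.Properties as ℤ
  open import Data.Integer.Divisibility.Signed using (_∣_; divides; ∣⇒∣ᵤ; ∣m⇒∣m*n; ∣n⇒∣m*n)
  open import Data.Integer.Solver using (module +-*-Solver)
  open import Data.Nat as ℕ using (ℕ; zero; suc; _≤_; s≤s)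
  import Data.Nat.Divisibility as ℕ
  open import Data.Nat.DivMod using (_%_; _/_; m≡m%n+[m/n]*n; [m+kn]%n≡m%n)
  open import Data.Nat.Primality using (prime?)
  import Data.Nat.Properties as ℕ
  import Data.Nat.Solver as ℕS
  open import Data.Product using (_×_; _,_)
  open import Relation.Binary.PropositionalEquality using (_≡_; refl; sym; trans; cong; subst)
  open import Relation.Nullary using (¬_; yes; no)
  open import Relation.Nullary.Decidable using (from-yes; from-no)
  open import Defs using (a; partialProd)
  open PowerSeries using (∣-⊛)
  open Cancellations using (module ThetaVanishing)
  open Reflections using (ρ₇; ρ₁₁)
  open PartitionSeries using (module Partitions₇; module Partitions₁₁)

  module Arithmetic where
    open +-*-Solver

    -- The constant is 24 · 31 + 5 = 7 · 107.
    divisible-7 : ∀ i j n → i ℤ.+ + 7 ℤ.* j ≡ + 49 ℤ.* n ℤ.+ + 31 →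
      + 24 ℤ.* i ℤ.+ + 5 ≡ (+ 168 ℤ.* n ℤ.+ + 107 ℤ.- + 24 ℤ.* j) ℤ.* + 7
    divisible-7 i j n eq = trans
      (solve 2 (λ i j → con (+ 24) :* i :+ con (+ 5) := con (+ 24) :* (i :+ con (+ 7) :* j) :+ con (+ 5) :- con (+ 168) :* j) refl i j)
      (trans (cong (λ x → + 24 ℤ.* x ℤ.+ + 5 ℤ.- + 168 ℤ.* j) eq)
      (solve 2 (λ j n → con (+ 24) :* (con (+ 49) :* n :+ con (+ 31)) :+ con (+ 5) :- con (+ 168) :* j
        := (con (+ 168) :* n :+ con (+ 107) :- con (+ 24) :* j) :* con (+ 7)) refl j n))

    -- The constant is 24 · 36 + 5 = 11 · 79.
    divisible-11 : ∀ i j n → i ℤ.+ + 11 ℤ.* j ≡ + 121 ℤ.* n ℤ.+ + 36 →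
      + 24 ℤ.* i ℤ.+ + 5 ≡ (+ 264 ℤ.* n ℤ.+ + 79 ℤ.- + 24 ℤ.* j) ℤ.* + 11
    divisible-11 i j n eq = trans
      (solve 2 (λ i j → con (+ 24) :* i :+ con (+ 5) := con (+ 24) :* (i :+ con (+ 11) :* j) :+ con (+ 5) :- con (+ 264) :* j) refl i j)
      (trans (cong (λ x → + 24 ℤ.* x ℤ.+ + 5 ℤ.- + 264 ℤ.* j) eq)
      (solve 2 (λ j n → con (+ 24) :* (con (+ 121) :* n :+ con (+ 36)) :+ con (+ 5) :- con (+ 264) :* j
        := (con (+ 264) :* n :+ con (+ 79) :- con (+ 24) :* j) :* con (+ 11)) refl j n))

    -- After one division, 7 divides 16(168n + 107 - 24j). Here 16 · 168 = 7 · 384, 16 · 107 = 7 ·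
    -- 244 + 4 and -16 · 24 = -7 · 55 + 1, which leaves j + 4 modulo 7.
    square-7 : ∀ D j n → D ≡ (+ 168 ℤ.* n ℤ.+ + 107 ℤ.- + 24 ℤ.* j) ℤ.* + 7 → + 7 ℤ.* + 7 ∣ + 16 ℤ.* D → + 7 ∣ j ℤ.+ + 4
    square-7 D j n refl (divides q eq) = divides (q ℤ.- (+ 384 ℤ.* n ℤ.+ + 244 ℤ.- + 55 ℤ.* j))
      (ℤ.*-cancelʳ-≡ (j ℤ.+ + 4) ((q ℤ.- (+ 384 ℤ.* n ℤ.+ + 244 ℤ.- + 55 ℤ.* j)) ℤ.* + 7) (+ 7)
      (trans (solve 2 (λ j n → (j :+ con (+ 4)) :* con (+ 7)
          := con (+ 16) :* ((con (+ 168) :* n :+ con (+ 107) :- con (+ 24) :* j) :* con (+ 7)) :- (con (+ 384) :* n :+ con (+ 244) :- con (+ 55) :* j) :* con (+ 49)) refl j n)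
      (trans (cong (λ x → x ℤ.- (+ 384 ℤ.* n ℤ.+ + 244 ℤ.- + 55 ℤ.* j) ℤ.* + 49) eq)
      (solve 2 (λ q x → q :* con (+ 49) :- x :* con (+ 49) := (q :- x) :* con (+ 7) :* con (+ 7)) refl q (+ 384 ℤ.* n ℤ.+ + 244 ℤ.- + 55 ℤ.* j)))))

    -- The same with 16 · 264 = 11 · 384, 16 · 79 = 11 · 114 + 10 and -16 · 24 = -11 · 35 + 1.
    square-11 : ∀ D j n → D ≡ (+ 264 ℤ.* n ℤ.+ + 79 ℤ.- + 24 ℤ.* j) ℤ.* + 11 → + 11 ℤ.* + 11 ∣ + 16 ℤ.* D → + 11 ∣ j ℤ.+ + 10
    square-11 D j n refl (divides q eq) = divides (q ℤ.- (+ 384 ℤ.* n ℤ.+ + 114 ℤ.- + 35 ℤ.* j))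
      (ℤ.*-cancelʳ-≡ (j ℤ.+ + 10) ((q ℤ.- (+ 384 ℤ.* n ℤ.+ + 114 ℤ.- + 35 ℤ.* j)) ℤ.* + 11) (+ 11)
      (trans (solve 2 (λ j n → (j :+ con (+ 10)) :* con (+ 11)
          := con (+ 16) :* ((con (+ 264) :* n :+ con (+ 79) :- con (+ 24) :* j) :* con (+ 11)) :- (con (+ 384) :* n :+ con (+ 114) :- con (+ 35) :* j) :* con (+ 121)) refl j n)
      (trans (cong (λ x → x ℤ.- (+ 384 ℤ.* n ℤ.+ + 114 ℤ.- + 35 ℤ.* j) ℤ.* + 121) eq)
      (solve 2 (λ q x → q :* con (+ 121) :- x :* con (+ 121) := (q :- x) :* con (+ 11) :* con (+ 11)) refl q (+ 384 ℤ.* n ℤ.+ + 114 ℤ.- + 35 ℤ.* j)))))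

  residue-7 : ∀ j → 7 ℕ.∣ j ℕ.+ 4 → (7 ℕ.* j) % 49 ≡ 21
  residue-7 j (ℕ.divides zero eq) with () ← trans (ℕ.+-comm 4 j) eq
  residue-7 j (ℕ.divides (suc c) eq) = trans (cong (λ k → (7 ℕ.* k) % 49) j≡) (trans (cong (_% 49) (solve 1 (λ c → con 7 :* (con 3 :+ c :* con 7) := con 21 :+ c :* con 49) refl c)) ([m+kn]%n≡m%n 21 c 49))
    where
    open ℕS.+-*-Solver
    j≡ : j ≡ 3 ℕ.+ c ℕ.* 7
    j≡ = ℕ.+-cancelˡ-≡ 4 j (3 ℕ.+ c ℕ.* 7) (trans (ℕ.+-comm 4 j) eq)

  residue-11 : ∀ j → 11 ℕ.∣ j ℕ.+ 10 → (11 ℕ.* j) % 121 ≡ 11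
  residue-11 j (ℕ.divides zero eq) with () ← trans (ℕ.+-comm 10 j) eq
  residue-11 j (ℕ.divides (suc c) eq) = trans (cong (λ k → (11 ℕ.* k) % 121) j≡) (trans (cong (_% 121) (solve 1 (λ c → con 11 :* (con 1 :+ c :* con 11) := con 11 :+ c :* con 121) refl c)) ([m+kn]%n≡m%n 11 c 121))
    where
    open ℕS.+-*-Solver
    j≡ : j ≡ 1 ℕ.+ c ℕ.* 11
    j≡ = ℕ.+-cancelˡ-≡ 10 j (1 ℕ.+ c ℕ.* 11) (trans (ℕ.+-comm 10 j) eq)

  multiple : ∀ p .{{_ : ℕ.NonZero p}} j → j % p ≡ 0 → j ≡ p ℕ.* (j / p)
  multiple p j eq = trans (m≡m%n+[m/n]*n j p) (trans (cong (ℕ._+ j / p ℕ.* p) eq) (ℕ.*-comm (j / p) p))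

  embed-equation : ∀ i p j m n r → i ℕ.+ p ℕ.* j ≡ m ℕ.* n ℕ.+ r → + i ℤ.+ + p ℤ.* + j ≡ + m ℤ.* + n ℤ.+ + r
  embed-equation i p j m n r eq = trans (cong (λ x → + i ℤ.+ x) (sym (ℤ.pos-* p j))) (trans (cong +_ eq) (cong (λ x → x ℤ.+ + r) (ℤ.pos-* m n)))

  module Case₇ (n : ℕ) where

    N : ℕ
    N = 49 ℕ.* n ℕ.+ 31

    open SeriesModulo 7 N hiding (refl; sym; trans)
    open Partitions₇ N using (s; s-nilpotent; frobenius; H-supported; off)
    module A = Products.ColouredPartitions ring X embed embed-one divGeom-inverse
    module F = Products.Factorisation ring 4 X (suc N) X-nilpotent s-nilpotent frobenius
      (embed (partialProd 5 N)) (A.partialProd-inverse-stable 4 N X-nilpotent)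
    module S = Support 7 N 7

    H : Carrier
    H = F.Nₛ.poch⁻¹ (suc N)

    H-homogeneous : S.Homogeneous 0 H
    H-homogeneous = S.homogeneous-poch⁻¹ (S.supported-≈ (^-assocʳ X 2 7) (S.homogeneous-X^ 14)) {suc N} s-nilpotent (suc N)

    -- The number of terms in the sums of `theta` for K = N + 1, so that the lattice argument
    -- applies to exactly these sums.
    L : ℕ
    L = suc (suc N ℕ.+ suc N)

    theta-vanishes : ∀ i → i ≤ N → + 7 ∣ + 24 ℤ.* + i ℤ.+ + 5 → ¬ + 7 ℤ.* + 7 ∣ + 16 ℤ.* (+ 24 ℤ.* + i ℤ.+ + 5) → F.theta i ≋ + 0
    theta-vanishes i i≤N d ∤ = ≋-trans (ThetaCoefficients.theta-coefficient 7 N L i≤N)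
      (≋-reflexive (ThetaVanishing.vanishing 7 (+ 3) (from-yes (prime? 7)) refl (λ d → from-no (7 ℕ.∣? 3) (∣⇒∣ᵤ d)) ρ₇ i L
        (ℕ.≤-trans (s≤s i≤N) (ℕ.≤-trans (ℕ.m≤m+n (suc N) (suc N)) (ℕ.n≤1+n _))) d ∤))

    -- Each product of the Cauchy sum vanishes by itself: for 7 ∤ j because H is a series in q^14,
    -- for j ≡ 21 (mod 49) by Ramanujan's congruence, and otherwise because 7 divides 24i + 5
    -- exactly once.
    terms : ∀ i j → i ℕ.+ j ≡ N → + 7 ∣ F.theta i ℤ.* H j
    terms i j eq with j % 7 ℕ.≟ 0
    ... | no j≢0 = ∣n⇒∣m*n (F.theta i) (≋0⇒∣ (S.off H-homogeneous (subst (j ≤_) eq (ℕ.m≤n+m j i)) j≢0))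
    ... | yes j≡0 with j % 49 ℕ.≟ 21
    ...   | yes j≡21 = ∣n⇒∣m*n (F.theta i) (≋0⇒∣ (off H-supported (subst (j ≤_) eq (ℕ.m≤n+m j i)) (λ j≢21 → j≢21 j≡21)))
    ...   | no j≢21 = ∣m⇒∣m*n (H j) (≋0⇒∣ (theta-vanishes i (subst (i ≤_) eq (ℕ.m≤m+n i j)) (divides (+ 168 ℤ.* + n ℤ.+ + 107 ℤ.- + 24 ℤ.* + j′) D≡) ∤))
      where
      j′ : ℕ
      j′ = j / 7
      j≡ : j ≡ 7 ℕ.* j′
      j≡ = multiple 7 j j≡0
      D≡ : + 24 ℤ.* + i ℤ.+ + 5 ≡ (+ 168 ℤ.* + n ℤ.+ + 107 ℤ.- + 24 ℤ.* + j′) ℤ.* + 7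
      D≡ = Arithmetic.divisible-7 (+ i) (+ j′) (+ n) (embed-equation i 7 j′ 49 n 31 (trans (cong (i ℕ.+_) (sym j≡)) eq))
      ∤ : ¬ + 7 ℤ.* + 7 ∣ + 16 ℤ.* (+ 24 ℤ.* + i ℤ.+ + 5)
      ∤ d = j≢21 (trans (cong (_% 49) j≡) (residue-7 j′ (∣⇒∣ᵤ (Arithmetic.square-7 (+ 24 ℤ.* + i ℤ.+ + 5) (+ j′) (+ n) D≡ d))))

    result : 7 ℕ.∣ a 5 N
    -- By definition `a 5 N` is coefficient N of `partialProd 5 N`, so the factorisation is read at
    -- that one coefficient.
    result = ∣⇒∣ᵤ (≋0⇒∣ (≋-trans (F.factorisation N ℕ.≤-refl) (∣⇒≋0 (∣-⊛ F.theta H N terms))))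

  module Case₁₁ (n : ℕ) where

    N : ℕ
    N = 121 ℕ.* n ℕ.+ 36

    open SeriesModulo 11 N hiding (refl; sym; trans)
    open Partitions₁₁ N using (s; s-nilpotent; frobenius; H-supported; off)
    module A = Products.ColouredPartitions ring X embed embed-one divGeom-inverse
    module F = Products.Factorisation ring 8 X (suc N) X-nilpotent s-nilpotent frobenius
      (embed (partialProd 9 N)) (A.partialProd-inverse-stable 8 N X-nilpotent)
    module S = Support 11 N 11

    H : Carrier
    H = F.Nₛ.poch⁻¹ (suc N)

    H-homogeneous : S.Homogeneous 0 H
    H-homogeneous = S.homogeneous-poch⁻¹ (S.supported-≈ (^-assocʳ X 2 11) (S.homogeneous-X^ 22)) {suc N} s-nilpotent (suc N)

    L : ℕ
    L = suc (suc N ℕ.+ suc N)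

    theta-vanishes : ∀ i → i ≤ N → + 11 ∣ + 24 ℤ.* + i ℤ.+ + 5 → ¬ + 11 ℤ.* + 11 ∣ + 16 ℤ.* (+ 24 ℤ.* + i ℤ.+ + 5) → F.theta i ≋ + 0
    theta-vanishes i i≤N d ∤ = ≋-trans (ThetaCoefficients.theta-coefficient 11 N L i≤N)
      (≋-reflexive (ThetaVanishing.vanishing 11 (+ 5) (from-yes (prime? 11)) refl (λ d → from-no (11 ℕ.∣? 3) (∣⇒∣ᵤ d)) ρ₁₁ i L
        (ℕ.≤-trans (s≤s i≤N) (ℕ.≤-trans (ℕ.m≤m+n (suc N) (suc N)) (ℕ.n≤1+n _))) d ∤))

    -- As for 7; the exceptional class 11 modulo 121 is 22 · 6, the class of the partition numbers
    -- p(11k + 6).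
    terms : ∀ i j → i ℕ.+ j ≡ N → + 11 ∣ F.theta i ℤ.* H j
    terms i j eq with j % 11 ℕ.≟ 0
    ... | no j≢0 = ∣n⇒∣m*n (F.theta i) (≋0⇒∣ (S.off H-homogeneous (subst (j ≤_) eq (ℕ.m≤n+m j i)) j≢0))
    ... | yes j≡0 with j % 121 ℕ.≟ 11
    ...   | yes j≡11 = ∣n⇒∣m*n (F.theta i) (≋0⇒∣ (off H-supported (subst (j ≤_) eq (ℕ.m≤n+m j i)) (λ j≢11 → j≢11 j≡11)))
    ...   | no j≢11 = ∣m⇒∣m*n (H j) (≋0⇒∣ (theta-vanishes i (subst (i ≤_) eq (ℕ.m≤m+n i j)) (divides (+ 264 ℤ.* + n ℤ.+ + 79 ℤ.- + 24 ℤ.* + j′) D≡) ∤))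
      where
      j′ : ℕ
      j′ = j / 11
      j≡ : j ≡ 11 ℕ.* j′
      j≡ = multiple 11 j j≡0
      D≡ : + 24 ℤ.* + i ℤ.+ + 5 ≡ (+ 264 ℤ.* + n ℤ.+ + 79 ℤ.- + 24 ℤ.* + j′) ℤ.* + 11
      D≡ = Arithmetic.divisible-11 (+ i) (+ j′) (+ n) (embed-equation i 11 j′ 121 n 36 (trans (cong (i ℕ.+_) (sym j≡)) eq))
      ∤ : ¬ + 11 ℤ.* + 11 ∣ + 16 ℤ.* (+ 24 ℤ.* + i ℤ.+ + 5)
      ∤ d = j≢11 (trans (cong (_% 121) j≡) (residue-11 j′ (∣⇒∣ᵤ (Arithmetic.square-11 (+ 24 ℤ.* + i ℤ.+ + 5) (+ j′) (+ n) D≡ d))))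

    result : 11 ℕ.∣ a 9 N
    result = ∣⇒∣ᵤ (≋0⇒∣ (≋-trans (F.factorisation N ℕ.≤-refl) (∣⇒≋0 (∣-⊛ F.theta H N terms))))

open import Defs
open import Data.Nat using (_+_; _*_)
open import Data.Nat.Divisibility using (_∣_)
open import Data.Product using (_×_; _,_)

theorem7p1 : (n : ℕ) → (7 ∣ a 5 (49 * n + 31)) × (11 ∣ a 9 (121 * n + 36))
theorem7p1 n = Congruences.Case₇.result n , Congruences.Case₁₁.result n
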